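{- $\mathbf{CF}\subseteq\mathbf{P_{/poly}}$.
   Context: Binary strings of length $n$ are identified with vectors in $\{0,1\}^n$. $\mathbf{CF}$ is the set of languages $L\subseteq\{0,1\}^*$ for which there exists a polynomial $p$ such that for every $n\in\mathbb{N}$ there exist $A\in\mathbb{R}^{p(n)\times n}$, $B\in\mathbb{R}^{p(n)\times p(n)}$, $b\in\mathbb{R}^{p(n)}$ with $\operatorname{conv}(\{x\in L: |x|=n\})=\{x\in\mathbb{R}^n\mid\exists y\in\mathbb{R}^{p(n)}: Ax+By\le b\}$. $\mathbf{P_{/poly}}$ is the class of languages decidable by families of polynomial-size Boolean circuits (equivalently, by polynomial-time Turing machines with polynomial-length advice depending only on the input length). -}

module Defs where

open import Data.Bool.Base as Bool using (Bool; true; false; if_then_else_)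
open import Data.Fin.Base using (Fin)
open import Data.List.Base as List using (List)
open import Data.Nat.Base as ℕ using (ℕ; suc)
import Data.Nat.Properties as ℕ
open import Data.Integer.Base using (+_)
open import Data.Product.Base using (∃-syntax; Σ-syntax; _×_; _,_)
open import Data.Rational.Base as ℚ using (ℚ; 0ℚ; 1ℚ; ½; ∣_∣)
import Data.Rational.Properties as ℚ
open import Data.Rational.Solver using (module +-*-Solver)
open import Data.Vec.Base as Vec using (Vec; lookup; toList)
open import Data.Vec.Functional using (Vector; foldr; zipWith)
open import Function.Bundles using (_⇔_)
open import Level using (0ℓ)
open import Relation.Binary.PropositionalEquality
  using (_≡_; refl; sym; trans; cong; cong₂; subst)
open import Relation.Unary using (Pred; _∈_; _≐_)

------------------------------------------------------------------------
-- Real numbers: Cauchy sequences of rationals, where _≈_ identifies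
-- two sequences whose difference tends to zero.

IsCauchy : (ℕ → ℚ) → Set
IsCauchy s = ∀ ε → 0ℚ ℚ.< ε → ∃[ N ] ∀ m n → N ℕ.≤ m → N ℕ.≤ n →
             ∣ s m ℚ.- s n ∣ ℚ.< ε

record ℝ : Set where
  constructor mkℝ
  field
    seq    : ℕ → ℚ
    cauchy : IsCauchy seq

open ℝ public

infix  4 _≈_ _≤_
infixl 6 _+_
infixl 7 _*_

_≈_ : ℝ → ℝ → Set
x ≈ y = ∀ ε → 0ℚ ℚ.< ε → ∃[ N ] ∀ n → N ℕ.≤ n → ∣ seq x n ℚ.- seq y n ∣ ℚ.< ε

-- A termwise comparison would not respect _≈_, hence the slack ε.
_≤_ : ℝ → ℝ → Set
x ≤ y = ∀ ε → 0ℚ ℚ.< ε → ∃[ N ] ∀ n → N ℕ.≤ n → seq x n ℚ.≤ seq y n ℚ.+ ε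

private
  open ℚ.≤-Reasoning
  open +-*-Solver using (solve; _:=_; _:+_; _:*_; _:-_)

  const-cauchy : ∀ q → IsCauchy (λ _ → q)
  const-cauchy q ε ε>0 = 0 , λ _ _ _ _ →
    subst (ℚ._< ε) (sym (cong ∣_∣ (ℚ.+-inverseʳ q))) ε>0

  half+half : ∀ ε → ½ ℚ.* ε ℚ.+ ½ ℚ.* ε ≡ ε
  half+half ε = trans (sym (ℚ.*-distribʳ-+ ε ½ ½)) (ℚ.*-identityˡ ε)

  half>0 : ∀ {ε} → 0ℚ ℚ.< ε → 0ℚ ℚ.< ½ ℚ.* ε
  half>0 ε>0 = ℚ.*-monoʳ-<-pos ½ ε>0

  +-cauchy : ∀ s t → IsCauchy s → IsCauchy t → IsCauchy (λ n → s n ℚ.+ t n)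
  +-cauchy s t cs ct ε ε>0
    with cs (½ ℚ.* ε) (half>0 ε>0) | ct (½ ℚ.* ε) (half>0 ε>0)
  ... | M , close-s | N , close-t = M ℕ.⊔ N , λ m n m≥ n≥ → begin-strict
    ∣ (s m ℚ.+ t m) ℚ.- (s n ℚ.+ t n) ∣
      ≡⟨ cong ∣_∣ (solve 4 (λ a b c d → (a :+ b) :- (c :+ d) := (a :- c) :+ (b :- d))
                     refl (s m) (t m) (s n) (t n)) ⟩
    ∣ (s m ℚ.- s n) ℚ.+ (t m ℚ.- t n) ∣
      ≤⟨ ℚ.∣p+q∣≤∣p∣+∣q∣ (s m ℚ.- s n) (t m ℚ.- t n) ⟩
    ∣ s m ℚ.- s n ∣ ℚ.+ ∣ t m ℚ.- t n ∣
      <⟨ ℚ.+-mono-< (close-s m n (ℕ.m⊔n≤o⇒m≤o M N m≥) (ℕ.m⊔n≤o⇒m≤o M N n≥))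
                    (close-t m n (ℕ.m⊔n≤o⇒n≤o M N m≥) (ℕ.m⊔n≤o⇒n≤o M N n≥)) ⟩
    ½ ℚ.* ε ℚ.+ ½ ℚ.* ε
      ≡⟨ half+half ε ⟩
    ε ∎

  bounded : ∀ {s} → IsCauchy s →
            ∃[ B ] (0ℚ ℚ.< B × ∃[ N ] ∀ n → N ℕ.≤ n → ∣ s n ∣ ℚ.≤ B)
  bounded {s} cs with cs 1ℚ (ℚ.positive⁻¹ 1ℚ)
  ... | N , close =
    1ℚ ℚ.+ ∣ s N ∣ , ℚ.+-mono-<-≤ (ℚ.positive⁻¹ 1ℚ) (ℚ.0≤∣p∣ (s N)) , N , λ n n≥ → begin
      ∣ s n ∣
        ≡⟨ cong ∣_∣ (solve 2 (λ a b → a := (a :- b) :+ b) refl (s n) (s N)) ⟩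
      ∣ (s n ℚ.- s N) ℚ.+ s N ∣
        ≤⟨ ℚ.∣p+q∣≤∣p∣+∣q∣ (s n ℚ.- s N) (s N) ⟩
      ∣ s n ℚ.- s N ∣ ℚ.+ ∣ s N ∣
        ≤⟨ ℚ.+-monoˡ-≤ ∣ s N ∣ (ℚ.<⇒≤ (close n N n≥ ℕ.≤-refl)) ⟩
      1ℚ ℚ.+ ∣ s N ∣ ∎

  scale : ∀ {K ε} → 0ℚ ℚ.< K → 0ℚ ℚ.< ε → ∃[ δ ] (0ℚ ℚ.< δ × K ℚ.* δ ≡ ε)
  scale {K} {ε} K>0 ε>0 = 1/K ℚ.* ε , δ>0 , Kδ≡ε
    where
    instance
      K⁺ = ℚ.positive K>0
      K≢0 = ℚ.pos⇒nonZero K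
    1/K = ℚ.1/ K
    δ>0 : 0ℚ ℚ.< 1/K ℚ.* ε
    δ>0 = subst (ℚ._< 1/K ℚ.* ε) (ℚ.*-zeroʳ 1/K)
            (ℚ.*-monoʳ-<-pos 1/K {{ℚ.1/pos⇒pos K}} ε>0)
    Kδ≡ε : K ℚ.* (1/K ℚ.* ε) ≡ ε
    Kδ≡ε = trans (sym (ℚ.*-assoc K 1/K ε))
             (trans (cong (ℚ._* ε) (ℚ.*-inverseʳ K)) (ℚ.*-identityˡ ε))

  *-mono-≤-< : ∀ {a A d δ} → 0ℚ ℚ.< A → a ℚ.≤ A → 0ℚ ℚ.≤ d → d ℚ.< δ → a ℚ.* d ℚ.< A ℚ.* δ
  *-mono-≤-< {a} {A} {d} {δ} A>0 a≤A d≥0 d<δ = begin-strict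
    a ℚ.* d  ≤⟨ ℚ.*-monoʳ-≤-nonNeg d {{ℚ.nonNegative d≥0}} a≤A ⟩
    A ℚ.* d  <⟨ ℚ.*-monoʳ-<-pos A {{ℚ.positive A>0}} d<δ ⟩
    A ℚ.* δ  ∎

  split : ∀ a b c d → a ℚ.* b ℚ.- c ℚ.* d ≡ a ℚ.* (b ℚ.- d) ℚ.+ d ℚ.* (a ℚ.- c)
  split = solve 4 (λ a b c d → a :* b :- c :* d := a :* (b :- d) :+ d :* (a :- c)) refl

  *-close : ∀ {A B δ} a b c d → 0ℚ ℚ.< A → 0ℚ ℚ.< B → ∣ a ∣ ℚ.≤ A → ∣ d ∣ ℚ.≤ B →
            ∣ b ℚ.- d ∣ ℚ.< δ → ∣ a ℚ.- c ∣ ℚ.< δ →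
            ∣ a ℚ.* b ℚ.- c ℚ.* d ∣ ℚ.< (A ℚ.+ B) ℚ.* δ
  *-close {A} {B} {δ} a b c d A>0 B>0 a≤A d≤B b≈d a≈c = begin-strict
    ∣ a ℚ.* b ℚ.- c ℚ.* d ∣
      ≡⟨ cong ∣_∣ (split a b c d) ⟩
    ∣ a ℚ.* (b ℚ.- d) ℚ.+ d ℚ.* (a ℚ.- c) ∣
      ≤⟨ ℚ.∣p+q∣≤∣p∣+∣q∣ (a ℚ.* (b ℚ.- d)) (d ℚ.* (a ℚ.- c)) ⟩
    ∣ a ℚ.* (b ℚ.- d) ∣ ℚ.+ ∣ d ℚ.* (a ℚ.- c) ∣
      ≡⟨ cong₂ ℚ._+_ (ℚ.∣p*q∣≡∣p∣*∣q∣ a (b ℚ.- d)) (ℚ.∣p*q∣≡∣p∣*∣q∣ d (a ℚ.- c)) ⟩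
    ∣ a ∣ ℚ.* ∣ b ℚ.- d ∣ ℚ.+ ∣ d ∣ ℚ.* ∣ a ℚ.- c ∣
      <⟨ ℚ.+-mono-< (*-mono-≤-< A>0 a≤A (ℚ.0≤∣p∣ (b ℚ.- d)) b≈d)
                    (*-mono-≤-< B>0 d≤B (ℚ.0≤∣p∣ (a ℚ.- c)) a≈c) ⟩
    A ℚ.* δ ℚ.+ B ℚ.* δ
      ≡⟨ sym (ℚ.*-distribʳ-+ δ A B) ⟩
    (A ℚ.+ B) ℚ.* δ ∎

  *-cauchy : ∀ s t → IsCauchy s → IsCauchy t → IsCauchy (λ n → s n ℚ.* t n)
  *-cauchy s t cs ct ε ε>0 =
    let A , A>0 , N₁ , s≤A = bounded cs
        B , B>0 , N₂ , t≤B = bounded ct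
        δ , δ>0 , [A+B]δ≡ε = scale (ℚ.+-mono-< A>0 B>0) ε>0
        N₃ , close-s       = cs δ δ>0
        N₄ , close-t       = ct δ δ>0
        N₁₂ = N₁ ℕ.⊔ N₂
        N₃₄ = N₃ ℕ.⊔ N₄
    in N₁₂ ℕ.⊔ N₃₄ , λ m n m≥ n≥ →
      let m≥N₁₂ = ℕ.m⊔n≤o⇒m≤o N₁₂ N₃₄ m≥
          m≥N₃₄ = ℕ.m⊔n≤o⇒n≤o N₁₂ N₃₄ m≥
          n≥N₁₂ = ℕ.m⊔n≤o⇒m≤o N₁₂ N₃₄ n≥
          n≥N₃₄ = ℕ.m⊔n≤o⇒n≤o N₁₂ N₃₄ n≥
      in subst (∣ s m ℚ.* t m ℚ.- s n ℚ.* t n ∣ ℚ.<_) [A+B]δ≡ε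
           (*-close (s m) (t m) (s n) (t n) A>0 B>0
             (s≤A m (ℕ.m⊔n≤o⇒m≤o N₁ N₂ m≥N₁₂)) (t≤B n (ℕ.m⊔n≤o⇒n≤o N₁ N₂ n≥N₁₂))
             (close-t m n (ℕ.m⊔n≤o⇒n≤o N₃ N₄ m≥N₃₄) (ℕ.m⊔n≤o⇒n≤o N₃ N₄ n≥N₃₄))
             (close-s m n (ℕ.m⊔n≤o⇒m≤o N₃ N₄ m≥N₃₄) (ℕ.m⊔n≤o⇒m≤o N₃ N₄ n≥N₃₄)))

fromℚ : ℚ → ℝ
fromℚ q = mkℝ (λ _ → q) (const-cauchy q)

0ℝ 1ℝ : ℝ
0ℝ = fromℚ 0ℚ
1ℝ = fromℚ 1ℚ

_+_ : ℝ → ℝ → ℝ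
x + y = mkℝ (λ n → seq x n ℚ.+ seq y n) (+-cauchy (seq x) (seq y) (cauchy x) (cauchy y))

_*_ : ℝ → ℝ → ℝ
x * y = mkℝ (λ n → seq x n ℚ.* seq y n) (*-cauchy (seq x) (seq y) (cauchy x) (cauchy y))

------------------------------------------------------------------------
-- Vectors, matrices and convex hulls

infix  4 _≈ᵛ_ _≤ᵛ_
infixl 6 _+ᵛ_
infixr 7 _·_

ℝ^_ : ℕ → Set
ℝ^ n = Vector ℝ n

Matrix : ℕ → ℕ → Set
Matrix m n = Vector (ℝ^ n) m

_≈ᵛ_ _≤ᵛ_ : ∀ {n} → ℝ^ n → ℝ^ n → Set
x ≈ᵛ y = ∀ i → x i ≈ y i
x ≤ᵛ y = ∀ i → x i ≤ y i

_+ᵛ_ : ∀ {n} → ℝ^ n → ℝ^ n → ℝ^ n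
_+ᵛ_ = zipWith _+_

∑ : ∀ {n} → ℝ^ n → ℝ
∑ = foldr _+_ 0ℝ

_·_ : ∀ {m n} → Matrix m n → ℝ^ n → ℝ^ m
(A · x) i = ∑ (λ j → A i j * x j)

conv : ∀ {n} → Pred (ℝ^ n) 0ℓ → Pred (ℝ^ n) 0ℓ
conv {n} S x = ∃[ k ] Σ[ c ∈ ℝ^ k ] Σ[ v ∈ Vector (ℝ^ n) k ]
  (∀ i → 0ℝ ≤ c i) ×
  ∑ c ≈ 1ℝ ×
  (∀ i → v i ∈ S) ×
  x ≈ᵛ (λ j → ∑ (λ i → c i * v i j))

------------------------------------------------------------------------
-- Languages and polynomials

Language : Set₁
Language = Pred (List Bool) 0ℓ

bitVector : ∀ {n} → Vec Bool n → ℝ^ n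
bitVector w i = if lookup w i then 1ℝ else 0ℝ

-- The words of length n in L, as a subset of {0,1}ⁿ ⊆ ℝⁿ.
slice : Language → (n : ℕ) → Pred (ℝ^ n) 0ℓ
slice L n x = Σ[ w ∈ Vec Bool n ] toList w ∈ L × x ≈ᵛ bitVector w

fromℕ : ℕ → ℚ
fromℕ n = + n ℚ./ 1

-- Coefficients are listed from the constant term upwards.
evalPoly : List ℚ → ℚ → ℚ
evalPoly as x = List.foldr (λ a r → a ℚ.+ x ℚ.* r) 0ℚ as

-- A polynomial taking values in ℕ at all points of ℕ has rational
-- coefficients, but not necessarily integral ones: n(n-1)/2.
IsPolynomial : Pred (ℕ → ℕ) 0ℓ
IsPolynomial p = ∃[ as ] ∀ n → fromℕ (p n) ≡ evalPoly as (fromℕ n)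

------------------------------------------------------------------------
-- Compact extended formulations

projection : ∀ {m n k} → Matrix m n → Matrix m k → ℝ^ m → Pred (ℝ^ n) 0ℓ
projection {k = k} A B b x = Σ[ y ∈ ℝ^ k ] A · x +ᵛ B · y ≤ᵛ b

CF : Pred Language 0ℓ
CF L = ∃[ p ] IsPolynomial p × ∀ n →
  Σ[ A ∈ Matrix (p n) n ] Σ[ B ∈ Matrix (p n) (p n) ] Σ[ b ∈ ℝ^ (p n) ]
    conv (slice L n) ≐ projection A B b

------------------------------------------------------------------------
-- Boolean circuits

data Gate (wires : ℕ) : Set where
  const   : Bool → Gate wires
  not     : Fin wires → Gate wires
  and or  : (i j : Fin wires) → Gate wires

infixl 5 _▷_

-- Gates in topological order; each one may read all n inputs and all
-- earlier gates, so fan-out is unrestricted.  The index s counts gates.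
data Gates (n : ℕ) : ℕ → Set where
  []  : Gates n 0
  _▷_ : ∀ {s} → Gates n s → Gate (s ℕ.+ n) → Gates n (suc s)

record Circuit (n s : ℕ) : Set where
  field
    gates  : Gates n s
    output : Fin (s ℕ.+ n)

evalGate : ∀ {m} → Gate m → Vec Bool m → Bool
evalGate (const b) w = b
evalGate (not i)   w = Bool.not (lookup w i)
evalGate (and i j) w = lookup w i Bool.∧ lookup w j
evalGate (or i j)  w = lookup w i Bool.∨ lookup w j

-- The value of the newest gate comes first, the inputs come last.
evalGates : ∀ {n s} → Gates n s → Vec Bool n → Vec Bool (s ℕ.+ n)
evalGates []       w = w
evalGates (gs ▷ g) w = let vs = evalGates gs w in evalGate g vs Vec.∷ vs

evalCircuit : ∀ {n s} → Circuit n s → Vec Bool n → Bool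
evalCircuit C w = lookup (evalGates (Circuit.gates C) w) (Circuit.output C)

P/poly : Pred Language 0ℓ
P/poly L = ∃[ q ] IsPolynomial q × ∀ n →
  ∃[ s ] s ℕ.≤ q n × Σ[ C ∈ Circuit n s ] ∀ w →
    toList w ∈ L ⇔ evalCircuit C w ≡ true

-- A word w outside L has Hamming distance at least 1 from every point of
-- the hull of L ∩ {0,1}ⁿ, while a word of L is a point of the hull.  This
-- gap allows the linear program "is (w , y) feasible for some y?" to be
-- solved approximately, as follows.
--
-- By compactness the real data can be replaced by rational ones: a late
-- term of the Cauchy sequences, with slightly relaxed right-hand sides and
-- a box around y.  Relaxing makes every slack positive at the words of L,
-- so each slack can be scaled to have maximum 1 over L.  Averaging with the
-- maximisers then shows that for w ∉ L the system stays infeasible when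
-- every constraint is relaxed by δ, where 1/δ is polynomial in n.
--
-- Let z collect the coordinates x and the scaled slacks; it ranges over an
-- affine subspace with direction space V, and let P k ∈ V be the orthogonal
-- projection of the k-th unit vector.  Starting from the point of some word
-- of L, repeatedly move by ±ε P k whenever the k-th constraint is violated.
-- If z* is feasible, each move decreases ∣z − z*∣² by ε², so a polynomial
-- number of moves suffices.  Rounding the coordinates of z to a grid leaves
-- polynomially many letters per coordinate; with one wire per letter, each
-- update is a disjunction over pairs of letters.

module Submission where

open import Defs hiding (_+_; _*_; _≤_; _≈_)
import Defs as ℝ
open import Axiom.ExcludedMiddle using (ExcludedMiddle)
open import Level using (0ℓ)
open import Relation.Unary using (_⊆_; Pred)
open import Algebra.Properties.Semiring.Sum as Sum using ()
open import Algebra.Bundles using (CommutativeRing)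
open import Data.Bool.Base as Bool using (Bool; true; false; if_then_else_)
open import Data.Empty using (⊥; ⊥-elim)
open import Data.Fin.Base as Fin using (Fin; zero; suc; toℕ)
import Data.Fin.Properties as Fin
open import Data.List.Relation.Unary.All as All using (All; []; _∷_)
import Data.List.Properties as List
import Data.List.Membership.Propositional.Properties as List
open import Data.List.Base as List using (List; []; _∷_)
open import Data.Maybe.Base using (Maybe; just; nothing; is-nothing)
open import Data.Nat.Base as ℕ using (ℕ; zero; suc)
import Data.Nat.Properties as ℕ
import Data.Bool.Properties as Bool
open import Data.Integer.Base as ℤ using ()
import Data.Integer.Properties as ℤ
open import Data.Product.Base using (∃-syntax; Σ-syntax; Σ; _×_; _,_; proj₁; proj₂)
open import Data.Sum.Base using (_⊎_; inj₁; inj₂; [_,_])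
open import Data.Rational.Base as ℚ using (ℚ; 0ℚ; 1ℚ; ½; _+_; _*_; _-_; -_; _≤_; _<_; ∣_∣)
import Data.Rational.Properties as ℚ
import Data.Rational.Unnormalised.Base as ℚᵘ
import Data.Rational.Unnormalised.Properties as ℚᵘ
open import Data.Vec.Base as Vec using (Vec; lookup; toList)
open import Function.Base using (_∘_; case_of_)
open import Function.Bundles using (_⇔_; mk⇔; Equivalence)
open import Relation.Binary.PropositionalEquality
  using (_≡_; _≢_; refl; sym; trans; cong; cong₂; subst; module ≡-Reasoning)
open import Relation.Binary.Definitions using (tri<; tri≈; tri>)
open import Relation.Nullary using (¬_; Dec; yes; no; does)
open import Relation.Nullary.Decidable.Core using (dec⇒maybe)
import Tactic.RingSolver as RingSolver
import Tactic.RingSolver.Core.AlmostCommutativeRing as ACR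

open Sum (CommutativeRing.semiring ℚ.+-*-commutativeRing)
  using (sum; sum-cong-≗; ∑-distrib-+; *-distribˡ-sum; ∑-comm)

-- The obstacle is that compactness yields rational data without any bound on their bit length, so a
-- small circuit cannot calculate with them. The relaxation method avoids this: a move at k changes
-- coordinate i by the fixed number `η * P k i`, so a new letter depends on two old letters only and
-- the data disappear into a finite table. The estimates use nothing of the coefficients except that
-- `P k` reproduces the k-th coordinate on V and has norm at most 1. Subtracting the bits of w from
-- the coordinates x translates the affine subspace but leaves V alone, so one family P serves all
-- inputs and w enters only through the initial letters. The order of the constraints is fixed in
-- advance; satisfied ones are passed over, and a sweep without any move certifies that all
-- constraints nearly hold. Moves are triggered beyond 2ε and rounding costs at most ε, hence the
-- tolerance δ is 3ε. It is chosen so that δ(m+1) is at most θ = 1/(2n+1), and n θ ≤ ½ keeps points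
-- θ-close to w out of the hull. Excluded middle serves compactness and the decision of membership:
-- circuits are only shown to exist.

ring : ACR.AlmostCommutativeRing 0ℓ 0ℓ
ring = ACR.fromCommutativeRing ℚ.+-*-commutativeRing λ q → dec⇒maybe (0ℚ ℚ.≟ q)

-- Ordered-field arithmetic

0≤1 : 0ℚ ≤ 1ℚ
0≤1 = ℚ.nonNegative⁻¹ 1ℚ

0<1 : 0ℚ < 1ℚ
0<1 = ℚ.positive⁻¹ 1ℚ

0≤+ : ∀ {p q} → 0ℚ ≤ p → 0ℚ ≤ q → 0ℚ ≤ p + q
0≤+ = ℚ.+-mono-≤

0≤* : ∀ {p q} → 0ℚ ≤ p → 0ℚ ≤ q → 0ℚ ≤ p * q
0≤* {p} {q} 0≤p 0≤q = subst (_≤ p * q) (ℚ.*-zeroʳ p)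
  (ℚ.*-monoˡ-≤-nonNeg p {{ℚ.nonNegative 0≤p}} 0≤q)

0<* : ∀ {p q} → 0ℚ < p → 0ℚ < q → 0ℚ < p * q
0<* {p} {q} 0<p 0<q = subst (_< p * q) (ℚ.*-zeroʳ p)
  (ℚ.*-monoʳ-<-pos p {{ℚ.positive 0<p}} 0<q)

0≤-diff : ∀ {p q} → p ≤ q → 0ℚ ≤ q - p
0≤-diff {p} {q} p≤q = subst (_≤ q - p) (ℚ.+-inverseʳ p) (ℚ.+-monoˡ-≤ (- p) p≤q)

≤-by : ∀ {p q} r → 0ℚ ≤ r → q ≡ p + r → p ≤ q
≤-by {p} r 0≤r refl = subst (_≤ p + r) (ℚ.+-identityʳ p) (ℚ.+-monoʳ-≤ p 0≤r)

<-by : ∀ {p q} r → 0ℚ < r → q ≡ p + r → p < q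
<-by {p} r 0<r refl = subst (_< p + r) (ℚ.+-identityʳ p) (ℚ.+-monoʳ-< p 0<r)

0<-diff : ∀ {p q} → p < q → 0ℚ < q - p
0<-diff {p} {q} p<q = subst (_< q - p) (ℚ.+-inverseʳ p) (ℚ.+-monoˡ-< (- p) p<q)

<⇒≱ : ∀ {p q} → p < q → ¬ (q ≤ p)
<⇒≱ p<q q≤p = ℚ.<-irrefl refl (ℚ.<-≤-trans p<q q≤p)

neg*neg : ∀ p → (- p) * (- p) ≡ p * p
neg*neg = RingSolver.solve-∀ ring

0≤-square : ∀ p → 0ℚ ≤ p * p
0≤-square p with ℚ.≤-total 0ℚ p
... | inj₁ 0≤p = 0≤* 0≤p 0≤p
... | inj₂ p≤0 = subst (0ℚ ≤_) (neg*neg p) (0≤* 0≤-p 0≤-p)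
  where
  0≤-p = ℚ.neg-antimono-≤ p≤0

*-mono-≤ : ∀ {p q r s} → 0ℚ ≤ p → 0ℚ ≤ s → p ≤ q → r ≤ s → p * r ≤ q * s
*-mono-≤ {p} {q} {r} {s} 0≤p 0≤s p≤q r≤s = ℚ.≤-trans
  (ℚ.*-monoˡ-≤-nonNeg p {{ℚ.nonNegative 0≤p}} r≤s)
  (ℚ.*-monoʳ-≤-nonNeg s {{ℚ.nonNegative 0≤s}} p≤q)

∣p∣≤q : ∀ {p q} → p ≤ q → - p ≤ q → ∣ p ∣ ≤ q
∣p∣≤q {p} {q} p≤q -p≤q with ℚ.∣p∣≡p∨∣p∣≡-p p
... | inj₁ eq = subst (_≤ q) (sym eq) p≤q
... | inj₂ eq = subst (_≤ q) (sym eq) -p≤q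

p≤∣p∣ : ∀ p → p ≤ ∣ p ∣
p≤∣p∣ p with ℚ.≤-total 0ℚ p
... | inj₁ 0≤p = ℚ.≤-reflexive (sym (ℚ.0≤p⇒∣p∣≡p 0≤p))
... | inj₂ p≤0 = ℚ.≤-trans p≤0 (ℚ.0≤∣p∣ p)

-p≤∣p∣ : ∀ p → - p ≤ ∣ p ∣
-p≤∣p∣ p = subst (- p ≤_) (ℚ.∣-p∣≡∣p∣ p) (p≤∣p∣ (- p))

∣p-q∣≡∣q-p∣ : ∀ p q → ∣ p - q ∣ ≡ ∣ q - p ∣
∣p-q∣≡∣q-p∣ p q = trans (cong ∣_∣ (flip-diff p q)) (ℚ.∣-p∣≡∣p∣ (q - p))
  where
  flip-diff : ∀ p q → p - q ≡ - (q - p)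
  flip-diff = RingSolver.solve-∀ ring

triangle : ∀ p q r → ∣ p - r ∣ ≤ ∣ p - q ∣ + ∣ q - r ∣
triangle p q r = subst (λ t → ∣ t ∣ ≤ ∣ p - q ∣ + ∣ q - r ∣) (telescope p q r)
  (ℚ.∣p+q∣≤∣p∣+∣q∣ (p - q) (q - r))
  where
  telescope : ∀ p q r → (p - q) + (q - r) ≡ p - r
  telescope = RingSolver.solve-∀ ring

sum-nonNeg : ∀ {k} {f : Fin k → ℚ} → (∀ i → 0ℚ ≤ f i) → 0ℚ ≤ sum f
sum-nonNeg {zero}  f≥0 = ℚ.≤-refl
sum-nonNeg {suc k} f≥0 = 0≤+ (f≥0 zero) (sum-nonNeg (f≥0 ∘ suc))

sum-mono : ∀ {k} {f g : Fin k → ℚ} → (∀ i → f i ≤ g i) → sum f ≤ sum g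
sum-mono {zero}  f≤g = ℚ.≤-refl
sum-mono {suc k} f≤g = ℚ.+-mono-≤ (f≤g zero) (sum-mono (f≤g ∘ suc))

term≤sum : ∀ {k} {f : Fin k → ℚ} → (∀ i → 0ℚ ≤ f i) → ∀ i → f i ≤ sum f
term≤sum {suc k} {f} f≥0 zero    = ≤-by _ (sum-nonNeg (f≥0 ∘ suc)) refl
term≤sum {suc k} {f} f≥0 (suc i) = ℚ.≤-trans (term≤sum (f≥0 ∘ suc) i)
  (≤-by (f zero) (f≥0 zero) (ℚ.+-comm (f zero) _))

∣sum∣≤sum∣∣ : ∀ {k} (f : Fin k → ℚ) → ∣ sum f ∣ ≤ sum (λ i → ∣ f i ∣)
∣sum∣≤sum∣∣ {zero}  f = ℚ.≤-refl
∣sum∣≤sum∣∣ {suc k} f = ℚ.≤-trans (ℚ.∣p+q∣≤∣p∣+∣q∣ (f zero) _)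
  (ℚ.+-monoʳ-≤ ∣ f zero ∣ (∣sum∣≤sum∣∣ (f ∘ suc)))

fromℕ-homo-+ : ∀ a b → fromℕ (a ℕ.+ b) ≡ fromℕ a + fromℕ b
fromℕ-homo-+ a b = ℚ.toℚᵘ-injective (ℚᵘ.≃-trans (toℚᵘ-fromℕ (a ℕ.+ b))
  (ℚᵘ.≃-trans (ℚᵘ.*≡* (cong (ℤ._* ℤ.+ 1) (sym (cong₂ ℤ._+_ (ℤ.*-identityʳ (ℤ.+ a)) (ℤ.*-identityʳ (ℤ.+ b))))))
  (ℚᵘ.≃-sym (ℚᵘ.≃-trans (ℚ.toℚᵘ-homo-+ (fromℕ a) (fromℕ b))
    (ℚᵘ.+-cong (toℚᵘ-fromℕ a) (toℚᵘ-fromℕ b))))))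
  where
  toℚᵘ-fromℕ : ∀ a → ℚ.toℚᵘ (fromℕ a) ℚᵘ.≃ ℚᵘ.mkℚᵘ (ℤ.+ a) 0
  toℚᵘ-fromℕ a = ℚ.toℚᵘ-fromℚᵘ (ℚᵘ.mkℚᵘ (ℤ.+ a) 0)

fromℕ-suc : ∀ n → fromℕ (suc n) ≡ 1ℚ + fromℕ n
fromℕ-suc = fromℕ-homo-+ 1

fromℕ-homo-* : ∀ a b → fromℕ (a ℕ.* b) ≡ fromℕ a * fromℕ b
fromℕ-homo-* zero    b = sym (ℚ.*-zeroˡ (fromℕ b))
fromℕ-homo-* (suc a) b = begin
  fromℕ (b ℕ.+ a ℕ.* b)                ≡⟨ fromℕ-homo-+ b (a ℕ.* b) ⟩
  fromℕ b + fromℕ (a ℕ.* b)            ≡⟨ cong (fromℕ b +_) (fromℕ-homo-* a b) ⟩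
  fromℕ b + fromℕ a * fromℕ b          ≡⟨ factor (fromℕ a) (fromℕ b) ⟩
  (1ℚ + fromℕ a) * fromℕ b             ≡⟨ cong (_* fromℕ b) (fromℕ-suc a) ⟨
  fromℕ (suc a) * fromℕ b              ∎
  where
  open ≡-Reasoning
  factor : ∀ x y → y + x * y ≡ (1ℚ + x) * y
  factor = RingSolver.solve-∀ ring

0≤fromℕ : ∀ n → 0ℚ ≤ fromℕ n
0≤fromℕ zero    = ℚ.≤-refl
0≤fromℕ (suc n) = subst (0ℚ ≤_) (sym (fromℕ-suc n)) (0≤+ 0≤1 (0≤fromℕ n))

fromℕ-mono : ∀ {m n} → m ℕ.≤ n → fromℕ m ≤ fromℕ n
fromℕ-mono {m} {n} m≤n = ≤-by (fromℕ (n ℕ.∸ m)) (0≤fromℕ (n ℕ.∸ m))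
  (trans (cong fromℕ (sym (ℕ.m+[n∸m]≡n m≤n))) (fromℕ-homo-+ m (n ℕ.∸ m)))

0<fromℕ-suc : ∀ n → 0ℚ < fromℕ (suc n)
0<fromℕ-suc n = ℚ.<-≤-trans 0<1 (fromℕ-mono {1} {suc n} (ℕ.s≤s ℕ.z≤n))

sum-const : ∀ k c → sum {k} (λ _ → c) ≡ fromℕ k * c
sum-const zero    c = sym (ℚ.*-zeroˡ c)
sum-const (suc k) c = trans (cong (c +_) (sum-const k c))
  (trans (factor (fromℕ k) c) (cong (_* c) (sym (fromℕ-suc k))))
  where
  factor : ∀ x y → y + x * y ≡ (1ℚ + x) * y
  factor = RingSolver.solve-∀ ring

abstract
  archimedean : ∀ q → ∃[ n ] q ≤ fromℕ n
  archimedean q = ℤ.∣ ℚᵘ.↥ (ℚ.toℚᵘ q) ∣ , ℚ.toℚᵘ-cancel-≤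
    (ℚᵘ.≤-respʳ-≃ (ℚᵘ.≃-sym (ℚ.toℚᵘ-fromℚᵘ _))
      (numerator-bound (ℚ.toℚᵘ q)))
    where
    i≤∣i∣ : ∀ i → i ℤ.≤ ℤ.+ ℤ.∣ i ∣
    i≤∣i∣ (ℤ.+ n)        = ℤ.≤-refl
    i≤∣i∣ (ℤ.-[1+ n ]) = ℤ.-≤+
    numerator-bound : ∀ p → p ℚᵘ.≤ ℚᵘ.mkℚᵘ (ℤ.+ ℤ.∣ ℚᵘ.↥ p ∣) 0
    numerator-bound p = ℚᵘ.*≤* (ℤ.≤-trans (ℤ.≤-reflexive (ℤ.*-identityʳ (ℚᵘ.↥ p)))
      (ℤ.≤-trans (i≤∣i∣ (ℚᵘ.↥ p))
        (subst (λ i → ℤ.+ ℤ.∣ ℚᵘ.↥ p ∣ ℤ.≤ i) (ℤ.pos-* ℤ.∣ ℚᵘ.↥ p ∣ (ℚᵘ.↧ₙ p))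
          (ℤ.+≤+ (ℕ.m≤m*n ℤ.∣ ℚᵘ.↥ p ∣ (ℚᵘ.↧ₙ p))))))

  inverse : ∀ {q} → 0ℚ < q → ∃[ r ] (0ℚ < r × q * r ≡ 1ℚ)
  inverse {q} 0<q = ℚ.1/ q , ℚ.positive⁻¹ (ℚ.1/ q) {{ℚ.1/pos⇒pos q}} , ℚ.*-inverseʳ q
    where
    instance
      q⁺ : ℚ.Positive q
      q⁺  = ℚ.positive 0<q
      q≢0 : ℚ.NonZero q
      q≢0 = ℚ.pos⇒nonZero q

small-reciprocal : ∀ {ε} → 0ℚ < ε → ∃[ n ] (∀ m → n ℕ.≤ m → ∀ r → 0ℚ ≤ r → fromℕ (suc m) * r ≡ 1ℚ → r < ε)
small-reciprocal {ε} 0<ε with inverse 0<ε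
... | r , 0<r , εr≡1 with archimedean r
... | n , r≤n = n , λ m n≤m s 0≤s ms≡1 → ℚ.≰⇒> λ ε≤s → ℚ.<-irrefl refl (begin-strict
    1ℚ                  ≡⟨ trans (sym εr≡1) (ℚ.*-comm ε r) ⟩
    r * ε               ≤⟨ *-mono-≤ (ℚ.<⇒≤ 0<r) 0≤s (ℚ.≤-trans r≤n (fromℕ-mono n≤m)) ε≤s ⟩
    fromℕ m * s         <⟨ <-by s (ℚ.<-≤-trans 0<ε ε≤s) (trans (cong (_* s) (fromℕ-suc m)) (expand (fromℕ m) s)) ⟩
    fromℕ (suc m) * s   ≡⟨ ms≡1 ⟩
    1ℚ                  ∎)
  where
  open ℚ.≤-Reasoning
  expand : ∀ x y → (1ℚ + x) * y ≡ x * y + y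
  expand = RingSolver.solve-∀ ring

-- Circuits simulating straight-line programs over a finite alphabet

infix 4 _⊑_

data _⊑_ {n s} (gs : Gates n s) : ∀ {t} → Gates n t → Set where
  done : gs ⊑ gs
  more : ∀ {t} {hs : Gates n t} {g} → gs ⊑ hs → gs ⊑ hs ▷ g

⊑-trans : ∀ {n s t u} {fs : Gates n s} {gs : Gates n t} {hs : Gates n u} →
          fs ⊑ gs → gs ⊑ hs → fs ⊑ hs
⊑-trans p done     = p
⊑-trans p (more q) = more (⊑-trans p q)

Computes : ∀ {n s} → Gates n s → (Vec Bool n → Bool) → Set
Computes {n} {s} gs f = Σ[ i ∈ Fin (s ℕ.+ n) ] (∀ w → lookup (evalGates gs w) i ≡ f w)

-- Values are stored newest first, so each later gate moves an old wire up by one `suc` and leaves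
-- its value alone.
computes-⊑ : ∀ {n s t} {gs : Gates n s} {hs : Gates n t} {f} →
             gs ⊑ hs → Computes gs f → Computes hs f
computes-⊑ done     c = c
computes-⊑ (more p) c with computes-⊑ p c
... | i , eq = suc i , eq

-- The cost is a bound relative to `s`, so the costs of successive extensions add up.
Extension : ∀ {n s} → Gates n s → ℕ → (∀ {t} → Gates n t → Set) → Set
Extension {n} {s} gs c P =
  ∃[ t ] (t ℕ.≤ c ℕ.+ s × Σ[ hs ∈ Gates n t ] (gs ⊑ hs × P hs))

-- Boolean formulas and their compilation into gates

data Formula (V : Set) : Set where
  con     : Bool → Formula V
  var     : V → Formula V
  neg     : Formula V → Formula V
  _∧ᶠ_ _∨ᶠ_ : Formula V → Formula V → Formula V

-- Only new gates count; a variable is free because its wire exists already. The summand of ψ stands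
-- first since its gates are appended after those of φ, which is the order in `compile₂`.
size : ∀ {V} → Formula V → ℕ
size (con b)  = 1
size (var v)  = 0
size (neg φ)  = 1 ℕ.+ size φ
size (φ ∧ᶠ ψ) = 1 ℕ.+ (size ψ ℕ.+ size φ)
size (φ ∨ᶠ ψ) = 1 ℕ.+ (size ψ ℕ.+ size φ)

⟦_⟧ : ∀ {V} → Formula V → (V → Bool) → Bool
⟦ con b ⟧  ρ = b
⟦ var v ⟧  ρ = ρ v
⟦ neg φ ⟧  ρ = Bool.not (⟦ φ ⟧ ρ)
⟦ φ ∧ᶠ ψ ⟧ ρ = ⟦ φ ⟧ ρ Bool.∧ ⟦ ψ ⟧ ρ
⟦ φ ∨ᶠ ψ ⟧ ρ = ⟦ φ ⟧ ρ Bool.∨ ⟦ ψ ⟧ ρ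

module _ {n : ℕ} {V : Set} (ρ : V → Vec Bool n → Bool) where

  value : Formula V → Vec Bool n → Bool
  value φ w = ⟦ φ ⟧ (λ v → ρ v w)

  compile : ∀ {s} (gs : Gates n s) → (∀ v → Computes gs (ρ v)) →
            ∀ φ → Extension gs (size φ) (λ hs → Computes hs (value φ))

  compile₂ : ∀ {s} (gs : Gates n s) → (∀ v → Computes gs (ρ v)) → ∀ φ ψ →
             Extension gs (size ψ ℕ.+ size φ)
               (λ hs → Computes hs (value φ) × Computes hs (value ψ))
  compile₂ {s} gs cs φ ψ with compile gs cs φ
  ... | t , t≤ , hs , p , c with compile hs (λ v → computes-⊑ p (cs v)) ψ
  ... | u , u≤ , is , q , d = u ,
    ℕ.≤-trans u≤ (ℕ.≤-trans (ℕ.+-monoʳ-≤ (size ψ) t≤)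
      (ℕ.≤-reflexive (sym (ℕ.+-assoc (size ψ) (size φ) s)))) ,
    is , ⊑-trans p q , computes-⊑ q c , d

  compile {s} gs cs (con b) = suc s , ℕ.≤-refl , gs ▷ const b , more done , zero , λ w → refl
  compile {s} gs cs (var v) = s , ℕ.≤-refl , gs , done , cs v
  compile gs cs (neg φ) with compile gs cs φ
  ... | t , t≤ , hs , p , i , eq =
    suc t , ℕ.s≤s t≤ , hs ▷ not i , more p , zero , λ w → cong Bool.not (eq w)
  compile gs cs (φ ∧ᶠ ψ) with compile₂ gs cs φ ψ
  ... | t , t≤ , hs , p , (i , eq) , (j , eq′) =
    suc t , ℕ.s≤s t≤ , hs ▷ and i j , more p , zero , λ w → cong₂ Bool._∧_ (eq w) (eq′ w)
  compile gs cs (φ ∨ᶠ ψ) with compile₂ gs cs φ ψ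
  ... | t , t≤ , hs , p , (i , eq) , (j , eq′) =
    suc t , ℕ.s≤s t≤ , hs ▷ or i j , more p , zero , λ w → cong₂ Bool._∨_ (eq w) (eq′ w)

  compileAll : ∀ {s} (gs : Gates n s) → (∀ v → Computes gs (ρ v)) →
               ∀ {k} c (φ : Fin k → Formula V) → (∀ i → size (φ i) ℕ.≤ c) →
               Extension gs (k ℕ.* c) (λ hs → ∀ i → Computes hs (value (φ i)))
  compileAll {s} gs cs {zero}  c φ φ≤ = s , ℕ.≤-refl , gs , done , λ ()
  compileAll {s} gs cs {suc k} c φ φ≤ with compile gs cs (φ zero)
  ... | t , t≤ , hs , p , d
    with compileAll hs (λ v → computes-⊑ p (cs v)) c (φ ∘ suc) (φ≤ ∘ suc)
  ... | u , u≤ , is , q , ds = u ,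
    ℕ.≤-trans u≤ (ℕ.≤-trans (ℕ.+-monoʳ-≤ (k ℕ.* c) (ℕ.≤-trans t≤ (ℕ.+-monoˡ-≤ s (φ≤ zero))))
      (ℕ.≤-reflexive (trans (sym (ℕ.+-assoc (k ℕ.* c) c s)) (cong (ℕ._+ s) (ℕ.+-comm (k ℕ.* c) c))))) ,
    is , ⊑-trans p q , λ { zero → computes-⊑ q d ; (suc i) → ds i }

⋁ ⋀ : ∀ {V} k → (Fin k → Formula V) → Formula V
⋁ zero    φ = con false
⋁ (suc k) φ = φ zero ∨ᶠ ⋁ k (φ ∘ suc)
⋀ zero    φ = con true
⋀ (suc k) φ = φ zero ∧ᶠ ⋀ k (φ ∘ suc)

size-⋁ : ∀ {V} k c (φ : Fin k → Formula V) → (∀ i → size (φ i) ℕ.≤ c) →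
         size (⋁ k φ) ℕ.≤ 1 ℕ.+ k ℕ.* (1 ℕ.+ c)
size-⋁ zero    c φ φ≤ = ℕ.≤-refl
size-⋁ (suc k) c φ φ≤ = ℕ.s≤s (ℕ.≤-trans
  (ℕ.+-mono-≤ (size-⋁ k c (φ ∘ suc) (φ≤ ∘ suc)) (φ≤ zero))
  (ℕ.≤-reflexive (cong suc (ℕ.+-comm (k ℕ.* suc c) c))))

size-⋀ : ∀ {V} k c (φ : Fin k → Formula V) → (∀ i → size (φ i) ℕ.≤ c) →
         size (⋀ k φ) ℕ.≤ 1 ℕ.+ k ℕ.* (1 ℕ.+ c)
size-⋀ zero    c φ φ≤ = ℕ.≤-refl
size-⋀ (suc k) c φ φ≤ = ℕ.s≤s (ℕ.≤-trans
  (ℕ.+-mono-≤ (size-⋀ k c (φ ∘ suc) (φ≤ ∘ suc)) (φ≤ zero))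
  (ℕ.≤-reflexive (cong suc (ℕ.+-comm (k ℕ.* suc c) c))))

⋁⁺ : ∀ {V} k (φ : Fin k → Formula V) {ρ} i → ⟦ φ i ⟧ ρ ≡ true → ⟦ ⋁ k φ ⟧ ρ ≡ true
⋁⁺ (suc k) φ {ρ} zero    eq rewrite eq = refl
⋁⁺ (suc k) φ {ρ} (suc i) eq with ⟦ φ zero ⟧ ρ
... | true  = refl
... | false = ⋁⁺ k (φ ∘ suc) i eq

⋁⁻ : ∀ {V} k (φ : Fin k → Formula V) {ρ} → ⟦ ⋁ k φ ⟧ ρ ≡ true → ∃[ i ] ⟦ φ i ⟧ ρ ≡ true
⋁⁻ (suc k) φ {ρ} eq with ⟦ φ zero ⟧ ρ in eq₀
... | true  = zero , eq₀
... | false with ⋁⁻ k (φ ∘ suc) eq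
...   | i , eqᵢ = suc i , eqᵢ

⋀⁺ : ∀ {V} k (φ : Fin k → Formula V) {ρ} → (∀ i → ⟦ φ i ⟧ ρ ≡ true) → ⟦ ⋀ k φ ⟧ ρ ≡ true
⋀⁺ zero    φ eqs = refl
⋀⁺ (suc k) φ eqs rewrite eqs zero = ⋀⁺ k (φ ∘ suc) (eqs ∘ suc)

⋀⁻ : ∀ {V} k (φ : Fin k → Formula V) {ρ} → ⟦ ⋀ k φ ⟧ ρ ≡ true → ∀ i → ⟦ φ i ⟧ ρ ≡ true
⋀⁻ (suc k) φ {ρ} eq i with ⟦ φ zero ⟧ ρ in eq₀
⋀⁻ (suc k) φ {ρ} eq zero    | true = eq₀
⋀⁻ (suc k) φ {ρ} eq (suc i) | true = ⋀⁻ k (φ ∘ suc) eq i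

≡-by-truth : ∀ {a b} → (a ≡ true → b ≡ true) → (b ≡ true → a ≡ true) → a ≡ b
≡-by-truth {true}  {b}     f g = sym (f refl)
≡-by-truth {false} {true}  f g = g refl
≡-by-truth {false} {false} f g = refl

∧-true⁻ : ∀ {a b} → a Bool.∧ b ≡ true → a ≡ true × b ≡ true
∧-true⁻ {true} eq = refl , eq

dec⁺ : ∀ {P : Set} (P? : Dec P) → P → does P? ≡ true
dec⁺ (yes _) p = refl
dec⁺ (no ¬p) p = ⊥-elim (¬p p)

dec⁻ : ∀ {P : Set} (P? : Dec P) → does P? ≡ true → P
dec⁻ (yes p) _ = p

-- Straight-line programs with one wire per coordinate and letter

infix 6 _==_

_==_ : ∀ {M} → Fin M → Fin M → Bool
a == b = does (a Fin.≟ b)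

-- The condition is known when the circuit is built, so testing it costs nothing; a failed guard
-- still takes one constant gate.
guard : ∀ {V} → Bool → Formula V → Formula V
guard b φ = if b then φ else con false

size-guard : ∀ {V} b (φ : Formula V) c → 1 ℕ.≤ c → size φ ℕ.≤ c → size (guard b φ) ℕ.≤ c
size-guard true  φ c 1≤c φ≤c = φ≤c
size-guard false φ c 1≤c φ≤c = 1≤c

guard⁺ : ∀ {V} {b} {φ : Formula V} {ρ} → b ≡ true → ⟦ φ ⟧ ρ ≡ true → ⟦ guard b φ ⟧ ρ ≡ true
guard⁺ refl eq = eq

guard⁻ : ∀ {V} b {φ : Formula V} {ρ} → ⟦ guard b φ ⟧ ρ ≡ true → b ≡ true × ⟦ φ ⟧ ρ ≡ true
guard⁻ true eq = refl , eq

-- A coordinate without an input bit reads `false`, which becomes 0, so slack coordinates are not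
-- shifted by the input.
bitAt : ∀ {n} → Maybe (Fin n) → Vec Bool n → Bool
bitAt nothing  w = false
bitAt (just j) w = lookup w j

-- `size-⋁` applied twice around a conjunction of one gate.
step-cost : ℕ → ℕ
step-cost M = 1 ℕ.+ M ℕ.* (1 ℕ.+ (1 ℕ.+ M ℕ.* 2))

accept-cost : ℕ → ℕ → ℕ
accept-cost N M = 1 ℕ.+ N ℕ.* (1 ℕ.+ (1 ℕ.+ M ℕ.* 2))

-- The summands are acceptance, T steps that each recompute all `N * M` wires, and initialisation at
-- six gates per wire.
network-size : ℕ → ℕ → ℕ → ℕ
network-size N M T = accept-cost N M ℕ.+ (T ℕ.* (N ℕ.* M ℕ.* step-cost M) ℕ.+ N ℕ.* M ℕ.* 6)

module Network {n N M : ℕ}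
  (source : Fin N → Maybe (Fin n))
  (start  : Fin N → Bool → Fin M)
  (update : Fin N → Fin N → Fin M → Fin M → Fin M)
  (accept : Fin N → Fin M → Bool)
  where

  State : Set
  State = Fin N → Fin M

  initial : Vec Bool n → State
  initial w i = start i (bitAt (source i) w)

  -- Each new letter depends on two old ones, its own and that of k. This locality keeps the step
  -- formula polynomial in M.
  step : Fin N → State → State
  step k σ i = update k i (σ k) (σ i)

  run : List (Fin N) → State → State
  run []       σ = σ
  run (k ∷ ks) σ = run ks (step k σ)

  Encoded : ∀ {s} → Gates n s → (Vec Bool n → State) → Set
  Encoded gs σ = ∀ v → Computes gs (λ w → σ w (proj₁ v) == proj₂ v)

  encode-all : ∀ {V : Set} (ρ : V → Vec Bool n → Bool) {s} (gs : Gates n s) →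
    (∀ v → Computes gs (ρ v)) → (σ : Vec Bool n → State) →
    ∀ c (φ : Fin N × Fin M → Formula V) → (∀ v → size (φ v) ℕ.≤ c) →
    (∀ v w → value ρ (φ v) w ≡ σ w (proj₁ v) == proj₂ v) →
    Extension gs (N ℕ.* M ℕ.* c) (λ hs → Encoded hs σ)
  encode-all ρ gs cs σ c φ φ≤ correct
    with compileAll ρ gs cs c (φ ∘ Fin.remQuot {N} M) (φ≤ ∘ Fin.remQuot {N} M)
  ... | t , t≤ , hs , p , ds = t , t≤ , hs , p , enc
    where
    enc : Encoded hs σ
    enc v@(i , a) with ds (Fin.combine i a)
    ... | x , eq = x , λ w → trans (eq w)
      (trans (cong (λ u → value ρ (φ u) w) (Fin.remQuot-combine i a)) (correct v w))

  initialᶠ : Fin N × Fin M → Formula (Fin n)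
  initialᶠ (i , a) with source i
  ... | nothing = con (start i false == a)
  ... | just j  = (var j ∧ᶠ con (start i true == a)) ∨ᶠ (neg (var j) ∧ᶠ con (start i false == a))

  size-initialᶠ : ∀ v → size (initialᶠ v) ℕ.≤ 6
  size-initialᶠ (i , a) with source i
  ... | nothing = ℕ.s≤s ℕ.z≤n
  ... | just j  = ℕ.≤-refl

  initialᶠ-correct : ∀ v w → ⟦ initialᶠ v ⟧ (lookup w) ≡ initial w (proj₁ v) == proj₂ v
  initialᶠ-correct (i , a) w with source i
  ... | nothing = refl
  ... | just j with lookup w j
  ...   | true  = Bool.∨-identityʳ _
  ...   | false = refl

  stepᶠ : Fin N → Fin N × Fin M → Formula (Fin N × Fin M)
  stepᶠ k (i , c) = ⋁ M λ b → ⋁ M λ a →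
    guard (update k i b a == c) (var (k , b) ∧ᶠ var (i , a))

  size-stepᶠ : ∀ k v → size (stepᶠ k v) ℕ.≤ step-cost M
  size-stepᶠ k (i , c) = size-⋁ M _ _ λ b → size-⋁ M 1 _ λ a →
    size-guard (update k i b a == c) _ 1 ℕ.≤-refl ℕ.≤-refl

  stepᶠ-correct : ∀ k v (σ : State) →
    ⟦ stepᶠ k v ⟧ (λ u → σ (proj₁ u) == proj₂ u) ≡ step k σ (proj₁ v) == proj₂ v
  stepᶠ-correct k (i , c) σ = ≡-by-truth to from
    where
    ρ : Fin N × Fin M → Bool
    ρ u = σ (proj₁ u) == proj₂ u
    to : ⟦ stepᶠ k (i , c) ⟧ ρ ≡ true → step k σ i == c ≡ true
    to eq with ⋁⁻ M _ eq
    ... | b , eq₁ with ⋁⁻ M _ eq₁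
    ...   | a , eq₂ with guard⁻ (update k i b a == c) eq₂
    ...     | eq₃ , eq₄ with ∧-true⁻ eq₄
    ...       | eq₅ , eq₆ rewrite dec⁻ (σ k Fin.≟ b) eq₅ | dec⁻ (σ i Fin.≟ a) eq₆ = eq₃
    from : step k σ i == c ≡ true → ⟦ stepᶠ k (i , c) ⟧ ρ ≡ true
    from eq = ⋁⁺ M _ (σ k) (⋁⁺ M _ (σ i) (guard⁺ eq
      (cong₂ Bool._∧_ (dec⁺ (σ k Fin.≟ σ k) refl) (dec⁺ (σ i Fin.≟ σ i) refl))))

  acceptᶠ : Formula (Fin N × Fin M)
  acceptᶠ = ⋀ N λ i → ⋁ M λ a → guard (accept i a) (var (i , a))

  size-acceptᶠ : size acceptᶠ ℕ.≤ accept-cost N M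
  size-acceptᶠ = size-⋀ N _ _ λ i → size-⋁ M 1 _ λ a →
    size-guard (accept i a) _ 1 ℕ.≤-refl ℕ.z≤n

  acceptᶠ-correct : (σ : State) →
    (⟦ acceptᶠ ⟧ (λ u → σ (proj₁ u) == proj₂ u) ≡ true) ⇔ (∀ i → accept i (σ i) ≡ true)
  acceptᶠ-correct σ = mk⇔ to from
    where
    to : ⟦ acceptᶠ ⟧ (λ u → σ (proj₁ u) == proj₂ u) ≡ true → ∀ i → accept i (σ i) ≡ true
    to eq i with ⋁⁻ M _ (⋀⁻ N _ eq i)
    ... | a , eq₁ with guard⁻ (accept i a) eq₁
    ...   | eq₂ , eq₃ rewrite dec⁻ (σ i Fin.≟ a) eq₃ = eq₂
    from : (∀ i → accept i (σ i) ≡ true) → ⟦ acceptᶠ ⟧ (λ u → σ (proj₁ u) == proj₂ u) ≡ true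
    from eqs = ⋀⁺ N _ λ i → ⋁⁺ M _ (σ i) (guard⁺ (eqs i) (dec⁺ (σ i Fin.≟ σ i) refl))

  run-gates : ∀ {s} (gs : Gates n s) (σ : Vec Bool n → State) → Encoded gs σ → ∀ ks →
    Extension gs (List.length ks ℕ.* (N ℕ.* M ℕ.* step-cost M)) (λ hs → Encoded hs (run ks ∘ σ))
  run-gates {s} gs σ enc [] = s , ℕ.≤-refl , gs , done , enc
  run-gates {s} gs σ enc (k ∷ ks)
    with encode-all _ gs enc (step k ∘ σ) (step-cost M) (stepᶠ k) (size-stepᶠ k)
           (λ v w → stepᶠ-correct k v (σ w))
  ... | t , t≤ , hs , p , enc₁ with run-gates hs (step k ∘ σ) enc₁ ks
  ...   | u , u≤ , is , q , enc₂ = u ,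
    ℕ.≤-trans u≤ (ℕ.≤-trans (ℕ.+-monoʳ-≤ (List.length ks ℕ.* cost) t≤)
      (ℕ.≤-reflexive (trans (sym (ℕ.+-assoc (List.length ks ℕ.* cost) cost s))
        (cong (ℕ._+ s) (ℕ.+-comm (List.length ks ℕ.* cost) cost))))) ,
    is , ⊑-trans p q , enc₂
    where
    cost : ℕ
    cost = N ℕ.* M ℕ.* step-cost M

  network-circuit : ∀ ks → ∃[ s ] (s ℕ.≤ network-size N M (List.length ks) × Σ[ C ∈ Circuit n s ]
    (∀ w → (evalCircuit C w ≡ true) ⇔ (∀ i → accept i (run ks (initial w) i) ≡ true)))
  network-circuit ks
    with encode-all (λ j w → lookup w j) [] (λ j → j , λ w → refl) initial 6
           initialᶠ size-initialᶠ initialᶠ-correct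
  ... | s , s≤ , gs , _ , enc with run-gates gs initial enc ks
  ...   | t , t≤ , hs , _ , enc₁ with compile _ hs enc₁ acceptᶠ
  ...     | u , u≤ , is , _ , (x , eq) = u ,
    ℕ.≤-trans u≤ (ℕ.+-mono-≤ size-acceptᶠ (ℕ.≤-trans t≤
      (ℕ.+-monoʳ-≤ (List.length ks ℕ.* (N ℕ.* M ℕ.* step-cost M))
        (ℕ.≤-trans s≤ (ℕ.≤-reflexive (ℕ.+-identityʳ _)))))) ,
    record { gates = is ; output = x } ,
    λ w → mk⇔
      (λ out → Equivalence.to (acceptᶠ-correct (run ks (initial w))) (trans (sym (eq w)) out))
      (λ acc → trans (eq w) (Equivalence.from (acceptᶠ-correct (run ks (initial w))) acc))

-- Linear algebra over ℚ

Vector : ℕ → Set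
Vector N = Fin N → ℚ

infix 8 ⟨_,_⟩

⟨_,_⟩ : ∀ {N} → Vector N → Vector N → ℚ
⟨ u , v ⟩ = sum (λ i → u i * v i)

⟨,⟩-congʳ : ∀ {N} (u : Vector N) {v w} → (∀ i → v i ≡ w i) → ⟨ u , v ⟩ ≡ ⟨ u , w ⟩
⟨,⟩-congʳ u v≗w = sum-cong-≗ λ i → cong (u i *_) (v≗w i)

⟨,⟩-comm : ∀ {N} (u v : Vector N) → ⟨ u , v ⟩ ≡ ⟨ v , u ⟩
⟨,⟩-comm u v = sum-cong-≗ λ i → ℚ.*-comm (u i) (v i)

⟨,⟩-+ʳ : ∀ {N} (u v w : Vector N) → ⟨ u , (λ i → v i + w i) ⟩ ≡ ⟨ u , v ⟩ + ⟨ u , w ⟩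
⟨,⟩-+ʳ u v w = trans (sum-cong-≗ λ i → ℚ.*-distribˡ-+ (u i) (v i) (w i))
  (∑-distrib-+ (λ i → u i * v i) (λ i → u i * w i))

⟨,⟩-*ʳ : ∀ {N} (u : Vector N) c (v : Vector N) → ⟨ u , (λ i → c * v i) ⟩ ≡ c * ⟨ u , v ⟩
⟨,⟩-*ʳ u c v = trans (sum-cong-≗ λ i → swap (u i) c (v i)) (sym (*-distribˡ-sum c (λ i → u i * v i)))
  where
  swap : ∀ x y z → x * (y * z) ≡ y * (x * z)
  swap = RingSolver.solve-∀ ring

⟨,⟩-+ˡ : ∀ {N} (u v w : Vector N) → ⟨ (λ i → u i + v i) , w ⟩ ≡ ⟨ u , w ⟩ + ⟨ v , w ⟩
⟨,⟩-+ˡ u v w = trans (⟨,⟩-comm _ w) (trans (⟨,⟩-+ʳ w u v) (cong₂ _+_ (⟨,⟩-comm w u) (⟨,⟩-comm w v)))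

⟨,⟩-*ˡ : ∀ {N} c (u v : Vector N) → ⟨ (λ i → c * u i) , v ⟩ ≡ c * ⟨ u , v ⟩
⟨,⟩-*ˡ c u v = trans (⟨,⟩-comm _ v) (trans (⟨,⟩-*ʳ v c u) (cong (c *_) (⟨,⟩-comm v u)))

⟨,⟩-zeroˡ : ∀ {N} (v : Vector N) → ⟨ (λ _ → 0ℚ) , v ⟩ ≡ 0ℚ
⟨,⟩-zeroˡ v = trans (⟨,⟩-*ˡ 0ℚ (λ _ → 0ℚ) v) (ℚ.*-zeroˡ ⟨ (λ _ → 0ℚ) , v ⟩)

⟨,⟩-zeroʳ : ∀ {N} (v : Vector N) → ⟨ v , (λ _ → 0ℚ) ⟩ ≡ 0ℚ
⟨,⟩-zeroʳ v = trans (⟨,⟩-comm v (λ _ → 0ℚ)) (⟨,⟩-zeroˡ v)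

combination : ∀ {d N} → Vector d → (Fin d → Vector N) → Vector N
combination c g i = sum (λ j → c j * g j i)

⟨,⟩-combinationʳ : ∀ {d N} (u : Vector N) (c : Vector d) (g : Fin d → Vector N) →
  ⟨ u , combination c g ⟩ ≡ sum (λ j → c j * ⟨ u , g j ⟩)
⟨,⟩-combinationʳ {zero}  u c g = ⟨,⟩-zeroʳ u
⟨,⟩-combinationʳ {suc d} u c g = trans
  (⟨,⟩-+ʳ u (λ i → c zero * g zero i) (combination (c ∘ suc) (g ∘ suc)))
  (cong₂ _+_ (⟨,⟩-*ʳ u (c zero) (g zero)) (⟨,⟩-combinationʳ u (c ∘ suc) (g ∘ suc)))

record Subspace {N} (Q : Vector N → Set) : Set where
  field
    resp  : ∀ {u v} → (∀ i → u i ≡ v i) → Q u → Q v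
    null  : Q (λ _ → 0ℚ)
    plus  : ∀ {u v} → Q u → Q v → Q (λ i → u i + v i)
    scale : ∀ c {v} → Q v → Q (λ i → c * v i)

  combine : ∀ {d} (c : Vector d) {g : Fin d → Vector N} → (∀ j → Q (g j)) → Q (combination c g)
  combine {zero}  c gs = null
  combine {suc d} c gs = plus (scale (c zero) (gs zero)) (combine (c ∘ suc) (gs ∘ suc))

Span : ∀ {d N} → (Fin d → Vector N) → Vector N → Set
Span {d} g v = Σ[ c ∈ Vector d ] (∀ i → v i ≡ combination c g i)

span-least : ∀ {d N} {g : Fin d → Vector N} {Q v} → Subspace Q → (∀ j → Q (g j)) → Span g v → Q v
span-least S gs (c , eq) = Subspace.resp S (λ i → sym (eq i)) (Subspace.combine S c gs)

span-subspace : ∀ {d N} (g : Fin d → Vector N) → Subspace (Span g)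
span-subspace {d} {N} g = record
  { resp  = λ { u≗v (c , eq) → c , λ i → trans (sym (u≗v i)) (eq i) }
  ; null  = (λ _ → 0ℚ) , λ i → sym (⟨,⟩-zeroˡ (λ j → g j i))
  ; plus  = λ { (c , eq) (c′ , eq′) → (λ j → c j + c′ j) , λ i →
                trans (cong₂ _+_ (eq i) (eq′ i)) (sym (⟨,⟩-+ˡ c c′ (λ j → g j i))) }
  ; scale = λ { a (c , eq) → (λ j → a * c j) , λ i →
                trans (cong (a *_) (eq i)) (sym (⟨,⟩-*ˡ a c (λ j → g j i))) }
  }

span-generator : ∀ {d N} (g : Fin d → Vector N) j → Span g (g j)
span-generator {suc d} g zero = c , λ i → sym (begin
    1ℚ * g zero i + ⟨ (λ _ → 0ℚ) , (λ j → g (suc j) i) ⟩   ≡⟨ cong (1ℚ * g zero i +_) (rest i) ⟩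
    1ℚ * g zero i + 0ℚ                                      ≡⟨ unit (g zero i) ⟩
    g zero i                                                ∎)
  where
  open ≡-Reasoning
  c : Vector (suc d)
  c zero    = 1ℚ
  c (suc j) = 0ℚ
  rest : ∀ i → ⟨ (λ _ → 0ℚ) , (λ j → g (suc j) i) ⟩ ≡ 0ℚ
  rest i = ⟨,⟩-zeroˡ (λ j → g (suc j) i)
  unit : ∀ x → 1ℚ * x + 0ℚ ≡ x
  unit = RingSolver.solve-∀ ring
span-generator {suc d} g (suc j) with span-generator (g ∘ suc) j
... | c , eq = c⁺ , λ i → trans (eq i) (pad (g zero i) _)
  where
  c⁺ : Vector (suc d)
  c⁺ zero    = 0ℚ
  c⁺ (suc j) = c j
  pad : ∀ x y → y ≡ 0ℚ * x + y
  pad = RingSolver.solve-∀ ring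

-- `P k` acts on `v` as the k-th coordinate functional. If this holds on a subspace that also
-- contains every `P k`, then P is the matrix of the orthogonal projection onto it.
Represents : ∀ {N} → (Fin N → Vector N) → Vector N → Set
Represents P v = ∀ k → ⟨ P k , v ⟩ ≡ v k

represents-subspace : ∀ {N} (P : Fin N → Vector N) → Subspace (Represents P)
represents-subspace P = record
  { resp  = λ u≗v rep k → trans (⟨,⟩-congʳ (P k) (λ i → sym (u≗v i))) (trans (rep k) (u≗v k))
  ; null  = λ k → ⟨,⟩-zeroʳ (P k)
  ; plus  = λ {u} {v} rep rep′ k → trans (⟨,⟩-+ʳ (P k) u v) (cong₂ _+_ (rep k) (rep′ k))
  ; scale = λ c {v} rep k → trans (⟨,⟩-*ʳ (P k) c v) (cong (c *_) (rep k))
  }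

square≤norm : ∀ {N} (u : Vector N) i → u i * u i ≤ ⟨ u , u ⟩
square≤norm u = term≤sum (λ i → 0≤-square (u i))

square≤0⇒≡0 : ∀ {q} → q * q ≤ 0ℚ → q ≡ 0ℚ
square≤0⇒≡0 {q} q²≤0 with ℚ.<-cmp q 0ℚ
... | tri≈ _ q≡0 _ = q≡0
... | tri< q<0 _ _ = ⊥-elim (ℚ.<-irrefl refl (ℚ.<-≤-trans
  (subst (0ℚ <_) (neg*neg q) (0<* (ℚ.neg-antimono-< q<0) (ℚ.neg-antimono-< q<0))) q²≤0))
... | tri> _ _ 0<q = ⊥-elim (ℚ.<-irrefl refl (ℚ.<-≤-trans (0<* 0<q 0<q) q²≤0))

-- One Gram–Schmidt step: u is the component of g zero orthogonal to the
-- span of the remaining generators, on which P represents the coordinates.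
representers : ∀ {d N} (g : Fin d → Vector N) →
  Σ[ P ∈ (Fin N → Vector N) ] ((∀ j → Represents P (g j)) × (∀ k → Span g (P k)))
representers {zero}  {N} g = (λ _ _ → 0ℚ) , (λ ()) , λ k → (λ ()) , λ i → refl
representers {suc d} {N} g with representers (g ∘ suc)
... | P , P-rep , P-span = extended
  where
  open ≡-Reasoning
  v = g zero
  proj u : Vector N
  proj = combination v P
  u i = v i - proj i

  span⊆ : ∀ {x} → Span (g ∘ suc) x → Span g x
  span⊆ = span-least (span-subspace g) (λ j → span-generator g (suc j))

  rep-span : ∀ {x} → Span (g ∘ suc) x → Represents P x
  rep-span = span-least (represents-subspace P) P-rep

  proj-span : Span (g ∘ suc) proj
  proj-span = Subspace.combine (span-subspace (g ∘ suc)) v P-span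

  cancel : ∀ x y → (x - y) + y ≡ x
  cancel = RingSolver.solve-∀ ring

  -- Since `proj` is the sum of the `v k * P k`, representing x gives `⟨ x , proj ⟩ ≡ ⟨ v , x ⟩`.
  u⊥ : ∀ x → Represents P x → ⟨ x , u ⟩ ≡ 0ℚ
  u⊥ x rep = begin
    ⟨ x , u ⟩                                  ≡⟨ shift ⟨ x , u ⟩ ⟨ x , proj ⟩ ⟩
    (⟨ x , u ⟩ + ⟨ x , proj ⟩) - ⟨ x , proj ⟩   ≡⟨ cong₂ _-_ (sym (⟨,⟩-+ʳ x u proj)) x·proj ⟩
    ⟨ x , (λ i → u i + proj i) ⟩ - ⟨ v , x ⟩    ≡⟨ cong (_- ⟨ v , x ⟩) (⟨,⟩-congʳ x (λ i → cancel (v i) (proj i))) ⟩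
    ⟨ x , v ⟩ - ⟨ v , x ⟩                       ≡⟨ cong (_- ⟨ v , x ⟩) (⟨,⟩-comm x v) ⟩
    ⟨ v , x ⟩ - ⟨ v , x ⟩                       ≡⟨ ℚ.+-inverseʳ ⟨ v , x ⟩ ⟩
    0ℚ                                         ∎
    where
    shift : ∀ a b → a ≡ (a + b) - b
    shift = RingSolver.solve-∀ ring
    x·proj : ⟨ x , proj ⟩ ≡ ⟨ v , x ⟩
    x·proj = trans (⟨,⟩-combinationʳ x v P)
      (sum-cong-≗ λ k → cong (v k *_) (trans (⟨,⟩-comm x (P k)) (rep k)))

  P·v : ∀ k → ⟨ P k , v ⟩ ≡ proj k
  P·v k = begin
    ⟨ P k , v ⟩                       ≡⟨ ⟨,⟩-congʳ (P k) (λ i → sym (cancel (v i) (proj i))) ⟩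
    ⟨ P k , (λ i → u i + proj i) ⟩    ≡⟨ ⟨,⟩-+ʳ (P k) u proj ⟩
    ⟨ P k , u ⟩ + ⟨ P k , proj ⟩      ≡⟨ cong₂ _+_ (u⊥ (P k) (rep-span (P-span k))) (rep-span proj-span k) ⟩
    0ℚ + proj k                      ≡⟨ ℚ.+-identityˡ (proj k) ⟩
    proj k                           ∎

  u·v : ⟨ u , v ⟩ ≡ ⟨ u , u ⟩
  u·v = begin
    ⟨ u , v ⟩                         ≡⟨ ⟨,⟩-congʳ u (λ i → sym (cancel (v i) (proj i))) ⟩
    ⟨ u , (λ i → u i + proj i) ⟩      ≡⟨ ⟨,⟩-+ʳ u u proj ⟩
    ⟨ u , u ⟩ + ⟨ u , proj ⟩          ≡⟨ cong (⟨ u , u ⟩ +_) (trans (⟨,⟩-comm u proj) (u⊥ proj (rep-span proj-span))) ⟩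
    ⟨ u , u ⟩ + 0ℚ                   ≡⟨ ℚ.+-identityʳ ⟨ u , u ⟩ ⟩
    ⟨ u , u ⟩                         ∎

  u-span : Span g u
  u-span = Subspace.resp (span-subspace g) (λ i → minus (v i) (proj i))
    (Subspace.plus (span-subspace g) (span-generator g zero)
      (Subspace.scale (span-subspace g) (- 1ℚ) (span⊆ proj-span)))
    where
    minus : ∀ x y → x + (- 1ℚ) * y ≡ x - y
    minus = RingSolver.solve-∀ ring

  extended : Σ[ P′ ∈ (Fin N → Vector N) ] ((∀ j → Represents P′ (g j)) × (∀ k → Span g (P′ k)))
  extended with ⟨ u , u ⟩ ℚ.≤? 0ℚ
  -- Here `u` vanishes, so `g zero` equals its projection and lies in the old span.
  ... | yes u²≤0 = P , (λ { zero → rep-v ; (suc j) → P-rep j }) , λ k → span⊆ (P-span k)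
    where
    rep-v : Represents P v
    rep-v k = trans (P·v k) (sym (trans (sym (cancel (v k) (proj k)))
      (trans (cong (_+ proj k) (square≤0⇒≡0 {u k} (ℚ.≤-trans (square≤norm u k) u²≤0))) (ℚ.+-identityˡ (proj k)))))
  ... | no u²≰0 = P′ , (λ { zero → rep-v ; (suc j) → rep-old (P-rep j) }) , P′-span
    where
    0<u² : 0ℚ < ⟨ u , u ⟩
    0<u² = ℚ.≰⇒> u²≰0
    r = proj₁ (inverse 0<u²)
    -- The projection onto the larger span gains the rank-one term of the new orthogonal direction
    -- `u`, where r inverts `⟨ u , u ⟩`.
    P′ : Fin N → Vector N
    P′ k i = P k i + (u k * r) * u i
    P′· : ∀ k x → ⟨ P′ k , x ⟩ ≡ ⟨ P k , x ⟩ + (u k * r) * ⟨ u , x ⟩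
    P′· k x = trans (⟨,⟩-+ˡ (P k) (λ i → (u k * r) * u i) x) (cong (⟨ P k , x ⟩ +_) (⟨,⟩-*ˡ (u k * r) u x))
    rep-old : ∀ {x} → Represents P x → Represents P′ x
    rep-old {x} rep k = begin
      ⟨ P′ k , x ⟩                          ≡⟨ P′· k x ⟩
      ⟨ P k , x ⟩ + (u k * r) * ⟨ u , x ⟩    ≡⟨ cong₂ (λ a b → a + (u k * r) * b) (rep k) (trans (⟨,⟩-comm u x) (u⊥ x rep)) ⟩
      x k + (u k * r) * 0ℚ                  ≡⟨ drop (x k) (u k * r) ⟩
      x k                                   ∎
      where
      drop : ∀ a b → a + b * 0ℚ ≡ a
      drop = RingSolver.solve-∀ ring
    rep-v : Represents P′ v
    rep-v k = begin
      ⟨ P′ k , v ⟩                          ≡⟨ P′· k v ⟩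
      ⟨ P k , v ⟩ + (u k * r) * ⟨ u , v ⟩    ≡⟨ cong₂ (λ a b → a + (u k * r) * b) (P·v k) u·v ⟩
      proj k + (u k * r) * ⟨ u , u ⟩         ≡⟨ regroup (proj k) (u k) r ⟨ u , u ⟩ ⟩
      proj k + u k * (⟨ u , u ⟩ * r)         ≡⟨ cong (λ t → proj k + u k * t) (proj₂ (proj₂ (inverse 0<u²))) ⟩
      proj k + u k * 1ℚ                     ≡⟨ restore (v k) (proj k) ⟩
      v k                                   ∎
      where
      regroup : ∀ a b c d → a + (b * c) * d ≡ a + b * (d * c)
      regroup = RingSolver.solve-∀ ring
      restore : ∀ a b → b + (a - b) * 1ℚ ≡ a
      restore = RingSolver.solve-∀ ring
    P′-span : ∀ k → Span g (P′ k)
    P′-span k = Subspace.plus (span-subspace g) (span⊆ (P-span k))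
      (Subspace.scale (span-subspace g) (u k * r) u-span)

1<⇒1<square : ∀ {q} → 1ℚ < q → 1ℚ < q * q
1<⇒1<square {q} 1<q = <-by _ (0<* (0<-diff 1<q) (ℚ.<-trans 0<1 (<-by q (ℚ.<-trans 0<1 1<q) refl))) (expand q)
  where
  expand : ∀ q → q * q ≡ 1ℚ + (q - 1ℚ) * (1ℚ + q)
  expand = RingSolver.solve-∀ ring

square≤1⇒∣∣≤1 : ∀ {q} → q * q ≤ 1ℚ → ∣ q ∣ ≤ 1ℚ
square≤1⇒∣∣≤1 {q} q²≤1 = ∣p∣≤q (below q²≤1) (below (subst (_≤ 1ℚ) (sym (neg*neg q)) q²≤1))
  where
  below : ∀ {p} → p * p ≤ 1ℚ → p ≤ 1ℚ
  below p²≤1 = ℚ.≮⇒≥ λ 1<p → ℚ.<-irrefl refl (ℚ.<-≤-trans (1<⇒1<square 1<p) p²≤1)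

module _ {N} (P : Fin N → Vector N) (idempotent : ∀ k → Represents P (P k)) where

  -- With p the diagonal entry `P k k`, idempotence gives `⟨ P k , P k ⟩ ≡ p`, while p * p is one
  -- summand of this sum. So p * p ≤ p, which excludes p above 1.
  norm-P≤1 : ∀ k → ⟨ P k , P k ⟩ ≤ 1ℚ
  norm-P≤1 k = ℚ.≮⇒≥ λ 1<p → ℚ.<-irrefl refl (ℚ.<-≤-trans
    (square-grows (subst (1ℚ <_) (idempotent k k) 1<p))
    (ℚ.≤-trans (square≤norm (P k) k) (ℚ.≤-reflexive (idempotent k k))))
    where
    square-grows : ∀ {q} → 1ℚ < q → q < q * q
    square-grows {q} 1<q = <-by _ (0<* (ℚ.<-trans 0<1 1<q) (0<-diff 1<q)) (expand q)
      where
      expand : ∀ q → q * q ≡ q + q * (q - 1ℚ)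
      expand = RingSolver.solve-∀ ring

  ∣P∣≤1 : ∀ k i → ∣ P k i ∣ ≤ 1ℚ
  ∣P∣≤1 k i = square≤1⇒∣∣≤1 (ℚ.≤-trans (square≤norm (P k) i) (norm-P≤1 k))

-- The relaxation method in finite precision

∣≤∣⇒≤ : ∀ {p q r} → ∣ p - q ∣ ≤ r → p ≤ q + r
∣≤∣⇒≤ {p} {q} {r} h = ≤-by (r - (p - q)) (0≤-diff (ℚ.≤-trans (p≤∣p∣ (p - q)) h)) (rearrange p q r)
  where
  rearrange : ∀ p q r → q + r ≡ p + (r - (p - q))
  rearrange = RingSolver.solve-∀ ring

∣≤∣⇒≥ : ∀ {p q r} → ∣ p - q ∣ ≤ r → q ≤ p + r
∣≤∣⇒≥ {p} {q} h = ∣≤∣⇒≤ (subst (_≤ _) (∣p-q∣≡∣q-p∣ p q) h)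

-- L bounds the number of roundings: `Lρ≤ε` keeps their total at most ε, and `range≤H` keeps every
-- value passed to `encode` where rounding is accurate.
module Relaxation {n N M : ℕ}
  (source : Fin N → Maybe (Fin n))
  (P : Fin N → Vector N) (P-idempotent : ∀ k → Represents P (P k))
  (ε : ℚ) (0<ε : 0ℚ < ε)
  (decode : Fin M → ℚ) (encode : ℚ → Fin M) (H ρ : ℚ) (0≤ρ : 0ℚ ≤ ρ)
  (encode-close : ∀ q → ∣ q ∣ ≤ H → ∣ decode (encode q) - q ∣ ≤ ρ)
  (L : ℕ) (Lρ≤ε : fromℕ L * ρ ≤ ε) (range≤H : ε + (1ℚ + fromℕ L * ε) ≤ H)
  where

  private
    0≤ε : 0ℚ ≤ ε
    0≤ε = ℚ.<⇒≤ 0<ε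

  -- Coordinates are relative to the input word: all should be nonnegative, and those carrying an
  -- input bit should be zero, so only the latter are pushed down. One ε of the threshold 2ε absorbs
  -- the accumulated rounding.
  data Move (k : Fin N) (q : ℚ) : Maybe ℚ → Set where
    up   : q < - (ε + ε) → Move k q (just ε)
    down : ∀ j → source k ≡ just j → ε + ε < q → Move k q (just (- ε))
    stay : - (ε + ε) ≤ q → (∀ j → source k ≡ just j → q ≤ ε + ε) → Move k q nothing

  abstract
    move : ∀ k q → Σ (Maybe ℚ) (Move k q)
    move k q with q ℚ.<? - (ε + ε)
    ... | yes below = just ε , up below
    ... | no ¬below with source k in eq
    ...   | nothing = nothing , stay (ℚ.≮⇒≥ ¬below) λ j eq′ → case trans (sym eq) eq′ of λ ()
    ...   | just j with (ε + ε) ℚ.<? q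
    ...     | yes above = just (- ε) , down j eq above
    ...     | no ¬above = nothing , stay (ℚ.≮⇒≥ ¬below) λ _ _ → ℚ.≮⇒≥ ¬above

  letter : Maybe ℚ → Fin N → Fin N → Fin M → Fin M
  letter nothing  k i a = a
  letter (just η) k i a = encode (decode a + η * P k i)

  exact : Maybe ℚ → Fin N → Vector N → Vector N
  exact nothing  k z = z
  exact (just η) k z = λ i → z i + η * P k i

  update : Fin N → Fin N → Fin M → Fin M → Fin M
  update k i b a = letter (proj₁ (move k (decode b))) k i a

  accept : Fin N → Fin M → Bool
  accept k a = is-nothing (proj₁ (move k (decode a)))

  Accepting : (Fin N → Fin M) → Set
  Accepting σ = ∀ k → accept k (σ k) ≡ true

  move-bound : ∀ {k q η} → Move k q (just η) → ∀ i → ∣ η * P k i ∣ ≤ ε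
  move-bound {k} {η = η} m i = begin
    ∣ η * P k i ∣       ≡⟨ ℚ.∣p*q∣≡∣p∣*∣q∣ η (P k i) ⟩
    ∣ η ∣ * ∣ P k i ∣    ≤⟨ *-mono-≤ (ℚ.0≤∣p∣ η) 0≤1 (∣η∣≤ε m) (∣P∣≤1 P P-idempotent k i) ⟩
    ε * 1ℚ              ≡⟨ ℚ.*-identityʳ ε ⟩
    ε                   ∎
    where
    open ℚ.≤-Reasoning
    ∣ε∣≤ε : ∣ ε ∣ ≤ ε
    ∣ε∣≤ε = ℚ.≤-reflexive (ℚ.0≤p⇒∣p∣≡p 0≤ε)
    ∣η∣≤ε : ∀ {q η} → Move k q (just η) → ∣ η ∣ ≤ ε
    ∣η∣≤ε (up _)       = ∣ε∣≤ε
    ∣η∣≤ε (down _ _ _) = subst (_≤ ε) (sym (ℚ.∣-p∣≡∣p∣ ε)) ∣ε∣≤ε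

  -- Rounding leaves the affine subspace, so the analysis follows an exact companion `z` that makes
  -- the same moves unrounded. `Q` and `centre` stay general: around a target point they yield
  -- progress, around the initial point they yield a solution.
  module Tracking {Q : Vector N → Set} (S : Subspace Q) (QP : ∀ k → Q (P k)) (centre : Vector N) where

    record Tracks (t : ℕ) (σ : Fin N → Fin M) (z : Vector N) : Set where
      field
        close  : ∀ i → ∣ decode (σ i) - z i ∣ ≤ fromℕ t * ρ
        range  : ∀ i → ∣ z i ∣ ≤ 1ℚ + fromℕ t * ε
        inside : Q (λ i → z i - centre i)

    open Tracks

    tracks-move : ∀ {t σ z m} k → suc t ℕ.≤ L → Move k (decode (σ k)) m → Tracks t σ z →
                  Tracks (suc t) (λ i → letter m k i (σ i)) (exact m k z)
    tracks-move {t} {m = nothing} k t<L mv τ = record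
      { close  = λ i → ℚ.≤-trans (close τ i) (later 0≤ρ)
      ; range  = λ i → ℚ.≤-trans (range τ i) (ℚ.+-monoʳ-≤ 1ℚ (later 0≤ε))
      ; inside = inside τ
      }
      where
      later : ∀ {q} → 0ℚ ≤ q → fromℕ t * q ≤ fromℕ (suc t) * q
      later {q} 0≤q = ℚ.*-monoʳ-≤-nonNeg q {{ℚ.nonNegative 0≤q}} (fromℕ-mono (ℕ.n≤1+n t))
    tracks-move {t} {σ} {z} {just η} k t<L mv τ = record
      { close = λ i → let q = decode (σ i) + η * P k i in begin
          ∣ decode (encode q) - (z i + η * P k i) ∣
            ≤⟨ triangle (decode (encode q)) q (z i + η * P k i) ⟩
          ∣ decode (encode q) - q ∣ + ∣ q - (z i + η * P k i) ∣
            ≤⟨ ℚ.+-mono-≤ (encode-close q (in-range i))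
                 (subst (λ x → ∣ x ∣ ≤ fromℕ t * ρ) (cancel (decode (σ i)) (z i) (η * P k i)) (close τ i)) ⟩
          ρ + fromℕ t * ρ
            ≡⟨ one-more ρ ⟩
          fromℕ (suc t) * ρ ∎
      ; range = λ i → begin
          ∣ z i + η * P k i ∣
            ≤⟨ ℚ.∣p+q∣≤∣p∣+∣q∣ (z i) (η * P k i) ⟩
          ∣ z i ∣ + ∣ η * P k i ∣
            ≤⟨ ℚ.+-mono-≤ (range τ i) (move-bound mv i) ⟩
          (1ℚ + fromℕ t * ε) + ε
            ≡⟨ shuffle 1ℚ (fromℕ t * ε) ε ⟩
          1ℚ + (ε + fromℕ t * ε)
            ≡⟨ cong (λ x → 1ℚ + x) (one-more ε) ⟩
          1ℚ + fromℕ (suc t) * ε ∎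
      ; inside = Subspace.resp S (λ i → recentre (z i) (η * P k i) (centre i))
          (Subspace.plus S (inside τ) (Subspace.scale S η (QP k)))
      }
      where
      open ℚ.≤-Reasoning
      cancel : ∀ a b c → a - b ≡ (a + c) - (b + c)
      cancel = RingSolver.solve-∀ ring
      recentre : ∀ a b c → (a - c) + b ≡ (a + b) - c
      recentre = RingSolver.solve-∀ ring
      shuffle : ∀ a b c → (a + b) + c ≡ a + (c + b)
      shuffle = RingSolver.solve-∀ ring
      one-more : ∀ q → q + fromℕ t * q ≡ fromℕ (suc t) * q
      one-more q = trans (factor q (fromℕ t)) (cong (_* q) (sym (fromℕ-suc t)))
        where
        factor : ∀ q x → q + x * q ≡ (1ℚ + x) * q
        factor = RingSolver.solve-∀ ring
      in-range : ∀ i → ∣ decode (σ i) + η * P k i ∣ ≤ H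
      in-range i = begin
        ∣ decode (σ i) + η * P k i ∣
          ≤⟨ ℚ.∣p+q∣≤∣p∣+∣q∣ (decode (σ i)) (η * P k i) ⟩
        ∣ decode (σ i) ∣ + ∣ η * P k i ∣
          ≤⟨ ℚ.+-mono-≤ (subst (λ x → ∣ x ∣ ≤ ∣ decode (σ i) - z i ∣ + ∣ z i ∣) (restore (decode (σ i)) (z i))
               (ℚ.∣p+q∣≤∣p∣+∣q∣ (decode (σ i) - z i) (z i))) (move-bound mv i) ⟩
        (∣ decode (σ i) - z i ∣ + ∣ z i ∣) + ε
          ≤⟨ ℚ.+-monoˡ-≤ ε (ℚ.+-mono-≤
               (ℚ.≤-trans (close τ i) (ℚ.≤-trans (mono 0≤ρ (ℕ.<⇒≤ t<L)) Lρ≤ε)) (range τ i)) ⟩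
        (ε + (1ℚ + fromℕ t * ε)) + ε
          ≡⟨ gather ε 1ℚ (fromℕ t * ε) ⟩
        ε + (1ℚ + (ε + fromℕ t * ε))
          ≡⟨ cong (λ x → ε + (1ℚ + x)) (one-more ε) ⟩
        ε + (1ℚ + fromℕ (suc t) * ε)
          ≤⟨ ℚ.+-monoʳ-≤ ε (ℚ.+-monoʳ-≤ 1ℚ (mono 0≤ε t<L)) ⟩
        ε + (1ℚ + fromℕ L * ε)
          ≤⟨ range≤H ⟩
        H ∎
        where
        restore : ∀ a b → (a - b) + b ≡ a
        restore = RingSolver.solve-∀ ring
        gather : ∀ a b c → (a + (b + c)) + a ≡ a + (b + (a + c))
        gather = RingSolver.solve-∀ ring
        mono : ∀ {q s} → 0ℚ ≤ q → s ℕ.≤ L → fromℕ s * q ≤ fromℕ L * q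
        mono {q} 0≤q s≤L = ℚ.*-monoʳ-≤-nonNeg q {{ℚ.nonNegative 0≤q}} (fromℕ-mono s≤L)

    close-ε : ∀ {t σ z} → t ℕ.≤ L → Tracks t σ z → ∀ i → ∣ decode (σ i) - z i ∣ ≤ ε
    close-ε t≤L τ i = ℚ.≤-trans (close τ i) (ℚ.≤-trans
      (ℚ.*-monoʳ-≤-nonNeg ρ {{ℚ.nonNegative 0≤ρ}} (fromℕ-mono t≤L)) Lρ≤ε)

  module Run (start : Fin N → Bool → Fin M) where

    open Network source start update accept public using (State; step; run)

    -- The order is independent of the data, as a circuit requires: each sweep offers a move to
    -- every coordinate in turn.
    schedule : ℕ → List (Fin N)
    schedule zero    = []
    schedule (suc r) = List.allFin N List.++ schedule r

    length-schedule : ∀ r → List.length (schedule r) ≡ r ℕ.* N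
    length-schedule zero    = refl
    length-schedule (suc r) = trans (List.length-++ (List.allFin N))
      (cong₂ ℕ._+_ (List.length-tabulate {n = N} (λ i → i)) (length-schedule r))

    run-++ : ∀ ks ls σ → run (ks List.++ ls) σ ≡ run ls (run ks σ)
    run-++ []       ls σ = refl
    run-++ (k ∷ ks) ls σ = run-++ ks ls (step k σ)

    module _ {Q : Vector N → Set} (S : Subspace Q) (QP : ∀ k → Q (P k)) (centre : Vector N) where
      open Tracking S QP centre

      tracks-run : ∀ ks {t σ z} → t ℕ.+ List.length ks ℕ.≤ L → Tracks t σ z →
                   ∃[ z′ ] Tracks (t ℕ.+ List.length ks) (run ks σ) z′
      tracks-run []       {t} {σ} {z} _ τ = z , subst (λ t → Tracks t σ z) (sym (ℕ.+-identityʳ t)) τ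
      tracks-run (k ∷ ks) {t} {σ} t≤L τ
        with tracks-run ks (subst (ℕ._≤ L) (ℕ.+-suc t _) t≤L)
               (tracks-move k (ℕ.≤-trans (ℕ.m≤m+n (suc t) _) (subst (ℕ._≤ L) (ℕ.+-suc t _) t≤L))
                 (proj₂ (move k (decode (σ k)))) τ)
      ... | z′ , τ′ = z′ , subst (λ t → Tracks t (run ks (step k σ)) z′) (sym (ℕ.+-suc t _)) τ′

      -- The threshold 2ε on decoded values and the tracking error ε add up to 3ε for the exact
      -- companion.
      accepting⇒near : ∀ {t σ z} → t ℕ.≤ L → Tracks t σ z → Accepting σ →
        ∀ k → - (ε + ε + ε) ≤ z k × (∀ j → source k ≡ just j → z k ≤ ε + ε + ε)
      accepting⇒near {σ = σ} {z} t≤L τ acc k with move k (decode (σ k)) | acc k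
      ... | nothing , stay lo hi | _ = lower , λ j eq →
        ℚ.≤-trans (∣≤∣⇒≥ {decode (σ k)} (close-ε t≤L τ k)) (ℚ.+-monoˡ-≤ ε (hi j eq))
        where
        lower : - (ε + ε + ε) ≤ z k
        lower = ≤-by _ (0≤+ (0≤-diff lo) (0≤-diff (∣≤∣⇒≤ {decode (σ k)} (close-ε t≤L τ k))))
          (regroup (z k) (decode (σ k)) ε)
          where
          regroup : ∀ z d e → z ≡ - (e + e + e) + ((d - - (e + e)) + ((z + e) - d))
          regroup = RingSolver.solve-∀ ring

    module _ (z* : Vector N) where
      open Tracking (represents-subspace P) P-idempotent z*
      open Tracks

      Target : Set
      Target = ∀ k → 0ℚ ≤ z* k × (∀ j → source k ≡ just j → z* k ≡ 0ℚ)

      potential : Vector N → ℚ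
      potential z = ⟨ (λ i → z i - z* i) , (λ i → z i - z* i) ⟩

      norm-+ : ∀ (a p : Vector N) η → ⟨ (λ i → a i + η * p i) , (λ i → a i + η * p i) ⟩ ≡
               ⟨ a , a ⟩ + (η + η) * ⟨ p , a ⟩ + (η * η) * ⟨ p , p ⟩
      norm-+ a p η = begin
        ⟨ a+ηp , a+ηp ⟩
          ≡⟨ ⟨,⟩-+ˡ a (λ i → η * p i) a+ηp ⟩
        ⟨ a , a+ηp ⟩ + ⟨ (λ i → η * p i) , a+ηp ⟩
          ≡⟨ cong₂ _+_ (right a) (trans (⟨,⟩-*ˡ η p a+ηp) (cong (η *_) (right p))) ⟩
        (⟨ a , a ⟩ + η * ⟨ a , p ⟩) + η * (⟨ p , a ⟩ + η * ⟨ p , p ⟩)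
          ≡⟨ cong (λ x → (⟨ a , a ⟩ + η * x) + η * (⟨ p , a ⟩ + η * ⟨ p , p ⟩)) (⟨,⟩-comm a p) ⟩
        (⟨ a , a ⟩ + η * ⟨ p , a ⟩) + η * (⟨ p , a ⟩ + η * ⟨ p , p ⟩)
          ≡⟨ collect ⟨ a , a ⟩ ⟨ p , a ⟩ ⟨ p , p ⟩ η ⟩
        ⟨ a , a ⟩ + (η + η) * ⟨ p , a ⟩ + (η * η) * ⟨ p , p ⟩ ∎
        where
        open ≡-Reasoning
        a+ηp : Vector N
        a+ηp i = a i + η * p i
        right : ∀ x → ⟨ x , a+ηp ⟩ ≡ ⟨ x , a ⟩ + η * ⟨ x , p ⟩
        right x = trans (⟨,⟩-+ʳ x a (λ i → η * p i)) (cong (⟨ x , a ⟩ +_) (⟨,⟩-*ʳ x η p))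
        collect : ∀ x y w η → (x + η * y) + η * (y + η * w) ≡ x + (η + η) * y + (η * η) * w
        collect = RingSolver.solve-∀ ring

      -- The decoded value exceeds the threshold by so much that the exact
      -- value is still off by ε, in the direction of the move.
      push : Target → ∀ {t σ z k η} → t ℕ.≤ L → Tracks t σ z → Move k (decode (σ k)) (just η) →
             η * (z k - z* k) ≤ - (ε * ε) × η * η ≡ ε * ε
      push target {σ = σ} {z} {k} t≤L τ (up below) =
        ≤-by _ (0≤* 0≤ε (0≤+ (0≤+ (0≤-diff (ℚ.<⇒≤ below))
            (0≤-diff (∣≤∣⇒≥ {decode (σ k)} (close-ε t≤L τ k)))) (proj₁ (target k))))
          (regroup (z k) (z* k) (decode (σ k)) ε) , refl
        where
        regroup : ∀ z s d e → - (e * e) ≡ e * (z - s) + e * (((- (e + e) - d) + ((d + e) - z)) + s)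
        regroup = RingSolver.solve-∀ ring
      push target {σ = σ} {z} {k} t≤L τ (down j eq above) =
        ≤-by _ (0≤* 0≤ε (0≤+ (0≤-diff (ℚ.<⇒≤ above))
            (0≤-diff (∣≤∣⇒≤ {decode (σ k)} (close-ε t≤L τ k)))))
          (trans (regroup (z k) (decode (σ k)) ε)
            (cong (λ s → - ε * (z k - s) + ε * ((decode (σ k) - (ε + ε)) + ((z k + ε) - decode (σ k))))
              (sym (proj₂ (target k) j eq)))) ,
        neg*neg ε
        where
        regroup : ∀ z d e → - (e * e) ≡ - e * (z - 0ℚ) + e * ((d - (e + e)) + ((z + e) - d))
        regroup = RingSolver.solve-∀ ring

      -- As P represents the difference of `z` and `z*`, the cross term of `norm-+` is 2η times its
      -- k-th coordinate, at most -2ε² by `push`. The quadratic term is at most ε² because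
      -- `⟨ P k , P k ⟩` is at most 1.
      potential-move : Target → ∀ {t σ z k η} → t ℕ.≤ L → Tracks t σ z → Move k (decode (σ k)) (just η) →
                       potential (exact (just η) k z) ≤ potential z - ε * ε
      potential-move target {σ = σ} {z} {k} {η} t≤L τ mv with push target t≤L τ mv
      ... | pushed , η²≡ε² = ≤-by
        (((- (ε * ε) - η * a k) + (- (ε * ε) - η * a k)) + ε * ε * (1ℚ - ⟨ P k , P k ⟩))
        (0≤+ (0≤+ (0≤-diff pushed) (0≤-diff pushed))
          (0≤* (0≤-square ε) (0≤-diff (norm-P≤1 P P-idempotent k))))
        (sym (trans (cong (_+ r) (trans (sum-cong-≗ λ i → cong₂ _*_ (recentre (z i) (η * P k i) (z* i)) (recentre (z i) (η * P k i) (z* i)))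
          (trans (norm-+ a (P k) η) (cong₂ (λ x y → ⟨ a , a ⟩ + (η + η) * x + y * ⟨ P k , P k ⟩) (inside τ k) η²≡ε²))))
          (collect ⟨ a , a ⟩ η (a k) (ε * ε) ⟨ P k , P k ⟩)))
        where
        a : Vector N
        a i = z i - z* i
        r = ((- (ε * ε) - η * a k) + (- (ε * ε) - η * a k)) + ε * ε * (1ℚ - ⟨ P k , P k ⟩)
        recentre : ∀ a b c → (a + b) - c ≡ (a - c) + b
        recentre = RingSolver.solve-∀ ring
        collect : ∀ x η y e p → (x + (η + η) * y + e * p) + (((- e - η * y) + (- e - η * y)) + e * (1ℚ - p)) ≡ x - e
        collect = RingSolver.solve-∀ ring

      Quiet : State → Fin N → Set
      Quiet σ k = accept k (σ k) ≡ true

      quiet-cong : ∀ {σ σ′ k} → σ k ≡ σ′ k → Quiet σ k → Quiet σ′ k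
      quiet-cong {k = k} eq q = subst (λ a → accept k a ≡ true) eq q

      step-quiet : ∀ σ k → Quiet σ k → ∀ i → step k σ i ≡ σ i
      step-quiet σ k q i with move k (decode (σ k))
      step-quiet σ k q i  | nothing , _ = refl
      step-quiet σ k () i | just _  , _

      -- An accepting state is a fixed point, so the remaining sweeps of the schedule do it no harm.
      run-accepting : ∀ ks {σ} → Accepting σ → Accepting (run ks σ)
      run-accepting []       acc = acc
      run-accepting (k ∷ ks) {σ} acc = run-accepting ks λ i →
        quiet-cong {σ} {step k σ} (sym (step-quiet σ k (acc k) i)) (acc i)

      -- A single genuine move already loses ε², and no move adds to the potential. Without any, the
      -- state is unchanged, so the quietness found at different moments holds for one and the same
      -- state.
      run-progress : Target → ∀ ks {t σ z} → t ℕ.+ List.length ks ℕ.≤ L → Tracks t σ z →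
        ∃[ z′ ] (Tracks (t ℕ.+ List.length ks) (run ks σ) z′ ×
          (potential z′ ≤ potential z - ε * ε ⊎
           (potential z′ ≤ potential z × (∀ i → run ks σ i ≡ σ i) × All (Quiet σ) ks)))
      run-progress target [] {t} {σ} {z} _ τ =
        z , subst (λ t → Tracks t σ z) (sym (ℕ.+-identityʳ t)) τ , inj₂ (ℚ.≤-refl , (λ i → refl) , [])
      run-progress target (k ∷ ks) {t} {σ} {z} t≤L τ
        with run-progress target ks {suc t} {step k σ} (subst (ℕ._≤ L) (ℕ.+-suc t _) t≤L)
               (tracks-move k (ℕ.≤-trans (ℕ.m≤m+n (suc t) _) (subst (ℕ._≤ L) (ℕ.+-suc t _) t≤L))
                 (proj₂ (move k (decode (σ k)))) τ)
      ... | z′ , τ′ , progress = z′ , subst (λ t → Tracks t (run ks (step k σ)) z′) (sym (ℕ.+-suc t _)) τ′ ,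
            conclude (proj₂ (move k (decode (σ k)))) refl progress
        where
        first = exact (proj₁ (move k (decode (σ k)))) k z
        conclude : ∀ {m} → Move k (decode (σ k)) m → m ≡ proj₁ (move k (decode (σ k))) →
          (potential z′ ≤ potential first - ε * ε ⊎
           (potential z′ ≤ potential first × (∀ i → run ks (step k σ) i ≡ step k σ i) × All (Quiet (step k σ)) ks)) →
          (potential z′ ≤ potential z - ε * ε ⊎
           (potential z′ ≤ potential z × (∀ i → run ks (step k σ) i ≡ σ i) × All (Quiet σ) (k ∷ ks)))
        conclude {just η} mv eq progress = inj₁ (ℚ.≤-trans (weaken progress)
          (subst (λ m → potential (exact m k z) ≤ potential z - ε * ε) eq
            (potential-move target (ℕ.≤-trans (ℕ.m≤m+n t _) t≤L) τ mv)))
          where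
          weaken : ∀ {B} → (potential z′ ≤ potential first - ε * ε ⊎ (potential z′ ≤ potential first × B)) →
                   potential z′ ≤ potential first
          weaken (inj₂ (le , _)) = le
          weaken (inj₁ le) = ℚ.≤-trans le (≤-by (ε * ε) (0≤-square ε) (restore (potential first) (ε * ε)))
            where
            restore : ∀ x y → x ≡ (x - y) + y
            restore = RingSolver.solve-∀ ring
        conclude {nothing} mv eq progress = still progress
          where
          quiet : Quiet σ k
          quiet = cong is-nothing (sym eq)
          same : potential first ≡ potential z
          same = cong (λ m → potential (exact m k z)) (sym eq)
          still : _ → _
          still (inj₁ le) = inj₁ (subst (λ x → potential z′ ≤ x - ε * ε) same le)
          still (inj₂ (le , fixed , quiets)) = inj₂ (subst (potential z′ ≤_) same le ,
            (λ i → trans (fixed i) (step-quiet σ k quiet i)) ,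
            quiet ∷ All.map (λ {j} → quiet-cong {step k σ} {σ} (step-quiet σ k quiet j)) quiets)

      -- Each sweep that does not find an accepting state consumes ε² of a nonnegative potential.
      sweeps : Target → ∀ r {t σ z} → t ℕ.+ r ℕ.* N ℕ.≤ L → Tracks t σ z →
               Accepting (run (schedule r) σ) ⊎ fromℕ r * (ε * ε) ≤ potential z
      sweeps target zero {z = z} _ _ = inj₂ (subst (_≤ potential z) (sym (ℚ.*-zeroˡ (ε * ε)))
        (sum-nonNeg λ i → 0≤-square (z i - z* i)))
      sweeps target (suc r) {t} {σ} {z} t≤L τ
        with run-progress target (List.allFin N) {t} {σ} {z} (ℕ.≤-trans (ℕ.+-monoʳ-≤ t
               (ℕ.≤-trans (ℕ.≤-reflexive len) (ℕ.m≤m+n N (r ℕ.* N)))) t≤L) τ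
        where
        len : List.length (List.allFin N) ≡ N
        len = List.length-tabulate {n = N} (λ i → i)
      ... | z′ , τ′ , inj₂ (_ , fixed , quiets) = inj₁ (subst Accepting
              (sym (run-++ (List.allFin N) (schedule r) σ))
              (run-accepting (schedule r) λ k → quiet-cong {σ} {run (List.allFin N) σ} (sym (fixed k)) (All.lookup quiets (List.∈-allFin k))))
      ... | z′ , τ′ , inj₁ less
        with sweeps target r {t ℕ.+ List.length (List.allFin N)} {run (List.allFin N) σ} {z′}
               (ℕ.≤-trans (ℕ.≤-reflexive (trans (cong (λ l → t ℕ.+ l ℕ.+ r ℕ.* N) (List.length-tabulate {n = N} (λ i → i)))
                 (ℕ.+-assoc t N (r ℕ.* N)))) t≤L) τ′
      ...   | inj₁ acc = inj₁ (subst Accepting (sym (run-++ (List.allFin N) (schedule r) σ)) acc)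
      ...   | inj₂ le  = inj₂ (begin
        fromℕ (suc r) * (ε * ε)            ≡⟨ cong (_* (ε * ε)) (fromℕ-suc r) ⟩
        (1ℚ + fromℕ r) * (ε * ε)           ≡⟨ expand (fromℕ r) (ε * ε) ⟩
        fromℕ r * (ε * ε) + ε * ε          ≤⟨ ℚ.+-monoˡ-≤ (ε * ε) (ℚ.≤-trans le less) ⟩
        (potential z - ε * ε) + ε * ε      ≡⟨ restore (potential z) (ε * ε) ⟩
        potential z                        ∎)
        where
        open ℚ.≤-Reasoning
        expand : ∀ x y → (1ℚ + x) * y ≡ x * y + y
        expand = RingSolver.solve-∀ ring
        restore : ∀ x y → (x - y) + y ≡ x
        restore = RingSolver.solve-∀ ring

-- Circuits from robustly separated affine systems

bit : Bool → ℚ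
bit b = if b then 1ℚ else 0ℚ

reciprocal : ∀ n → ∃[ r ] (0ℚ < r × fromℕ (suc n) * r ≡ 1ℚ)
reciprocal n = inverse (0<fromℕ-suc n)

reciprocal≤1 : ∀ n r → 0ℚ < r → fromℕ (suc n) * r ≡ 1ℚ → r ≤ 1ℚ
reciprocal≤1 n r 0<r nr≡1 = begin
  r                   ≡⟨ ℚ.*-identityˡ r ⟨
  1ℚ * r              ≤⟨ ℚ.*-monoʳ-≤-nonNeg r {{ℚ.nonNegative (ℚ.<⇒≤ 0<r)}} (fromℕ-mono {1} {suc n} (ℕ.s≤s ℕ.z≤n)) ⟩
  fromℕ (suc n) * r   ≡⟨ nr≡1 ⟩
  1ℚ                  ∎
  where open ℚ.≤-Reasoning

grid-point : ∀ {ρ} → 0ℚ ≤ ρ → ∀ m q → 0ℚ ≤ q → q ≤ fromℕ m * ρ →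
             Σ[ a ∈ Fin (suc m) ] ∣ fromℕ (toℕ a) * ρ - q ∣ ≤ ρ
grid-point {ρ} 0≤ρ zero q 0≤q q≤0 = zero , subst (λ x → ∣ x - q ∣ ≤ ρ) (sym (ℚ.*-zeroˡ ρ))
  (∣p∣≤q (≤-by (ρ + q) (0≤+ 0≤ρ 0≤q) (rearrange ρ q))
         (≤-by (ρ + (0ℚ - q)) (0≤+ 0≤ρ (0≤-diff (subst (q ≤_) (ℚ.*-zeroˡ ρ) q≤0))) (rearrange′ ρ q)))
  where
  rearrange : ∀ ρ q → ρ ≡ (0ℚ - q) + (ρ + q)
  rearrange = RingSolver.solve-∀ ring
  rearrange′ : ∀ ρ q → ρ ≡ - (0ℚ - q) + (ρ + (0ℚ - q))
  rearrange′ = RingSolver.solve-∀ ring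
grid-point {ρ} 0≤ρ (suc m) q 0≤q q≤ with q ℚ.≤? fromℕ m * ρ
... | yes q≤m with grid-point 0≤ρ m q 0≤q q≤m
...   | a , close = Fin.inject₁ a , subst (λ i → ∣ fromℕ i * ρ - q ∣ ≤ ρ) (sym (Fin.toℕ-inject₁ a)) close
grid-point {ρ} 0≤ρ (suc m) q 0≤q q≤ | no q≰m = Fin.fromℕ (suc m) ,
  subst (λ i → ∣ fromℕ i * ρ - q ∣ ≤ ρ) (sym (Fin.toℕ-fromℕ (suc m)))
    (∣p∣≤q (≤-by _ (0≤-diff (ℚ.<⇒≤ (ℚ.≰⇒> q≰m))) (trans (rearrange (fromℕ m) ρ q)
              (cong (λ x → (x * ρ - q) + (q - fromℕ m * ρ)) (sym (fromℕ-suc m)))))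
           (≤-by _ (0≤+ 0≤ρ (0≤-diff q≤)) (rearrange′ (fromℕ (suc m) * ρ) ρ q)))
  where
  rearrange : ∀ m ρ q → ρ ≡ ((1ℚ + m) * ρ - q) + (q - m * ρ)
  rearrange = RingSolver.solve-∀ ring
  rearrange′ : ∀ x ρ q → ρ ≡ - (x - q) + (ρ + (x - q))
  rearrange′ = RingSolver.solve-∀ ring

-- Counts the grid points of spacing 1/(G+1) from -H to H.
letterCount : ℕ → ℕ → ℕ
letterCount H G = suc ((H ℕ.+ H) ℕ.* suc G)

module Grid (H G : ℕ) where

  abstract
    ρ : ℚ
    ρ = proj₁ (reciprocal G)

    0<ρ : 0ℚ < ρ
    0<ρ = proj₁ (proj₂ (reciprocal G))

    Gρ≡1 : fromℕ (suc G) * ρ ≡ 1ℚ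
    Gρ≡1 = proj₂ (proj₂ (reciprocal G))

  letters : ℕ
  letters = letterCount H G

  decode : Fin letters → ℚ
  decode a = fromℕ (toℕ a) * ρ - fromℕ H

  nearest : ∀ q → ∣ q ∣ ≤ fromℕ H → Σ[ a ∈ Fin letters ] ∣ decode a - q ∣ ≤ ρ
  nearest q ∣q∣≤H = proj₁ point , subst (λ x → ∣ x ∣ ≤ ρ)
    (regroup (fromℕ (toℕ (proj₁ point)) * ρ) q (fromℕ H)) (proj₂ point)
    where
    minus-neg : ∀ h q → h - - q ≡ q + h
    minus-neg = RingSolver.solve-∀ ring
    regroup : ∀ x q h → x - (q + h) ≡ (x - h) - q
    regroup = RingSolver.solve-∀ ring
    width : fromℕ ((H ℕ.+ H) ℕ.* suc G) * ρ ≡ fromℕ H + fromℕ H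
    width = begin
      fromℕ ((H ℕ.+ H) ℕ.* suc G) * ρ              ≡⟨ cong (_* ρ) (fromℕ-homo-* (H ℕ.+ H) (suc G)) ⟩
      fromℕ (H ℕ.+ H) * fromℕ (suc G) * ρ          ≡⟨ ℚ.*-assoc (fromℕ (H ℕ.+ H)) (fromℕ (suc G)) ρ ⟩
      fromℕ (H ℕ.+ H) * (fromℕ (suc G) * ρ)        ≡⟨ cong (fromℕ (H ℕ.+ H) *_) Gρ≡1 ⟩
      fromℕ (H ℕ.+ H) * 1ℚ                         ≡⟨ ℚ.*-identityʳ (fromℕ (H ℕ.+ H)) ⟩
      fromℕ (H ℕ.+ H)                              ≡⟨ fromℕ-homo-+ H H ⟩
      fromℕ H + fromℕ H                            ∎
      where open ≡-Reasoning
    point : Σ[ a ∈ Fin letters ] ∣ fromℕ (toℕ a) * ρ - (q + fromℕ H) ∣ ≤ ρ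
    point = grid-point (ℚ.<⇒≤ 0<ρ) ((H ℕ.+ H) ℕ.* suc G) (q + fromℕ H)
      (subst (0ℚ ≤_) (minus-neg (fromℕ H) q) (0≤-diff (ℚ.≤-trans (-p≤∣p∣ q) ∣q∣≤H)))
      (ℚ.≤-trans (ℚ.+-monoˡ-≤ (fromℕ H) (ℚ.≤-trans (p≤∣p∣ q) ∣q∣≤H)) (ℚ.≤-reflexive (sym width)))

  nearest? : ∀ q → Dec (∣ q ∣ ≤ fromℕ H) → Σ[ a ∈ Fin letters ] (∣ q ∣ ≤ fromℕ H → ∣ decode a - q ∣ ≤ ρ)
  nearest? q (yes ∣q∣≤H) = let a , close = nearest q ∣q∣≤H in a , λ _ → close
  -- An arbitrary letter: runs of admissible length never round a value outside the range.
  nearest? q (no ∣q∣≰H)  = zero , λ ∣q∣≤H → ⊥-elim (∣q∣≰H ∣q∣≤H)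

  abstract
    encode : ℚ → Fin letters
    encode q = proj₁ (nearest? q (∣ q ∣ ℚ.≤? fromℕ H))

    encode-close : ∀ q → ∣ q ∣ ≤ fromℕ H → ∣ decode (encode q) - q ∣ ≤ ρ
    encode-close q = proj₂ (nearest? q (∣ q ∣ ℚ.≤? fromℕ H))

Unit : ℚ → Set
Unit q = 0ℚ ≤ q × q ≤ 1ℚ

bit-unit : ∀ b → Unit (bit b)
bit-unit true  = 0≤1 , ℚ.≤-refl
bit-unit false = ℚ.≤-refl , 0≤1

∣unit-unit∣≤1 : ∀ {p q} → Unit p → Unit q → ∣ p - q ∣ ≤ 1ℚ
∣unit-unit∣≤1 {p} {q} (0≤p , p≤1) (0≤q , q≤1) = ∣p∣≤q
  (≤-by _ (0≤+ (0≤-diff p≤1) 0≤q) (rearrange p q))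
  (≤-by _ (0≤+ (0≤-diff q≤1) 0≤p) (rearrange′ p q))
  where
  rearrange : ∀ p q → 1ℚ ≡ (p - q) + ((1ℚ - p) + q)
  rearrange = RingSolver.solve-∀ ring
  rearrange′ : ∀ p q → 1ℚ ≡ - (p - q) + ((1ℚ - q) + p)
  rearrange′ = RingSolver.solve-∀ ring

∣∣≤1⇒square≤1 : ∀ {q} → ∣ q ∣ ≤ 1ℚ → q * q ≤ 1ℚ
∣∣≤1⇒square≤1 {q} h = ≤-by _
  (0≤* (0≤-diff (ℚ.≤-trans (p≤∣p∣ q) h)) (0≤-diff (ℚ.≤-trans (-p≤∣p∣ q) h))) (factor q)
  where
  factor : ∀ q → 1ℚ ≡ q * q + (1ℚ - q) * (1ℚ - - q)
  factor = RingSolver.solve-∀ ring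

-- The initial potential is at most N and ε is 1/(E+1), so N(E+1)²+1 sweeps would overspend it. With
-- T the number of steps, the range 3+T covers a drift of ε per step, and the spacing makes T+1
-- roundings cost at most ε.
sweepCount stepCount gridSize : ℕ → ℕ → ℕ
sweepCount N E = suc (N ℕ.* (suc E ℕ.* suc E))
stepCount N E = sweepCount N E ℕ.* N
gridSize N E = letterCount (3 ℕ.+ stepCount N E) (suc (stepCount N E) ℕ.* suc E)

separatorSize : ℕ → ℕ → ℕ
separatorSize N E = network-size N (gridSize N E) (stepCount N E)

module Separator {n N d : ℕ}
  (source : Fin N → Maybe (Fin n)) (base : Vector N) (g : Fin d → Vector N)
  (InL : Vec Bool n → Set)
  (E : ℕ) (ε : ℚ) (0<ε : 0ℚ < ε) (Eε≡1 : fromℕ (suc E) * ε ≡ 1ℚ)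
  where

  point : Vector d → Vector N
  point u k = base k + combination u g k

  shift : Vec Bool n → Vector N
  shift w k = bit (bitAt (source k) w)

  -- The upper bound 1 serves the potential: two solutions differ by at most 1 in each coordinate,
  -- so their squared distance is at most N.
  Solves : Vec Bool n → Vector d → Set
  Solves w u = ∀ k → Unit (point u k) × (∀ j → source k ≡ just j → point u k ≡ shift w k)

  NearlySolves : Vec Bool n → Vector d → Set
  NearlySolves w u = ∀ k → - (ε + ε + ε) ≤ point u k - shift w k ×
    (∀ j → source k ≡ just j → point u k - shift w k ≤ ε + ε + ε)

  module _ (w₀ : Vec Bool n) (L₀ : InL w₀)
    (complete : ∀ w → InL w → Σ[ u ∈ Vector d ] Solves w u)
    (sound : ∀ w u → NearlySolves w u → InL w)
    where

    private
      u₀ = proj₁ (complete w₀ L₀)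

      representer = representers g
      P = proj₁ representer
      P-generator = proj₁ (proj₂ representer)
      P-span = proj₂ (proj₂ representer)

      P-idempotent : ∀ k → Represents P (P k)
      P-idempotent k = span-least (represents-subspace P) P-generator (P-span k)

      sweeps# steps : ℕ
      sweeps# = sweepCount N E
      steps = stepCount N E

      open Grid (3 ℕ.+ steps) (suc steps ℕ.* suc E)

      ρ-small : fromℕ (suc steps) * ρ ≤ ε
      ρ-small = ℚ.*-cancelˡ-≤-pos (fromℕ (suc E)) {{ℚ.positive (0<fromℕ-suc E)}} (begin
        fromℕ (suc E) * (fromℕ (suc steps) * ρ)   ≡⟨ regroup (fromℕ (suc E)) (fromℕ (suc steps)) ρ ⟩
        fromℕ (suc steps) * fromℕ (suc E) * ρ     ≡⟨ cong (_* ρ) (fromℕ-homo-* (suc steps) (suc E)) ⟨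
        fromℕ (suc steps ℕ.* suc E) * ρ           ≤⟨ ℚ.*-monoʳ-≤-nonNeg ρ {{ℚ.nonNegative (ℚ.<⇒≤ 0<ρ)}} (fromℕ-mono (ℕ.n≤1+n (suc steps ℕ.* suc E))) ⟩
        fromℕ (suc (suc steps ℕ.* suc E)) * ρ     ≡⟨ Gρ≡1 ⟩
        1ℚ                                        ≡⟨ Eε≡1 ⟨
        fromℕ (suc E) * ε                         ∎)
        where
        open ℚ.≤-Reasoning
        regroup : ∀ a b c → a * (b * c) ≡ b * a * c
        regroup = RingSolver.solve-∀ ring

      in-range : ε + (1ℚ + fromℕ (suc steps) * ε) ≤ fromℕ (3 ℕ.+ steps)
      in-range = begin
        ε + (1ℚ + fromℕ (suc steps) * ε)     ≤⟨ ℚ.+-mono-≤ ε≤1 (ℚ.+-monoʳ-≤ 1ℚ (*-mono-≤ (0≤fromℕ (suc steps)) 0≤1 ℚ.≤-refl ε≤1)) ⟩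
        1ℚ + (1ℚ + fromℕ (suc steps) * 1ℚ)   ≡⟨ cong (λ x → 1ℚ + (1ℚ + x)) (ℚ.*-identityʳ (fromℕ (suc steps))) ⟩
        1ℚ + (1ℚ + fromℕ (suc steps))        ≡⟨ cong (λ x → 1ℚ + x) (fromℕ-suc (suc steps)) ⟨
        1ℚ + fromℕ (2 ℕ.+ steps)             ≡⟨ fromℕ-suc (2 ℕ.+ steps) ⟨
        fromℕ (3 ℕ.+ steps)                  ∎
        where
        open ℚ.≤-Reasoning
        ε≤1 = reciprocal≤1 E ε 0<ε Eε≡1

      open Relaxation source P P-idempotent ε 0<ε decode encode (fromℕ (3 ℕ.+ steps)) ρ
        (ℚ.<⇒≤ 0<ρ) encode-close (suc steps) ρ-small in-range

      -- The solution for `w₀` is the starting point for every input; only the subtracted bit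
      -- depends on the word.
      start : Fin N → Bool → Fin letters
      start k b = encode (point u₀ k - bit b)

      open Run start
      open Network source start update accept using (initial; network-circuit)

      z₀ : Vec Bool n → Vector N
      z₀ w k = point u₀ k - shift w k

      z₀-range : ∀ w k → ∣ z₀ w k ∣ ≤ 1ℚ
      z₀-range w k = ∣unit-unit∣≤1 (proj₁ (proj₂ (complete w₀ L₀) k)) (bit-unit (bitAt (source k) w))

      -- The count starts at 1 because encoding the initial point is itself a rounding; hence
      -- `suc steps` in the instance of `Relaxation`.
      initial-tracks : ∀ {Q} (S : Subspace Q) (QP : ∀ k → Q (P k)) centre w →
        Q (λ i → z₀ w i - centre i) → Tracking.Tracks S QP centre 1 (initial w) (z₀ w)
      initial-tracks S QP centre w q = record
        { close  = λ k → ℚ.≤-trans (encode-close (z₀ w k) (ℚ.≤-trans (z₀-range w k) (fromℕ-mono {1} {3 ℕ.+ steps} (ℕ.s≤s ℕ.z≤n))))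
                           (ℚ.≤-reflexive (sym (ℚ.*-identityˡ ρ)))
        ; range  = λ k → ℚ.≤-trans (z₀-range w k) (≤-by (1ℚ * ε) (0≤* 0≤1 (ℚ.<⇒≤ 0<ε)) refl)
        ; inside = q
        }

      final : Vec Bool n → Fin N → Fin letters
      final w = run (schedule sweeps#) (initial w)

      accepts : ∀ w → InL w → Accepting (final w)
      accepts w inL = conclude outcome
        where
        u = proj₁ (complete w inL)
        solves = proj₂ (complete w inL)
        z* : Vector N
        z* k = point u k - shift w k
        -- The shift by w cancels, so the difference lies in the direction space and can be
        -- represented by P.
        difference : ∀ k → z₀ w k - z* k ≡ point u₀ k - point u k
        difference k = cancel (point u₀ k) (point u k) (shift w k)
          where
          cancel : ∀ a b s → (a - s) - (b - s) ≡ a - b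
          cancel = RingSolver.solve-∀ ring
        inside : Represents P (λ i → z₀ w i - z* i)
        inside = Subspace.resp (represents-subspace P) (λ k → sym (trans (difference k) (cancel (base k) _ _)))
          (Subspace.plus (represents-subspace P) (span u₀) (Subspace.scale (represents-subspace P) (- 1ℚ) (span u)))
          where
          span : ∀ u → Represents P (combination u g)
          span u = Subspace.combine (represents-subspace P) u P-generator
          cancel : ∀ b x y → (b + x) - (b + y) ≡ x + - 1ℚ * y
          cancel = RingSolver.solve-∀ ring
        target : Target z*
        target k = nonneg (source k) refl , zeros
          where
          zeros : ∀ j → source k ≡ just j → z* k ≡ 0ℚ
          zeros j eq = trans (cong (_- shift w k) (proj₂ (solves k) j eq)) (ℚ.+-inverseʳ (shift w k))
          nonneg : ∀ m → source k ≡ m → 0ℚ ≤ z* k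
          nonneg (just j) eq = ℚ.≤-reflexive (sym (zeros j eq))
          nonneg nothing  eq = 0≤-diff (subst (λ m → bit (bitAt m w) ≤ point u k) (sym eq) (proj₁ (proj₁ (solves k))))
        outcome : Accepting (final w) ⊎ fromℕ sweeps# * (ε * ε) ≤ potential z* (z₀ w)
        outcome = sweeps z* target sweeps# {1} {initial w} {z₀ w} ℕ.≤-refl
          (initial-tracks (represents-subspace P) P-idempotent z* w inside)
        open ℚ.≤-Reasoning
        low : potential z* (z₀ w) < fromℕ sweeps# * (ε * ε)
        low = begin-strict
          potential z* (z₀ w)
            ≤⟨ sum-mono (λ k → ∣∣≤1⇒square≤1 (subst (λ x → ∣ x ∣ ≤ 1ℚ) (sym (difference k))
                 (∣unit-unit∣≤1 (proj₁ (proj₂ (complete w₀ L₀) k)) (proj₁ (solves k))))) ⟩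
          sum {N} (λ _ → 1ℚ)
            ≡⟨ sum-const N 1ℚ ⟩
          fromℕ N * 1ℚ
            ≡⟨ cong (fromℕ N *_) (sym (cong₂ _*_ Eε≡1 Eε≡1)) ⟩
          fromℕ N * ((fromℕ (suc E) * ε) * (fromℕ (suc E) * ε))
            <⟨ <-by (ε * ε) (0<* 0<ε 0<ε) refl ⟩
          fromℕ N * ((fromℕ (suc E) * ε) * (fromℕ (suc E) * ε)) + ε * ε
            ≡⟨ collect (fromℕ N) (fromℕ (suc E)) ε ⟩
          (1ℚ + fromℕ N * (fromℕ (suc E) * fromℕ (suc E))) * (ε * ε)
            ≡⟨ cong (λ x → (1ℚ + x) * (ε * ε)) (trans (fromℕ-homo-* N (suc E ℕ.* suc E)) (cong (fromℕ N *_) (fromℕ-homo-* (suc E) (suc E)))) ⟨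
          (1ℚ + fromℕ (N ℕ.* (suc E ℕ.* suc E))) * (ε * ε)
            ≡⟨ cong (_* (ε * ε)) (fromℕ-suc (N ℕ.* (suc E ℕ.* suc E))) ⟨
          fromℕ sweeps# * (ε * ε) ∎
          where
          collect : ∀ n e ε → n * ((e * ε) * (e * ε)) + ε * ε ≡ (1ℚ + n * (e * e)) * (ε * ε)
          collect = RingSolver.solve-∀ ring

        conclude : Accepting (final w) ⊎ fromℕ sweeps# * (ε * ε) ≤ potential z* (z₀ w) → Accepting (final w)
        conclude (inj₁ acc)  = acc
        conclude (inj₂ high) = ⊥-elim (<⇒≱ low high)

      -- The exact companion has moved within the span of `g`; adding the coefficients of its
      -- displacement to `u₀` gives the parameters of a near solution.
      near : ∀ w → Accepting (final w) → Σ[ u ∈ Vector d ] NearlySolves w u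
      near w acc = (λ j → u₀ j + proj₁ displacement j) , λ k →
        subst Near (reposition k) (proj₁ (close k)) , λ j eq → subst (_≤ ε + ε + ε) (reposition k) (proj₂ (close k) j eq)
        where
        Near : ℚ → Set
        Near q = - (ε + ε + ε) ≤ q
        S = span-subspace g
        len : 1 ℕ.+ List.length (schedule sweeps#) ℕ.≤ suc steps
        len = ℕ.≤-reflexive (cong suc (length-schedule sweeps#))
        tracked = tracks-run S P-span (z₀ w) (schedule sweeps#) len
          (initial-tracks S P-span (z₀ w) w
            (Subspace.resp S (λ i → sym (ℚ.+-inverseʳ (z₀ w i))) (Subspace.null S)))
        z = proj₁ tracked
        displacement : Span g (λ i → z i - z₀ w i)
        displacement = Tracking.Tracks.inside (proj₂ tracked)
        close = accepting⇒near S P-span (z₀ w) len (proj₂ tracked) acc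
        reposition : ∀ k → z k ≡ point (λ j → u₀ j + proj₁ displacement j) k - shift w k
        reposition k = begin
          z k
            ≡⟨ regroup (z k) (base k) (combination u₀ g k) (shift w k) ⟩
          base k + (combination u₀ g k + (z k - z₀ w k)) - shift w k
            ≡⟨ cong (λ x → base k + (combination u₀ g k + x) - shift w k) (proj₂ displacement k) ⟩
          base k + (combination u₀ g k + combination (proj₁ displacement) g k) - shift w k
            ≡⟨ cong (λ x → base k + x - shift w k) (⟨,⟩-+ˡ u₀ (proj₁ displacement) (λ j → g j k)) ⟨
          point (λ j → u₀ j + proj₁ displacement j) k - shift w k ∎
          where
          open ≡-Reasoning
          regroup : ∀ z b c s → z ≡ b + (c + (z - ((b + c) - s))) - s
          regroup = RingSolver.solve-∀ ring

    separator : ∃[ s ] (s ℕ.≤ separatorSize N E × Σ[ C ∈ Circuit n s ]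
                  (∀ w → InL w ⇔ evalCircuit C w ≡ true))
    separator = let s , s≤ , C , correct = network-circuit (schedule sweeps#) in s ,
      subst (λ T → s ℕ.≤ network-size N letters T) (length-schedule sweeps#) s≤ ,
      C , λ w → mk⇔
        (λ inL → Equivalence.from (correct w) (accepts w inL))
        (λ out → let u , nearly = near w (Equivalence.to (correct w) out) in sound w u nearly)

-- Normalising the slacks and mixing in their maximisers

maximiser : ∀ {n} (f : Vec Bool n → ℚ) → ∃[ w ] (∀ v → f v ≤ f w)
maximiser {zero}  f = Vec.[] , λ { Vec.[] → ℚ.≤-refl }
maximiser {suc n} f with maximiser (f ∘ (true Vec.∷_)) | maximiser (f ∘ (false Vec.∷_))
... | w , f≤ | w′ , f≤′ with ℚ.≤-total (f (true Vec.∷ w)) (f (false Vec.∷ w′))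
...   | inj₁ le = false Vec.∷ w′ , λ { (true Vec.∷ v) → ℚ.≤-trans (f≤ v) le ; (false Vec.∷ v) → f≤′ v }
...   | inj₂ le = true Vec.∷ w , λ { (true Vec.∷ v) → f≤ v ; (false Vec.∷ v) → ℚ.≤-trans (f≤′ v) le }

affine : ∀ {d} → ℚ → Vector d → Vector d → ℚ
affine β a u = β + ⟨ u , a ⟩

affine-scale : ∀ {d} c β (a u : Vector d) → affine (c * β) (λ j → c * a j) u ≡ c * affine β a u
affine-scale c β a u = trans (cong (c * β +_) (⟨,⟩-*ʳ u c a)) (sym (ℚ.*-distribˡ-+ c β ⟨ u , a ⟩))

-- The weights are c for `u` and c * δ for each of the m points; they sum to 1 when c inverts
-- `1ℚ + fromℕ m * δ`.
mixture : ∀ {d m} → ℚ → ℚ → Vector d → (Fin m → Vector d) → Vector d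
mixture c δ u V j = c * (u j + combination (λ _ → δ) V j)

-- Affine maps commute with convex combinations; `mass` lets the constant term be spread over all
-- summands.
affine-mixture : ∀ {d m} c δ (u : Vector d) (V : Fin m → Vector d) → (1ℚ + fromℕ m * δ) * c ≡ 1ℚ → ∀ β a →
  affine β a (mixture c δ u V) ≡ c * (affine β a u + sum (λ l → δ * affine β a (V l)))
affine-mixture {m = m} c δ u V mass β a = begin
  β + ⟨ mixture c δ u V , a ⟩
    ≡⟨ cong (β +_) (trans (⟨,⟩-*ˡ c (λ j → u j + combination (λ _ → δ) V j) a) (cong (c *_) (⟨,⟩-+ˡ u (combination (λ _ → δ) V) a))) ⟩
  β + c * (⟨ u , a ⟩ + ⟨ combination (λ _ → δ) V , a ⟩)
    ≡⟨ cong (λ x → β + c * (⟨ u , a ⟩ + x)) (trans (⟨,⟩-comm (combination (λ _ → δ) V) a) (⟨,⟩-combinationʳ a (λ _ → δ) V)) ⟩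
  β + c * (⟨ u , a ⟩ + sum (λ l → δ * ⟨ a , V l ⟩))
    ≡⟨ cong (λ x → β + c * (⟨ u , a ⟩ + x)) (sum-cong-≗ λ l → cong (δ *_) (⟨,⟩-comm a (V l))) ⟩
  β + c * (⟨ u , a ⟩ + Σδ)
    ≡⟨ cong (λ x → x + c * (⟨ u , a ⟩ + Σδ)) (trans (sym (ℚ.*-identityʳ β)) (cong (β *_) (sym mass))) ⟩
  β * ((1ℚ + fromℕ m * δ) * c) + c * (⟨ u , a ⟩ + Σδ)
    ≡⟨ regroup β (fromℕ m) δ c ⟨ u , a ⟩ Σδ ⟩
  c * ((β + ⟨ u , a ⟩) + (fromℕ m * (δ * β) + Σδ))
    ≡⟨ cong (λ x → c * ((β + ⟨ u , a ⟩) + x)) (sym sum-affine) ⟩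
  c * (affine β a u + sum (λ l → δ * affine β a (V l))) ∎
  where
  open ≡-Reasoning
  Σδ = sum (λ l → δ * ⟨ V l , a ⟩)
  regroup : ∀ β m δ c x y → β * ((1ℚ + m * δ) * c) + c * (x + y) ≡ c * ((β + x) + (m * (δ * β) + y))
  regroup = RingSolver.solve-∀ ring
  sum-affine : sum (λ l → δ * affine β a (V l)) ≡ fromℕ m * (δ * β) + Σδ
  sum-affine = trans (sum-cong-≗ λ l → ℚ.*-distribˡ-+ δ β ⟨ V l , a ⟩)
    (trans (∑-distrib-+ (λ _ → δ * β) (λ l → δ * ⟨ V l , a ⟩)) (cong (_+ Σδ) (sum-const m (δ * β))))

-- `rep` stands for a retraction of all words onto the language, so that a maximum over the language
-- becomes one over the whole cube, where `maximiser` can recurse. Positivity of the slacks makes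
-- the maxima invertible.
module Normalise {n d m : ℕ}
  (x : Fin n → Vector d) (β : Fin m → ℚ) (a : Fin m → Vector d)
  (InL : Vec Bool n → Set) (w₀ : Vec Bool n) (L₀ : InL w₀)
  (rep : Vec Bool n → Vec Bool n) (rep-id : ∀ w → InL w → rep w ≡ w)
  (U : Vec Bool n → Vector d)
  (U-x : ∀ w i → ⟨ U w , x i ⟩ ≡ bit (lookup (rep w) i))
  (U-slack : ∀ w k → 0ℚ < affine (β k) (a k) (U w))
  (θ : ℚ)
  (sound : ∀ w u → (∀ i → ∣ ⟨ u , x i ⟩ - bit (lookup w i) ∣ ≤ θ) → (∀ k → 0ℚ ≤ affine (β k) (a k) u) → InL w)
  (E : ℕ) (ε : ℚ) (0<ε : 0ℚ < ε) (Eε≡1 : fromℕ (suc E) * ε ≡ 1ℚ)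
  (ε-small : (ε + ε + ε) * (1ℚ + fromℕ m) ≤ θ)
  where

  private
    slack : Fin m → Vector d → ℚ
    slack k = affine (β k) (a k)

    top : Fin m → Vec Bool n
    top k = proj₁ (maximiser (λ w → slack k (U w)))

    scale : Fin m → ℚ
    scale k = proj₁ (inverse (U-slack (top k) k))

    0<scale : ∀ k → 0ℚ < scale k
    0<scale k = proj₁ (proj₂ (inverse (U-slack (top k) k)))

    scaled : Fin m → Vector d → ℚ
    scaled k = affine (scale k * β k) (λ j → scale k * a k j)

    scaled≡ : ∀ k u → scaled k u ≡ scale k * slack k u
    scaled≡ k = affine-scale (scale k) (β k) (a k)

    scaled-top : ∀ k → scaled k (U (top k)) ≡ 1ℚ
    scaled-top k = trans (scaled≡ k (U (top k))) (trans (ℚ.*-comm (scale k) _) (proj₂ (proj₂ (inverse (U-slack (top k) k)))))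

    0≤scaled : ∀ k w → 0ℚ ≤ scaled k (U w)
    0≤scaled k w = subst (0ℚ ≤_) (sym (scaled≡ k (U w))) (0≤* (ℚ.<⇒≤ (0<scale k)) (ℚ.<⇒≤ (U-slack w k)))

    scaled≤1 : ∀ k w → scaled k (U w) ≤ 1ℚ
    scaled≤1 k w = begin
      scaled k (U w)               ≡⟨ scaled≡ k (U w) ⟩
      scale k * slack k (U w)       ≤⟨ ℚ.*-monoˡ-≤-nonNeg (scale k) {{ℚ.nonNegative (ℚ.<⇒≤ (0<scale k))}} (proj₂ (maximiser (λ w → slack k (U w))) w) ⟩
      scale k * slack k (U (top k)) ≡⟨ scaled≡ k (U (top k)) ⟨
      scaled k (U (top k))         ≡⟨ scaled-top k ⟩
      1ℚ                           ∎
      where open ℚ.≤-Reasoning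

    source′ : Fin n ⊎ Fin m → Maybe (Fin n)
    source′ (inj₁ i) = just i
    source′ (inj₂ k) = nothing

    base′ : Fin n ⊎ Fin m → ℚ
    base′ (inj₁ i) = 0ℚ
    base′ (inj₂ k) = scale k * β k

    g′ : Fin d → Fin n ⊎ Fin m → ℚ
    g′ j (inj₁ i) = x i j
    g′ j (inj₂ k) = scale k * a k j

    open Separator {n} {n ℕ.+ m} {d} (source′ ∘ Fin.splitAt n) (base′ ∘ Fin.splitAt n) (λ j → g′ j ∘ Fin.splitAt n)
      InL E ε 0<ε Eε≡1

    point′ : Vector d → Fin n ⊎ Fin m → ℚ
    point′ u κ = base′ κ + ⟨ u , (λ j → g′ j κ) ⟩

    solves′ : ∀ w → rep w ≡ w → ∀ κ → Unit (point′ (U w) κ) ×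
              (∀ j → source′ κ ≡ just j → point′ (U w) κ ≡ bit (bitAt (source′ κ) w))
    solves′ w rep≡ (inj₁ i) = subst Unit (sym coordinate) (bit-unit (lookup w i)) , λ _ _ → coordinate
      where
      coordinate : 0ℚ + ⟨ U w , x i ⟩ ≡ bit (lookup w i)
      coordinate = trans (ℚ.+-identityˡ ⟨ U w , x i ⟩) (trans (U-x w i) (cong (λ v → bit (lookup v i)) rep≡))
    solves′ w rep≡ (inj₂ k) = (0≤scaled k w , scaled≤1 k w) , λ _ ()

    complete : ∀ w → InL w → Σ[ u ∈ Vector d ] Solves w u
    complete w inL = U w , λ k → solves′ w (rep-id w inL) (Fin.splitAt n k)

    δ : ℚ
    δ = ε + ε + ε

    0≤δ : 0ℚ ≤ δ
    0≤δ = 0≤+ (0≤+ (ℚ.<⇒≤ 0<ε) (ℚ.<⇒≤ 0<ε)) (ℚ.<⇒≤ 0<ε)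

    1≤mass : 1ℚ ≤ 1ℚ + fromℕ m * δ
    1≤mass = ≤-by (fromℕ m * δ) (0≤* (0≤fromℕ m) 0≤δ) refl

    normaliser = inverse (ℚ.<-≤-trans 0<1 1≤mass)
    c = proj₁ normaliser

    0≤c : 0ℚ ≤ c
    0≤c = ℚ.<⇒≤ (proj₁ (proj₂ normaliser))

    c≤1 : c ≤ 1ℚ
    c≤1 = begin
      c                        ≡⟨ ℚ.*-identityˡ c ⟨
      1ℚ * c                   ≤⟨ ℚ.*-monoʳ-≤-nonNeg c {{ℚ.nonNegative 0≤c}} 1≤mass ⟩
      (1ℚ + fromℕ m * δ) * c   ≡⟨ proj₂ (proj₂ normaliser) ⟩
      1ℚ                       ∎
      where open ℚ.≤-Reasoning

    mixed : Vector d → Vector d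
    mixed u = mixture c δ u (U ∘ top)

    affine-mixed : ∀ u β a → affine β a (mixed u) ≡ c * (affine β a u + sum (λ l → δ * affine β a (U (top l))))
    affine-mixed u = affine-mixture c δ u (U ∘ top) (proj₂ (proj₂ normaliser))

    -- The k-th maximiser has k-th scaled slack 1 and enters with relative weight δ, which makes up
    -- for the defect `- δ`; the other maximisers contribute nonnegatively.
    slack-mixed : ∀ u k → - δ ≤ scaled k u → 0ℚ ≤ slack k (mixed u)
    slack-mixed u k -δ≤ = ℚ.*-cancelˡ-≤-pos (scale k) {{ℚ.positive (0<scale k)}}
      (subst (_≤ scale k * slack k (mixed u)) (sym (ℚ.*-zeroʳ (scale k)))
        (subst (0ℚ ≤_) (scaled≡ k (mixed u)) (subst (0ℚ ≤_) (sym (affine-mixed u (scale k * β k) (λ j → scale k * a k j))) (0≤* 0≤c inner))))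
      where
      open ℚ.≤-Reasoning
      inner : 0ℚ ≤ scaled k u + sum (λ l → δ * scaled k (U (top l)))
      inner = begin
        0ℚ                                                   ≡⟨ ℚ.+-inverseˡ δ ⟨
        - δ + δ                                              ≡⟨ cong (- δ +_) (trans (sym (ℚ.*-identityʳ δ)) (cong (δ *_) (sym (scaled-top k)))) ⟩
        - δ + δ * scaled k (U (top k))                       ≤⟨ ℚ.+-mono-≤ -δ≤ (term≤sum (λ l → 0≤* 0≤δ (0≤scaled k (top l))) k) ⟩
        scaled k u + sum (λ l → δ * scaled k (U (top l)))    ∎

    -- Bits differ by at most 1, so each of the m maximisers displaces the coordinate by at most δ.
    -- With the error δ of `u` this is δ(1+m), which `ε-small` bounds by θ.
    coordinate-mixed : ∀ w u i → ∣ ⟨ u , x i ⟩ - bit (lookup w i) ∣ ≤ δ → ∣ ⟨ mixed u , x i ⟩ - bit (lookup w i) ∣ ≤ θ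
    coordinate-mixed w u i close = begin
      ∣ ⟨ mixed u , x i ⟩ - b ∣
        ≡⟨ cong ∣_∣ (trans (ℚ.+-comm ⟨ mixed u , x i ⟩ (- b)) (affine-mixed u (- b) (x i))) ⟩
      ∣ c * (offset u + sum (λ l → δ * offset (U (top l)))) ∣
        ≡⟨ trans (ℚ.∣p*q∣≡∣p∣*∣q∣ c _) (cong (_* ∣ offset u + sum (λ l → δ * offset (U (top l))) ∣) (ℚ.0≤p⇒∣p∣≡p 0≤c)) ⟩
      c * ∣ offset u + sum (λ l → δ * offset (U (top l))) ∣
        ≤⟨ *-mono-≤ 0≤c (0≤+ 0≤δ (0≤* (0≤fromℕ m) 0≤δ)) c≤1
             (ℚ.≤-trans (ℚ.∣p+q∣≤∣p∣+∣q∣ (offset u) _) (ℚ.+-mono-≤ close′ sum≤)) ⟩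
      1ℚ * (δ + fromℕ m * δ)
        ≡⟨ factor δ (fromℕ m) ⟩
      δ * (1ℚ + fromℕ m)
        ≤⟨ ε-small ⟩
      θ ∎
      where
      open ℚ.≤-Reasoning
      b = bit (lookup w i)
      offset : Vector d → ℚ
      offset = affine (- b) (x i)
      factor : ∀ δ m → 1ℚ * (δ + m * δ) ≡ δ * (1ℚ + m)
      factor = RingSolver.solve-∀ ring
      close′ : ∣ offset u ∣ ≤ δ
      close′ = subst (λ y → ∣ y ∣ ≤ δ) (ℚ.+-comm ⟨ u , x i ⟩ (- b)) close
      term : ∀ l → ∣ δ * offset (U (top l)) ∣ ≤ δ
      term l = begin
        ∣ δ * offset (U (top l)) ∣          ≡⟨ ℚ.∣p*q∣≡∣p∣*∣q∣ δ (offset (U (top l))) ⟩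
        ∣ δ ∣ * ∣ offset (U (top l)) ∣       ≡⟨ cong₂ (λ y z → y * ∣ z ∣) (ℚ.0≤p⇒∣p∣≡p 0≤δ) (ℚ.+-comm (- b) ⟨ U (top l) , x i ⟩) ⟩
        δ * ∣ ⟨ U (top l) , x i ⟩ - b ∣      ≤⟨ ℚ.*-monoˡ-≤-nonNeg δ {{ℚ.nonNegative 0≤δ}}
                                                (subst (λ y → ∣ y - b ∣ ≤ 1ℚ) (sym (U-x (top l) i)) (∣unit-unit∣≤1 (bit-unit (lookup (rep (top l)) i)) (bit-unit (lookup w i)))) ⟩
        δ * 1ℚ                              ≡⟨ ℚ.*-identityʳ δ ⟩
        δ                                   ∎
      sum≤ : ∣ sum (λ l → δ * offset (U (top l))) ∣ ≤ fromℕ m * δ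
      sum≤ = begin
        ∣ sum (λ l → δ * offset (U (top l))) ∣     ≤⟨ ∣sum∣≤sum∣∣ (λ l → δ * offset (U (top l))) ⟩
        sum (λ l → ∣ δ * offset (U (top l)) ∣)     ≤⟨ sum-mono term ⟩
        sum {m} (λ _ → δ)                          ≡⟨ sum-const m δ ⟩
        fromℕ m * δ                                ∎

    nearly′ : ∀ w u → NearlySolves w u → ∀ κ → - δ ≤ point′ u κ - bit (bitAt (source′ κ) w) ×
              (∀ j → source′ κ ≡ just j → point′ u κ - bit (bitAt (source′ κ) w) ≤ δ)
    nearly′ w u nearly κ = subst
      (λ κ → - δ ≤ point′ u κ - bit (bitAt (source′ κ) w) ×
             (∀ j → source′ κ ≡ just j → point′ u κ - bit (bitAt (source′ κ) w) ≤ δ))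
      (Fin.splitAt-join n m κ) (nearly (Fin.join n m κ))

    robust : ∀ w u → NearlySolves w u → InL w
    robust w u nearly = sound w (mixed u)
      (λ i → coordinate-mixed w u i (close i (nearly′ w u nearly (inj₁ i))))
      (λ k → slack-mixed u k (subst (- δ ≤_) (drop (scaled k u)) (proj₁ (nearly′ w u nearly (inj₂ k)))))
      where
      drop : ∀ y → y - 0ℚ ≡ y
      drop = RingSolver.solve-∀ ring
      close : ∀ i → _ × _ → ∣ ⟨ u , x i ⟩ - bit (lookup w i) ∣ ≤ δ
      close i (lo , hi) = subst (λ y → ∣ y - bit (lookup w i) ∣ ≤ δ) (ℚ.+-identityˡ ⟨ u , x i ⟩)
        (∣p∣≤q (hi i refl) (subst (- (0ℚ + ⟨ u , x i ⟩ - bit (lookup w i)) ≤_) (involution δ) (ℚ.neg-antimono-≤ lo)))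
        where
        involution : ∀ y → - - y ≡ y
        involution = RingSolver.solve-∀ ring

  circuit : ∃[ s ] (s ℕ.≤ separatorSize (n ℕ.+ m) E × Σ[ C ∈ Circuit n s ]
              (∀ w → InL w ⇔ evalCircuit C w ≡ true))
  circuit = separator w₀ L₀ complete robust

-- Limits of rational sequences

Eventually : (ℕ → Set) → Set
Eventually P = ∃[ N ] (∀ t → N ℕ.≤ t → P t)

ev-map : ∀ {P Q : ℕ → Set} → (∀ {t} → P t → Q t) → Eventually P → Eventually Q
ev-map f (N , p) = N , λ t N≤t → f (p t N≤t)

ev-always : ∀ {P : ℕ → Set} → (∀ t → P t) → Eventually P
ev-always p = 0 , λ t _ → p t

ev-× : ∀ {P Q : ℕ → Set} → Eventually P → Eventually Q → Eventually (λ t → P t × Q t)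
ev-× (M , p) (N , q) = M ℕ.⊔ N , λ t ≤t → p t (ℕ.m⊔n≤o⇒m≤o M N ≤t) , q t (ℕ.m⊔n≤o⇒n≤o M N ≤t)

ev-Fin : ∀ {k} {P : Fin k → ℕ → Set} → (∀ i → Eventually (P i)) → Eventually (λ t → ∀ i → P i t)
ev-Fin {zero}  p = 0 , λ _ _ ()
ev-Fin {suc k} p = ev-map (λ { (p₀ , ps) zero → p₀ ; (p₀ , ps) (suc i) → ps i })
  (ev-× (p zero) (ev-Fin (p ∘ suc)))

ev-words : ∀ {n} {P : Vec Bool n → ℕ → Set} → (∀ w → Eventually (P w)) → Eventually (λ t → ∀ w → P w t)
ev-words {zero}  p = ev-map (λ { q Vec.[] → q }) (p Vec.[])
ev-words {suc n} p = ev-map (λ { (ps , qs) (true Vec.∷ w) → ps w ; (ps , qs) (false Vec.∷ w) → qs w })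
  (ev-× (ev-words (p ∘ (true Vec.∷_))) (ev-words (p ∘ (false Vec.∷_))))

ev-reciprocal : ∀ {ε} → 0ℚ < ε → Eventually (λ t → proj₁ (reciprocal t) ≤ ε)
ev-reciprocal 0<ε = let N , small = small-reciprocal 0<ε in N , λ t N≤t →
  let r , 0<r , tr≡1 = reciprocal t in ℚ.<⇒≤ (small t N≤t r (ℚ.<⇒≤ 0<r) tr≡1)

cauchy-tail : ∀ {s} → IsCauchy s → ∀ {ε} → 0ℚ < ε →
              Eventually (λ t → ∀ u → t ℕ.≤ u → ∣ s t - s u ∣ ≤ ε)
cauchy-tail cs 0<ε = let N , close = cs _ 0<ε in
  N , λ t N≤t u t≤u → ℚ.<⇒≤ (close t u N≤t (ℕ.≤-trans N≤t t≤u))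

cauchy-subsequence : ∀ {s φ} → IsCauchy s → (∀ t → t ℕ.≤ φ t) → IsCauchy (s ∘ φ)
cauchy-subsequence cs φ≥ ε 0<ε = let N , close = cs ε 0<ε in
  N , λ m n N≤m N≤n → close _ _ (ℕ.≤-trans N≤m (φ≥ m)) (ℕ.≤-trans N≤n (φ≥ n))

-- Phrased as eventual in the bound Y, so that `ev-Fin` and `ev-words` give a common bound for
-- finitely many sequences.
cauchy-bounded : ∀ {s} → IsCauchy s → Eventually (λ Y → Eventually (λ t → ∣ s t ∣ ≤ fromℕ Y))
cauchy-bounded {s} cs = let N , close = cs 1ℚ 0<1 ; Y₀ , ≤Y₀ = archimedean (∣ s N ∣ + 1ℚ) in
  Y₀ , λ Y Y₀≤Y → N , λ t N≤t → ℚ.≤-trans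
    (subst (λ x → ∣ x ∣ ≤ ∣ s N ∣ + 1ℚ) (restore (s N) (s t))
      (ℚ.≤-trans (ℚ.∣p+q∣≤∣p∣+∣q∣ (s N) (s t - s N)) (ℚ.+-monoʳ-≤ ∣ s N ∣ (ℚ.<⇒≤ (close t N N≤t ℕ.≤-refl)))))
    (ℚ.≤-trans ≤Y₀ (fromℕ-mono Y₀≤Y))
  where
  restore : ∀ a b → a + (b - a) ≡ b
  restore = RingSolver.solve-∀ ring

halve : ℚ → ℕ → ℚ
halve h zero    = h
halve h (suc l) = ½ * halve h l

0≤½ : 0ℚ ≤ ½
0≤½ = ℚ.nonNegative⁻¹ ½

0≤halve : ∀ {h} → 0ℚ ≤ h → ∀ l → 0ℚ ≤ halve h l
0≤halve 0≤h zero    = 0≤h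
0≤halve 0≤h (suc l) = 0≤* 0≤½ (0≤halve 0≤h l)

-- A linear lower bound on powers of two, enough for Archimedean arguments. The induction carries
-- the factor 1+l, using that 2+l is at most twice 1+l.
halve-decay : ∀ {h} → 0ℚ ≤ h → ∀ l → fromℕ l * halve h l ≤ h
halve-decay {h} 0≤h l = ℚ.≤-trans (≤-by (halve h l) (0≤halve 0≤h l) (expand (fromℕ l) (halve h l))) (bound l)
  where
  expand : ∀ x y → (1ℚ + x) * y ≡ x * y + y
  expand = RingSolver.solve-∀ ring
  bound : ∀ l → (1ℚ + fromℕ l) * halve h l ≤ h
  bound zero    = ℚ.≤-reflexive (ℚ.*-identityˡ h)
  bound (suc l) = ℚ.≤-trans (≤-by _ (0≤* (0≤fromℕ l) (0≤* 0≤½ (0≤halve 0≤h l)))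
      (trans (regroup (fromℕ l) (halve h l))
        (cong (λ x → (1ℚ + x) * (½ * halve h l) + fromℕ l * (½ * halve h l)) (sym (fromℕ-suc l)))))
    (bound l)
    where
    regroup : ∀ x y → (1ℚ + x) * y ≡ (1ℚ + (1ℚ + x)) * (½ * y) + x * (½ * y)
    regroup = RingSolver.solve-∀ ring

-- The Bolzano-Weierstrass theorem by bisection

module Compactness (em : ExcludedMiddle 0ℓ) where

  ¬∀⇒∃¬ : ∀ {A : Set} {P : A → Set} → ¬ (∀ x → P x) → ∃[ x ] ¬ P x
  ¬∀⇒∃¬ {A} {P} ¬∀ with em {∃[ x ] ¬ P x}
  ... | yes ∃¬ = ∃¬
  ... | no ¬∃¬ = ⊥-elim (¬∀ λ x → stable x em)
    where
    stable : ∀ x → Dec (P x) → P x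
    stable x (yes p) = p
    stable x (no ¬p) = ⊥-elim (¬∃¬ (x , ¬p))

  module Bisection (s : ℕ → ℚ) where

    Frequent : ℚ → ℚ → Set
    Frequent a h = ∀ t → ∃[ u ] (t ℕ.≤ u × a ≤ s u × s u ≤ a + h)

    Refinement : ℚ → ℚ → Set
    Refinement a h = ∃[ a′ ] (Frequent a′ (½ * h) × a ≤ a′ × a′ + ½ * h ≤ a + h)

    halves : ∀ a h → a + h ≡ (a + ½ * h) + ½ * h
    halves = RingSolver.solve-∀ ring

    -- If the lower half is not visited beyond some time, every later visit to the interval falls
    -- into the upper half.
    refine : ∀ {a h} → 0ℚ ≤ h → Frequent a h → Dec (Frequent a (½ * h)) → Refinement a h
    refine {a} {h} 0≤h freq (yes lower) = a , lower , ℚ.≤-refl ,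
      ≤-by (½ * h) (0≤* 0≤½ 0≤h) (halves a h)
    refine {a} {h} 0≤h freq (no ¬lower) = a + ½ * h , upper , ≤-by (½ * h) (0≤* 0≤½ 0≤h) refl ,
      ℚ.≤-reflexive (sym (halves a h))
      where
      upper : Frequent (a + ½ * h) (½ * h)
      upper t with ¬∀⇒∃¬ ¬lower
      ... | t₀ , absent with freq (t₀ ℕ.⊔ t)
      ...   | u , ≤u , a≤s , s≤ = u , ℕ.m⊔n≤o⇒n≤o t₀ t ≤u ,
        ℚ.≮⇒≥ (λ s<mid → absent (u , ℕ.m⊔n≤o⇒m≤o t₀ t ≤u , a≤s , ℚ.<⇒≤ s<mid)) ,
        ℚ.≤-trans s≤ (ℚ.≤-reflexive (halves a h))

    module _ {a₀ h₀ : ℚ} (0≤h₀ : 0ℚ ≤ h₀) (freq₀ : Frequent a₀ h₀) where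

      cell : ∀ l → Σ[ a ∈ ℚ ] Frequent a (halve h₀ l)
      refined : ∀ l → Refinement (proj₁ (cell l)) (halve h₀ l)
      cell zero    = a₀ , freq₀
      cell (suc l) = proj₁ (refined l) , proj₁ (proj₂ (refined l))
      refined l = refine (0≤halve 0≤h₀ l) (proj₂ (cell l)) em

      corner : ℕ → ℚ
      corner l = proj₁ (cell l)

      nested : ∀ l k → corner l ≤ corner (k ℕ.+ l) ×
               corner (k ℕ.+ l) + halve h₀ (k ℕ.+ l) ≤ corner l + halve h₀ l
      nested l zero    = ℚ.≤-refl , ℚ.≤-refl
      nested l (suc k) = let lo , hi = nested l k ; lo′ , hi′ = proj₂ (proj₂ (refined (k ℕ.+ l))) in
        ℚ.≤-trans lo lo′ , ℚ.≤-trans hi′ hi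

      index : ℕ → ℕ
      index l = proj₁ (proj₂ (cell l) l)

      index≥ : ∀ l → l ℕ.≤ index l
      index≥ l = proj₁ (proj₂ (proj₂ (cell l) l))

      inside : ∀ l m → l ℕ.≤ m → corner l ≤ s (index m) × s (index m) ≤ corner l + halve h₀ l
      inside l m l≤m = let lo , hi = subst (λ m → corner l ≤ corner m × corner m + halve h₀ m ≤ corner l + halve h₀ l)
                                       (ℕ.m∸n+n≡m l≤m) (nested l (m ℕ.∸ l))
                           lo′ , hi′ = proj₂ (proj₂ (proj₂ (cell m) m))
                       in ℚ.≤-trans lo lo′ , ℚ.≤-trans hi′ hi

      -- Indices from l on stay in the cell of level l, and L is so large that `halve-decay` makes
      -- the cell of level `suc L` narrower than ε.
      index-cauchy : IsCauchy (s ∘ index)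
      index-cauchy ε 0<ε = suc L , λ m n ≤m ≤n → ℚ.≤-<-trans (spread m n ≤m ≤n) small
        where
        open ℚ.≤-Reasoning
        1/ε = proj₁ (inverse 0<ε)
        L = proj₁ (archimedean (h₀ * 1/ε))
        spread : ∀ m n → suc L ℕ.≤ m → suc L ℕ.≤ n → ∣ s (index m) - s (index n) ∣ ≤ halve h₀ (suc L)
        spread m n ≤m ≤n = let lo , hi = inside (suc L) m ≤m ; lo′ , hi′ = inside (suc L) n ≤n in
          ∣p∣≤q (≤-by _ (0≤+ (0≤-diff hi) (0≤-diff lo′)) (difference (corner (suc L)) (halve h₀ (suc L)) (s (index m)) (s (index n))))
                (≤-by _ (0≤+ (0≤-diff hi′) (0≤-diff lo)) (difference′ (corner (suc L)) (halve h₀ (suc L)) (s (index m)) (s (index n))))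
          where
          difference : ∀ a h x y → h ≡ (x - y) + (((a + h) - x) + (y - a))
          difference = RingSolver.solve-∀ ring
          difference′ : ∀ a h x y → h ≡ - (x - y) + (((a + h) - y) + (x - a))
          difference′ = RingSolver.solve-∀ ring
        small : halve h₀ (suc L) < ε
        small = ℚ.≰⇒> λ ε≤ → <⇒≱ (begin-strict
          h₀                                  ≡⟨ trans (sym (ℚ.*-identityʳ h₀)) (cong (h₀ *_) (sym (proj₂ (proj₂ (inverse 0<ε))))) ⟩
          h₀ * (ε * 1/ε)                      ≡⟨ regroup h₀ ε 1/ε ⟩
          (h₀ * 1/ε) * ε                      ≤⟨ ℚ.*-monoʳ-≤-nonNeg ε {{ℚ.nonNegative (ℚ.<⇒≤ 0<ε)}} (proj₂ (archimedean (h₀ * 1/ε))) ⟩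
          fromℕ L * ε                         <⟨ <-by ε 0<ε (trans (cong (_* ε) (fromℕ-suc L)) (expand (fromℕ L) ε)) ⟩
          fromℕ (suc L) * ε                   ≤⟨ ℚ.*-monoˡ-≤-nonNeg (fromℕ (suc L)) {{ℚ.nonNegative (0≤fromℕ (suc L))}} ε≤ ⟩
          fromℕ (suc L) * halve h₀ (suc L)    ∎) (halve-decay 0≤h₀ (suc L))
          where
          regroup : ∀ a b c → a * (b * c) ≡ (a * c) * b
          regroup = RingSolver.solve-∀ ring
          expand : ∀ x y → (1ℚ + x) * y ≡ x * y + y
          expand = RingSolver.solve-∀ ring

  abstract
    -- Of a subsequence only `t ≤ φ t` is recorded; this form composes and transports Cauchy and
    -- eventual statements.
    convergent-subsequence : ∀ {B} s → (∀ t → ∣ s t ∣ ≤ B) →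
      Σ[ φ ∈ (ℕ → ℕ) ] ((∀ t → t ℕ.≤ φ t) × IsCauchy (s ∘ φ))
    convergent-subsequence {B} s bound = index 0≤2B all , index≥ 0≤2B all , index-cauchy 0≤2B all
      where
      open Bisection s
      0≤B : 0ℚ ≤ B
      0≤B = ℚ.≤-trans (ℚ.0≤∣p∣ (s 0)) (bound 0)
      0≤2B : 0ℚ ≤ B + B
      0≤2B = 0≤+ 0≤B 0≤B
      lower : ∀ x B → x ≡ - B + (B - - x)
      lower = RingSolver.solve-∀ ring
      upper : ∀ B → B ≡ - B + (B + B)
      upper = RingSolver.solve-∀ ring
      all : Frequent (- B) (B + B)
      all t = t , ℕ.≤-refl ,
        ≤-by (B - - s t) (0≤-diff (ℚ.≤-trans (-p≤∣p∣ (s t)) (bound t))) (lower (s t) B) ,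
        ℚ.≤-trans (p≤∣p∣ (s t)) (ℚ.≤-trans (bound t) (ℚ.≤-reflexive (upper B)))

  bolzano-weierstrass : ∀ {B} d (u : ℕ → Fin d → ℚ) → (∀ t j → ∣ u t j ∣ ≤ B) →
    Σ[ φ ∈ (ℕ → ℕ) ] ((∀ t → t ℕ.≤ φ t) × (∀ j → IsCauchy (λ t → u (φ t) j)))
  bolzano-weierstrass zero u bound = (λ t → t) , (λ t → ℕ.≤-refl) , λ ()
  bolzano-weierstrass {B} (suc d) u bound =
    (λ t → φ (ψ t)) , (λ t → ℕ.≤-trans (proj₁ (proj₂ rest) t) (proj₁ (proj₂ first) (ψ t))) , converges
    where
    first : Σ[ φ ∈ (ℕ → ℕ) ] ((∀ t → t ℕ.≤ φ t) × IsCauchy (λ t → u (φ t) zero))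
    first = convergent-subsequence {B} (λ t → u t zero) (λ t → bound t zero)
    φ : ℕ → ℕ
    φ = proj₁ first
    rest : Σ[ ψ ∈ (ℕ → ℕ) ] ((∀ t → t ℕ.≤ ψ t) × (∀ j → IsCauchy (λ t → u (φ (ψ t)) (suc j))))
    rest = bolzano-weierstrass {B} d (λ t j → u (φ t) (suc j)) (λ t j → bound (φ t) (suc j))
    ψ : ℕ → ℕ
    ψ = proj₁ rest
    converges : ∀ j → IsCauchy (λ t → u (φ (ψ t)) j)
    converges zero    = cauchy-subsequence {λ t → u (φ t) zero} {ψ} (proj₂ (proj₂ first)) (proj₁ (proj₂ rest))
    converges (suc j) = proj₂ (proj₂ rest) j

-- A word outside the language is at distance one from the convex hull

-- Summing over j the sign of the bit w_j times x_j - w_j gives an affine function of x that equals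
-- the Hamming distance to w at every 0/1 point. It separates w from the hull.
sign : Bool → ℚ
sign b = if b then - 1ℚ else 1ℚ

sign-bit : ∀ b b′ → sign b * (bit b′ - bit b) ≡ 0ℚ ⊎ sign b * (bit b′ - bit b) ≡ 1ℚ
sign-bit true  true  = inj₁ refl
sign-bit true  false = inj₂ refl
sign-bit false true  = inj₂ refl
sign-bit false false = inj₁ refl

sign-bit-≢ : ∀ b b′ → b′ ≢ b → sign b * (bit b′ - bit b) ≡ 1ℚ
sign-bit-≢ true  true  b≢b = ⊥-elim (b≢b refl)
sign-bit-≢ true  false _   = refl
sign-bit-≢ false true  _   = refl
sign-bit-≢ false false b≢b = ⊥-elim (b≢b refl)

∣sign∣≡1 : ∀ b → ∣ sign b ∣ ≡ 1ℚ
∣sign∣≡1 true  = refl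
∣sign∣≡1 false = refl

∣sign*∣ : ∀ b q → ∣ sign b * q ∣ ≡ ∣ q ∣
∣sign*∣ b q = trans (ℚ.∣p*q∣≡∣p∣*∣q∣ (sign b) q) (trans (cong (_* ∣ q ∣) (∣sign∣≡1 b)) (ℚ.*-identityˡ ∣ q ∣))

differing-index : ∀ {n} (v w : Vec Bool n) → v ≢ w → ∃[ j ] lookup v j ≢ lookup w j
differing-index Vec.[] Vec.[] v≢w = ⊥-elim (v≢w refl)
differing-index (a Vec.∷ v) (b Vec.∷ w) v≢w with a Bool.≟ b
... | no a≢b = zero , a≢b
... | yes refl with differing-index v w (λ eq → v≢w (cong (a Vec.∷_) eq))
...   | j , ≢ = suc j , ≢

¼ : ℚ
¼ = ½ * ½

-- Membership in the hull, read off at one late time where every relation holds up to η. The choice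
-- of η keeps the errors of both estimates of `total` below the gap ¼ between ¾ and ½.
module Separation {n k : ℕ} (w : Vec Bool n) (words : Fin k → Vec Bool n) (words≢w : ∀ i → words i ≢ w)
  (c : Vector k) (v : Fin k → Vector n) (X : Vector n) (η θ : ℚ) (0<η : 0ℚ < η)
  (nθ≤½ : fromℕ n * θ ≤ ½)
  (η-small : (1ℚ + (fromℕ n + fromℕ n) + (fromℕ n + fromℕ n) * fromℕ k) * η ≡ ¼)
  (c≥ : ∀ i → 0ℚ ≤ c i + η)
  (Σc≈1 : ∣ sum c - 1ℚ ∣ ≤ η)
  (v≈word : ∀ i j → ∣ v i j - bit (lookup (words i) j) ∣ ≤ η)
  (X≈Σcv : ∀ j → ∣ X j - sum (λ i → c i * v i j) ∣ ≤ η)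
  (X≈w : ∀ j → ∣ X j - bit (lookup w j) ∣ ≤ θ)
  where

  private
    0≤η : 0ℚ ≤ η
    0≤η = ℚ.<⇒≤ 0<η

    b s : Vector n
    b j = bit (lookup w j)
    s j = sign (lookup w j)

    distance : Fin k → ℚ
    distance i = sum (λ j → s j * (v i j - b j))

    N K : ℚ
    N = fromℕ n
    K = fromℕ k

    0≤N : 0ℚ ≤ N
    0≤N = 0≤fromℕ n

    Nη≤¼ : N * η ≤ ¼
    Nη≤¼ = ≤-by ((1ℚ + N + (N + N) * K) * η)
      (0≤* (0≤+ (0≤+ 0≤1 0≤N) (0≤* (0≤+ 0≤N 0≤N) (0≤fromℕ k))) 0≤η)
      (trans (sym η-small) (regroup N K η))
      where
      regroup : ∀ N K η → (1ℚ + (N + N) + (N + N) * K) * η ≡ N * η + (1ℚ + N + (N + N) * K) * η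
      regroup = RingSolver.solve-∀ ring

    η≤1 : η ≤ 1ℚ
    η≤1 = ≤-by (½ + ¼ + ((N + N) + (N + N) * K) * η)
      (0≤+ (ℚ.nonNegative⁻¹ (½ + ¼)) (0≤* (0≤+ (0≤+ 0≤N 0≤N) (0≤* (0≤+ 0≤N 0≤N) (0≤fromℕ k))) 0≤η))
      (trans (cong (½ + ¼ +_) (sym η-small)) (regroup N K η (½ + ¼)))
      where
      regroup : ∀ N K η q → q + (1ℚ + (N + N) + (N + N) * K) * η ≡ η + (q + ((N + N) + (N + N) * K) * η)
      regroup = RingSolver.solve-∀ ring

    off : Fin k → Vector n
    off i j = s j * (bit (lookup (words i) j) - b j)

    0≤off : ∀ i j → 0ℚ ≤ off i j
    0≤off i j with sign-bit (lookup w j) (lookup (words i) j)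
    ... | inj₁ eq = ℚ.≤-reflexive (sym eq)
    ... | inj₂ eq = subst (0ℚ ≤_) (sym eq) 0≤1

    off≤1 : ∀ i j → off i j ≤ 1ℚ
    off≤1 i j with sign-bit (lookup w j) (lookup (words i) j)
    ... | inj₁ eq = subst (_≤ 1ℚ) (sym eq) 0≤1
    ... | inj₂ eq = ℚ.≤-reflexive eq

    term-close : ∀ i j → ∣ s j * (v i j - b j) - off i j ∣ ≤ η
    term-close i j = subst (λ x → ∣ x ∣ ≤ η) (regroup (s j) (v i j) (b j) (bit (lookup (words i) j)))
      (subst (_≤ η) (sym (∣sign*∣ (lookup w j) (v i j - bit (lookup (words i) j)))) (v≈word i j))
      where
      regroup : ∀ s v b β → s * (v - β) ≡ s * (v - b) - s * (β - b)
      regroup = RingSolver.solve-∀ ring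

    ¾≤distance : ∀ i → ½ + ¼ ≤ distance i
    ¾≤distance i = begin
      ½ + ¼                                ≡⟨⟩
      1ℚ - ¼                               ≤⟨ ℚ.+-mono-≤ 1≤Σoff (ℚ.neg-antimono-≤ Nη≤¼) ⟩
      sum (off i) - N * η                  ≡⟨ cong (sum (off i) +_) (trans (neg-distrib N η) (sym (sum-const n (- η)))) ⟩
      sum (off i) + sum {n} (λ _ → - η)    ≡⟨ ∑-distrib-+ (off i) (λ _ → - η) ⟨
      sum (λ j → off i j + - η)            ≤⟨ sum-mono (λ j → ≤-by _ (0≤-diff (ℚ.≤-trans (-p≤∣p∣ (s j * (v i j - b j) - off i j)) (term-close i j))) (regroup (s j * (v i j - b j)) (off i j) η)) ⟩
      distance i                           ∎
      where
      open ℚ.≤-Reasoning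
      neg-distrib : ∀ x y → - (x * y) ≡ x * - y
      neg-distrib = RingSolver.solve-∀ ring
      regroup : ∀ x o η → x ≡ (o + - η) + (η - - (x - o))
      regroup = RingSolver.solve-∀ ring
      1≤Σoff : 1ℚ ≤ sum (off i)
      1≤Σoff = let j , differ = differing-index (words i) w (words≢w i) in
        ℚ.≤-trans (ℚ.≤-reflexive (sym (sign-bit-≢ (lookup w j) (lookup (words i) j) differ))) (term≤sum (0≤off i) j)

    distance≤2N : ∀ i → distance i ≤ N + N
    distance≤2N i = begin
      distance i                      ≤⟨ sum-mono (λ j → ≤-by _
                                           (0≤+ (0≤+ (0≤-diff (ℚ.≤-trans (p≤∣p∣ (s j * (v i j - b j) - off i j)) (term-close i j))) (0≤-diff (off≤1 i j))) (0≤-diff η≤1))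
                                           (regroup (s j * (v i j - b j)) (off i j) η)) ⟩
      sum {n} (λ _ → 1ℚ + 1ℚ)         ≡⟨ sum-const n (1ℚ + 1ℚ) ⟩
      N * (1ℚ + 1ℚ)                   ≡⟨ double N ⟩
      N + N                           ∎
      where
      open ℚ.≤-Reasoning
      regroup : ∀ x o η → 1ℚ + 1ℚ ≡ x + (((η - (x - o)) + (1ℚ - o)) + (1ℚ - η))
      regroup = RingSolver.solve-∀ ring
      double : ∀ N → N * (1ℚ + 1ℚ) ≡ N + N
      double = RingSolver.solve-∀ ring

    total : ℚ
    total = sum (λ i → c i * distance i)

    -- At a finite time a weight may be as low as -η. Adding η makes it nonnegative, so that
    -- `¾≤distance` applies; `distance≤2N` pays for the addition.
    lower : (½ + ¼) * (1ℚ - η) - K * ((N + N) * η) ≤ total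
    lower = begin
      (½ + ¼) * (1ℚ - η) - K * ((N + N) * η)
        ≤⟨ ≤-by _ (0≤* (ℚ.nonNegative⁻¹ (½ + ¼)) (0≤+ (0≤-diff (∣≤∣⇒≥ {sum c} {1ℚ} Σc≈1)) (0≤* (0≤fromℕ k) 0≤η)))
             (regroup (½ + ¼) (sum c) η K (K * ((N + N) * η))) ⟩
      (½ + ¼) * (sum c + K * η) - K * ((N + N) * η)
        ≡⟨ spread ⟨
      sum (λ i → (½ + ¼) * (c i + η) + - ((N + N) * η))
        ≤⟨ sum-mono (λ i → ≤-by _ (0≤+ (0≤* (c≥ i) (0≤-diff (¾≤distance i))) (0≤* 0≤η (0≤-diff (distance≤2N i))))
             (term (½ + ¼) (c i) η (distance i) (N + N))) ⟩
      total ∎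
      where
      open ℚ.≤-Reasoning
      regroup : ∀ q S η K z → q * (S + K * η) - z ≡ (q * (1ℚ - η) - z) + q * (((S + η) - 1ℚ) + K * η)
      regroup = RingSolver.solve-∀ ring
      term : ∀ q c η D M → c * D ≡ (q * (c + η) + - (M * η)) + ((c + η) * (D - q) + η * (M - D))
      term = RingSolver.solve-∀ ring
      spread : sum (λ i → (½ + ¼) * (c i + η) + - ((N + N) * η)) ≡ (½ + ¼) * (sum c + K * η) - K * ((N + N) * η)
      spread = trans (∑-distrib-+ (λ i → (½ + ¼) * (c i + η)) (λ _ → - ((N + N) * η)))
        (cong₂ _+_
          (trans (sym (*-distribˡ-sum (½ + ¼) (λ i → c i + η)))
            (cong ((½ + ¼) *_) (trans (∑-distrib-+ c (λ _ → η)) (cong (sum c +_) (sum-const k η)))))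
          (trans (sum-const k (- ((N + N) * η))) (neg-distrib K ((N + N) * η))))
        where
        neg-distrib : ∀ x y → x * - y ≡ - (x * y)
        neg-distrib = RingSolver.solve-∀ ring

    exchanged : total ≡ sum (λ j → s j * (sum (λ i → c i * v i j) - b j * sum c))
    exchanged = trans (sum-cong-≗ λ i → *-distribˡ-sum (c i) (λ j → s j * (v i j - b j)))
      (trans (∑-comm (λ i j → c i * (s j * (v i j - b j)))) (sum-cong-≗ column))
      where
      open ≡-Reasoning
      column : ∀ j → sum (λ i → c i * (s j * (v i j - b j))) ≡ s j * (sum (λ i → c i * v i j) - b j * sum c)
      column j = begin
        sum (λ i → c i * (s j * (v i j - b j)))
          ≡⟨ (sum-cong-≗ λ i → expand (c i) (s j) (v i j) (b j)) ⟩
        sum (λ i → s j * (c i * v i j) + (- (s j * b j)) * c i)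
          ≡⟨ ∑-distrib-+ (λ i → s j * (c i * v i j)) (λ i → (- (s j * b j)) * c i) ⟩
        sum (λ i → s j * (c i * v i j)) + sum (λ i → (- (s j * b j)) * c i)
          ≡⟨ cong₂ _+_ (*-distribˡ-sum (s j) (λ i → c i * v i j)) (*-distribˡ-sum (- (s j * b j)) c) ⟨
        s j * sum (λ i → c i * v i j) + (- (s j * b j)) * sum c
          ≡⟨ collect (s j) (sum (λ i → c i * v i j)) (b j) (sum c) ⟩
        s j * (sum (λ i → c i * v i j) - b j * sum c) ∎
        where
        expand : ∀ c s v b → c * (s * (v - b)) ≡ s * (c * v) + (- (s * b)) * c
        expand = RingSolver.solve-∀ ring
        collect : ∀ s y b S → s * y + (- (s * b)) * S ≡ s * (y - b * S)
        collect = RingSolver.solve-∀ ring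

    -- After exchanging the sums, each column compares X with w, which differ by at most θ; the two
    -- η come from the combination and from the total weight.
    upper : total ≤ N * (η + θ + η)
    upper = begin
      total                                                        ≡⟨ exchanged ⟩
      sum (λ j → s j * (sum (λ i → c i * v i j) - b j * sum c))    ≤⟨ sum-mono column ⟩
      sum {n} (λ _ → η + θ + η)                                    ≡⟨ sum-const n (η + θ + η) ⟩
      N * (η + θ + η)                                              ∎
      where
      open ℚ.≤-Reasoning
      column : ∀ j → s j * (sum (λ i → c i * v i j) - b j * sum c) ≤ η + θ + η
      column j = begin
        s j * (y - b j * sum c)                     ≤⟨ p≤∣p∣ (s j * (y - b j * sum c)) ⟩
        ∣ s j * (y - b j * sum c) ∣                  ≡⟨ ∣sign*∣ (lookup w j) (y - b j * sum c) ⟩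
        ∣ y - b j * sum c ∣                          ≤⟨ triangle y (b j) (b j * sum c) ⟩
        ∣ y - b j ∣ + ∣ b j - b j * sum c ∣           ≤⟨ ℚ.+-mono-≤ (ℚ.≤-trans (triangle y (X j) (b j))
                                                         (ℚ.+-mono-≤ (subst (_≤ η) (∣p-q∣≡∣q-p∣ (X j) y) (X≈Σcv j)) (X≈w j))) mass ⟩
        (η + θ) + η                                 ∎
        where
        y = sum (λ i → c i * v i j)
        mass : ∣ b j - b j * sum c ∣ ≤ η
        mass = begin
          ∣ b j - b j * sum c ∣        ≡⟨ cong ∣_∣ (factor (b j) (sum c)) ⟩
          ∣ b j * (1ℚ - sum c) ∣       ≡⟨ ℚ.∣p*q∣≡∣p∣*∣q∣ (b j) (1ℚ - sum c) ⟩
          ∣ b j ∣ * ∣ 1ℚ - sum c ∣      ≤⟨ *-mono-≤ (ℚ.0≤∣p∣ (b j)) 0≤η ∣b∣≤1 (subst (_≤ η) (∣p-q∣≡∣q-p∣ (sum c) 1ℚ) Σc≈1) ⟩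
          1ℚ * η                      ≡⟨ ℚ.*-identityˡ η ⟩
          η                           ∎
          where
          factor : ∀ b S → b - b * S ≡ b * (1ℚ - S)
          factor = RingSolver.solve-∀ ring
          ∣b∣≤1 : ∣ b j ∣ ≤ 1ℚ
          ∣b∣≤1 = ℚ.≤-trans (ℚ.≤-reflexive (ℚ.0≤p⇒∣p∣≡p (proj₁ (bit-unit (lookup w j))))) (proj₂ (bit-unit (lookup w j)))

  -- Comparing the two bounds, ¾ (1 − η) − 2knη ≤ n (2η + θ) ≤ 2nη + ½, against the choice of η.
  separated : ⊥
  separated = <⇒≱ (0<* {¼} (ℚ.positive⁻¹ ¼) 0<η) (≤-by
    ((N * (η + θ + η) - ((½ + ¼) * (1ℚ - η) - K * ((N + N) * η))) + (½ - N * θ))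
    (0≤+ (0≤-diff (ℚ.≤-trans lower upper)) (0≤-diff nθ≤½))
    (trans (sym (trans (cong (_- ¼) η-small) (ℚ.+-inverseʳ ¼))) (regroup N K η θ)))
    where
    regroup : ∀ N K η θ → (1ℚ + (N + N) + (N + N) * K) * η - ¼ ≡
      ¼ * η + ((N * (η + θ + η) - ((½ + ¼) * (1ℚ - η) - K * ((N + N) * η))) + (½ - N * θ))
    regroup = RingSolver.solve-∀ ring

-- Real points as limits of rational ones

≈-pointwise : ∀ {x y : ℝ} → (∀ t → seq x t ≡ seq y t) → x ℝ.≈ y
≈-pointwise {x} {y} eq ε 0<ε = 0 , λ t _ →
  subst (_< ε) (sym (cong ∣_∣ (trans (cong (_- seq y t) (eq t)) (ℚ.+-inverseʳ (seq y t))))) 0<ε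

seq-∑ : ∀ {k} (f : ℝ^ k) t → seq (∑ f) t ≡ sum (λ i → seq (f i) t)
seq-∑ {zero}  f t = refl
seq-∑ {suc k} f t = cong (λ q → seq (f zero) t + q) (seq-∑ (f ∘ suc) t)

seq-bitVector : ∀ {n} (w : Vec Bool n) j t → seq (bitVector w j) t ≡ bit (lookup w j)
seq-bitVector w j t = by-value (lookup w j)
  where
  by-value : ∀ b → seq (if b then 1ℝ else 0ℝ) t ≡ bit b
  by-value true  = refl
  by-value false = refl

conv-extensive : ∀ {n} {S : Pred (ℝ^ n) 0ℓ} {x} → S x → conv S x
conv-extensive {x = x} Sx = 1 , (λ _ → 1ℝ) , (λ _ → x) ,
  (λ _ ε 0<ε → 0 , λ _ _ → 0≤+ 0≤1 (ℚ.<⇒≤ 0<ε)) ,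
  ≈-pointwise {∑ {1} (λ _ → 1ℝ)} {1ℝ} (λ _ → refl) ,
  (λ _ → Sx) ,
  λ j → ≈-pointwise {x j} {∑ {1} (λ _ → 1ℝ ℝ.* x j)} (λ t → unit (seq (x j) t))
  where
  unit : ∀ q → q ≡ 1ℚ * q + 0ℚ
  unit = RingSolver.solve-∀ ring

-- All conditions of hull membership hold eventually up to any η, hence at a common time. The number
-- k of points is known before η has to be chosen.
far-from-hull : ∀ {n} {L : Language} (w : Vec Bool n) → ¬ L (toList w) → ∀ {θ} → fromℕ n * θ ≤ ½ →
  (X : ℝ^ n) → (∀ t j → ∣ seq (X j) t - bit (lookup w j) ∣ ≤ θ) → ¬ conv (slice L n) X
far-from-hull {n} {L} w w∉L {θ} nθ≤½ X X≈w (k , c , v , c≥0 , Σc≈1 , v∈S , X≈Σcv) =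
  Separation.separated w words words≢w (λ i → seq (c i) t) (λ i j → seq (v i j) t) (λ j → seq (X j) t) η θ 0<η
    nθ≤½ Kη≡¼ (proj₁ sample) (proj₁ (proj₂ sample)) (proj₁ (proj₂ (proj₂ sample))) (proj₂ (proj₂ (proj₂ sample))) (X≈w t)
  where
  words : Fin k → Vec Bool n
  words i = proj₁ (v∈S i)
  words≢w : ∀ i → words i ≢ w
  words≢w i eq = w∉L (subst (λ u → L (toList u)) eq (proj₁ (proj₂ (v∈S i))))
  K : ℚ
  K = 1ℚ + (fromℕ n + fromℕ n) + (fromℕ n + fromℕ n) * fromℕ k
  0≤2n : 0ℚ ≤ fromℕ n + fromℕ n
  0≤2n = 0≤+ (0≤fromℕ n) (0≤fromℕ n)
  0<K : 0ℚ < K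
  0<K = ℚ.<-≤-trans 0<1 (≤-by ((fromℕ n + fromℕ n) + (fromℕ n + fromℕ n) * fromℕ k)
    (0≤+ 0≤2n (0≤* 0≤2n (0≤fromℕ k))) (ℚ.+-assoc 1ℚ (fromℕ n + fromℕ n) _))
  1/K η : ℚ
  1/K = proj₁ (inverse 0<K)
  η = ¼ * 1/K
  0<η : 0ℚ < η
  0<η = 0<* {¼} (ℚ.positive⁻¹ ¼) (proj₁ (proj₂ (inverse 0<K)))
  Kη≡¼ : K * η ≡ ¼
  Kη≡¼ = trans (swap K ¼ 1/K) (trans (cong (¼ *_) (proj₂ (proj₂ (inverse 0<K)))) (ℚ.*-identityʳ ¼))
    where
    swap : ∀ a b c → a * (b * c) ≡ b * (a * c)
    swap = RingSolver.solve-∀ ring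
  Sample : ℕ → Set
  Sample t = (∀ i → 0ℚ ≤ seq (c i) t + η) × ∣ sum (λ i → seq (c i) t) - 1ℚ ∣ ≤ η ×
    (∀ i j → ∣ seq (v i j) t - bit (lookup (words i) j) ∣ ≤ η) ×
    (∀ j → ∣ seq (X j) t - sum (λ i → seq (c i) t * seq (v i j) t) ∣ ≤ η)
  eventually-sample : Eventually Sample
  eventually-sample = ev-× (ev-Fin λ i → c≥0 i η 0<η) (ev-×
    (ev-map (λ {t} lt → subst (λ q → ∣ q - 1ℚ ∣ ≤ η) (seq-∑ c t) (ℚ.<⇒≤ lt)) (Σc≈1 η 0<η)) (ev-×
    (ev-Fin λ i → ev-Fin λ j → ev-map (λ {t} lt → subst (λ q → ∣ seq (v i j) t - q ∣ ≤ η)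
      (seq-bitVector (words i) j t) (ℚ.<⇒≤ lt)) (proj₂ (proj₂ (v∈S i)) j η 0<η))
    (ev-Fin λ j → ev-map (λ {t} lt → subst (λ q → ∣ seq (X j) t - q ∣ ≤ η)
      (seq-∑ (λ i → c i ℝ.* v i j) t) (ℚ.<⇒≤ lt)) (X≈Σcv j η 0<η))))
  t : ℕ
  t = proj₁ eventually-sample
  sample : Sample t
  sample = proj₂ eventually-sample t ℕ.≤-refl

-- Limits of nearly feasible rational points

perturbed-sum : ∀ {k η C} (a a′ x : Vector k) → (∀ j → ∣ a j - a′ j ∣ ≤ η) → (∀ j → ∣ x j ∣ ≤ C) →
  sum (λ j → a j * x j) ≤ sum (λ j → a′ j * x j) + fromℕ k * (η * C)
perturbed-sum {k} {η} {C} a a′ x a≈a′ x≤C = begin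
  sum (λ j → a j * x j)                                    ≤⟨ sum-mono term ⟩
  sum (λ j → a′ j * x j + η * C)                           ≡⟨ ∑-distrib-+ (λ j → a′ j * x j) (λ _ → η * C) ⟩
  sum (λ j → a′ j * x j) + sum {k} (λ _ → η * C)           ≡⟨ cong (sum (λ j → a′ j * x j) +_) (sum-const k (η * C)) ⟩
  sum (λ j → a′ j * x j) + fromℕ k * (η * C)               ∎
  where
  open ℚ.≤-Reasoning
  term : ∀ j → a j * x j ≤ a′ j * x j + η * C
  term j = begin
    a j * x j                           ≡⟨ split (a j) (a′ j) (x j) ⟩
    a′ j * x j + (a j - a′ j) * x j     ≤⟨ ℚ.+-monoʳ-≤ (a′ j * x j) (ℚ.≤-trans (p≤∣p∣ ((a j - a′ j) * x j))
                                             (ℚ.≤-trans (ℚ.≤-reflexive (ℚ.∣p*q∣≡∣p∣*∣q∣ (a j - a′ j) (x j)))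
                                               (*-mono-≤ (ℚ.0≤∣p∣ (a j - a′ j)) (ℚ.≤-trans (ℚ.0≤∣p∣ (x j)) (x≤C j)) (a≈a′ j) (x≤C j)))) ⟩
    a′ j * x j + η * C                  ∎
    where
    split : ∀ a b x → a * x ≡ b * x + (a - b) * x
    split = RingSolver.solve-∀ ring

module Rows {n r} (A : Matrix r n) (B : Matrix r r) (b : ℝ^ r) where

  row : ℕ → Fin r → Vector n → Vector r → ℚ
  row t i x y = sum (λ j → seq (A i j) t * x j) + sum (λ j → seq (B i j) t * y j)

  seq-row : ∀ (X : ℝ^ n) (Y : ℝ^ r) i t →
    seq ((A · X +ᵛ B · Y) i) t ≡ row t i (λ j → seq (X j) t) (λ j → seq (Y j) t)
  seq-row X Y i t = cong₂ _+_ (seq-∑ (λ j → A i j ℝ.* X j) t) (seq-∑ (λ j → B i j ℝ.* Y j) t)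

  module _ (τ : ℕ → ℕ) (τ≥ : ∀ t → t ℕ.≤ τ t) (x : ℕ → Vector n) (y : ℕ → Vector r)
    {C : ℚ} (0≤C : 0ℚ ≤ C) (x≤C : ∀ t j → ∣ x t j ∣ ≤ C) (y≤C : ∀ t j → ∣ y t j ∣ ≤ C)
    (x-cauchy : ∀ j → IsCauchy (λ t → x t j)) (y-cauchy : ∀ j → IsCauchy (λ t → y t j))
    (γ : ℕ → ℚ) (γ→0 : ∀ {η} → 0ℚ < η → Eventually (λ t → γ t ≤ η))
    (feasible : ∀ t i → row (τ t) i (x t) (y t) ≤ seq (b i) (τ t) + γ t)
    where

    -- Feasibility is given for the data at time `τ t`, but the limit is judged with the data at
    -- time t. These agree up to any η eventually, since the data are Cauchy and `t ≤ τ t`, and C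
    -- bounds the effect on the products.
    limit-feasible : Σ[ X ∈ ℝ^ n ] ((∀ t j → seq (X j) t ≡ x t j) × projection A B b X)
    limit-feasible = X , (λ t j → refl) , Y , bound
      where
      X : ℝ^ n
      X j = mkℝ (λ t → x t j) (x-cauchy j)
      Y : ℝ^ r
      Y j = mkℝ (λ t → y t j) (y-cauchy j)
      -- Total error in units of η: C for each entry of a row of A and B, and one unit each for `b`
      -- and `γ`.
      K : ℚ
      K = (fromℕ n * C + fromℕ r * C) + (1ℚ + 1ℚ)
      0<K : 0ℚ < K
      0<K = ℚ.<-≤-trans (ℚ.positive⁻¹ (1ℚ + 1ℚ)) (≤-by (fromℕ n * C + fromℕ r * C)
        (0≤+ (0≤* (0≤fromℕ n) 0≤C) (0≤* (0≤fromℕ r) 0≤C)) (ℚ.+-comm (fromℕ n * C + fromℕ r * C) (1ℚ + 1ℚ)))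
      bound : A · X +ᵛ B · Y ≤ᵛ b
      bound i ε 0<ε = ev-map (λ {t} → at t) estimates
        where
        1/K η : ℚ
        1/K = proj₁ (inverse 0<K)
        η = ε * 1/K
        0<η : 0ℚ < η
        0<η = 0<* 0<ε (proj₁ (proj₂ (inverse 0<K)))
        ηK≡ε : η * K ≡ ε
        ηK≡ε = trans (swap ε 1/K K) (trans (cong (ε *_) (proj₂ (proj₂ (inverse 0<K)))) (ℚ.*-identityʳ ε))
          where
          swap : ∀ a b c → a * b * c ≡ a * (c * b)
          swap = RingSolver.solve-∀ ring
        Close : ℝ → ℕ → Set
        Close z t = ∣ seq z t - seq z (τ t) ∣ ≤ η
        close : ∀ z → Eventually (Close z)
        close z = ev-map (λ {t} h → h (τ t) (τ≥ t)) (cauchy-tail {seq z} (cauchy z) {η} 0<η)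
        Estimates : ℕ → Set
        Estimates t = (∀ j → Close (A i j) t) × (∀ j → Close (B i j) t) × Close (b i) t × γ t ≤ η
        estimates : Eventually Estimates
        estimates = ev-× (ev-Fin λ j → close (A i j)) (ev-× (ev-Fin λ j → close (B i j))
          (ev-× (close (b i)) (γ→0 0<η)))
        at : ∀ t → Estimates t → seq ((A · X +ᵛ B · Y) i) t ≤ seq (b i) t + ε
        at t (A≈ , B≈ , b≈ , γ≤) = begin
          seq ((A · X +ᵛ B · Y) i) t
            ≡⟨ seq-row X Y i t ⟩
          row t i (x t) (y t)
            ≤⟨ ℚ.+-mono-≤ (perturbed-sum (λ j → seq (A i j) t) (λ j → seq (A i j) (τ t)) (x t) A≈ (x≤C t))
                 (perturbed-sum (λ j → seq (B i j) t) (λ j → seq (B i j) (τ t)) (y t) B≈ (y≤C t)) ⟩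
          (rowA + fromℕ n * (η * C)) + (rowB + fromℕ r * (η * C))
            ≤⟨ ≤-by _ (0≤+ (0≤+ (0≤-diff (feasible t i)) (0≤-diff γ≤)) (0≤-diff (∣≤∣⇒≥ {seq (b i) t} b≈)))
                 (regroup rowA rowB (fromℕ n) (fromℕ r) C η (seq (b i) (τ t)) (seq (b i) t) (γ t)) ⟩
          seq (b i) t + η * K
            ≡⟨ cong (seq (b i) t +_) ηK≡ε ⟩
          seq (b i) t + ε ∎
          where
          open ℚ.≤-Reasoning
          rowA rowB : ℚ
          rowA = sum (λ j → seq (A i j) (τ t) * x t j)
          rowB = sum (λ j → seq (B i j) (τ t) * y t j)
          regroup : ∀ p q n r C η b′ b γ → b + η * ((n * C + r * C) + (1ℚ + 1ℚ)) ≡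
            ((p + n * (η * C)) + (q + r * (η * C))) + ((((b′ + γ) - (p + q)) + (η - γ)) + ((b + η) - b′))
          regroup = RingSolver.solve-∀ ring

  -- The box on y makes compactness applicable. The right-hand sides are relaxed by two reciprocals:
  -- one covers the error of the true witnesses at a finite time, the other leaves them positive
  -- slack.
  record Configuration (w : Vec Bool n) (θ Y : ℚ) (T : ℕ) : Set where
    field
      time    : ℕ
      time≥   : T ℕ.≤ time
      x       : Vector n
      y       : Vector r
      x≈w     : ∀ j → ∣ x j - bit (lookup w j) ∣ ≤ θ
      y≤Y     : ∀ j → ∣ y j ∣ ≤ Y
      rows    : ∀ i → row time i x y ≤ seq (b i) time + (proj₁ (reciprocal T) + proj₁ (reciprocal T))

  module _ (em : ExcludedMiddle 0ℓ) (w : Vec Bool n) {θ Y : ℚ} (0≤θ : 0ℚ ≤ θ) (0≤Y : 0ℚ ≤ Y)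
    (far : (X : ℝ^ n) → (∀ t j → ∣ seq (X j) t - bit (lookup w j) ∣ ≤ θ) → ¬ projection A B b X)
    where

    open Compactness em

    -- Otherwise the configurations at arbitrarily late times accumulate at
    -- a point of the projection that is too close to w.
    no-configuration : Eventually (λ T → ¬ Configuration w θ Y T)
    no-configuration = decide em
      where
      Late : ℕ → Set
      Late t = Σ[ T ∈ ℕ ] (t ℕ.≤ T × Configuration w θ Y T)
      find : ¬ Eventually (λ T → ¬ Configuration w θ Y T) → ∀ t → Dec (Late t) → Late t
      find never t (yes late) = late
      find never t (no ¬late) = ⊥-elim (never (t , λ T t≤T conf → ¬late (T , t≤T , conf)))
      accumulate : (∀ t → Late t) → ⊥
      accumulate late = far (proj₁ limit)
        (λ t j → subst (λ q → ∣ q - bit (lookup w j) ∣ ≤ θ) (sym (proj₁ (proj₂ limit) t j)) (x≈w (conf (φ t)) j))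
        (proj₂ (proj₂ limit))
        where
        open Configuration
        T : ℕ → ℕ
        T t = proj₁ (late t)
        conf : ∀ t → Configuration w θ Y (T t)
        conf t = proj₂ (proj₂ (late t))
        gap : ℕ → ℚ
        gap t = proj₁ (reciprocal (T t))
        C : ℚ
        C = (θ + 1ℚ) + Y
        0≤C : 0ℚ ≤ C
        0≤C = 0≤+ (0≤+ 0≤θ 0≤1) 0≤Y
        x-bound : ∀ t j → ∣ x (conf t) j ∣ ≤ C
        x-bound t j = ℚ.≤-trans (subst (λ q → ∣ q ∣ ≤ θ + 1ℚ) (restore (x (conf t) j) (bit (lookup w j)))
            (ℚ.≤-trans (ℚ.∣p+q∣≤∣p∣+∣q∣ (x (conf t) j - bit (lookup w j)) (bit (lookup w j)))
              (ℚ.+-mono-≤ (x≈w (conf t) j) (ℚ.≤-trans (ℚ.≤-reflexive (ℚ.0≤p⇒∣p∣≡p (proj₁ (bit-unit (lookup w j)))))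
                (proj₂ (bit-unit (lookup w j)))))))
          (≤-by Y 0≤Y refl)
          where
          restore : ∀ a b → (a - b) + b ≡ a
          restore = RingSolver.solve-∀ ring
        y-bound : ∀ t j → ∣ y (conf t) j ∣ ≤ C
        y-bound t j = ℚ.≤-trans (y≤Y (conf t) j) (≤-by (θ + 1ℚ) (0≤+ 0≤θ 0≤1) (ℚ.+-comm (θ + 1ℚ) Y))
        first = bolzano-weierstrass {C} n (λ t → x (conf t)) x-bound
        second = bolzano-weierstrass {C} r (λ t → y (conf (proj₁ first t))) (λ t → y-bound (proj₁ first t))
        φ : ℕ → ℕ
        φ t = proj₁ first (proj₁ second t)
        φ≥ : ∀ t → t ℕ.≤ φ t
        φ≥ t = ℕ.≤-trans (proj₁ (proj₂ second) t) (proj₁ (proj₂ first) (proj₁ second t))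
        T≥ : ∀ t → t ℕ.≤ T (φ t)
        T≥ t = ℕ.≤-trans (φ≥ t) (proj₁ (proj₂ (late (φ t))))
        x-cauchy : ∀ j → IsCauchy (λ t → x (conf (φ t)) j)
        x-cauchy j = cauchy-subsequence {λ t → x (conf (proj₁ first t)) j} {proj₁ second} (proj₂ (proj₂ first) j) (proj₁ (proj₂ second))
        gap→0 : ∀ {η} → 0ℚ < η → Eventually (λ t → gap (φ t) + gap (φ t) ≤ η)
        gap→0 {η} 0<η = proj₁ small , λ t N≤t →
          let gap≤ = proj₂ small (T (φ t)) (ℕ.≤-trans N≤t (T≥ t)) in
          ℚ.≤-trans (ℚ.+-mono-≤ gap≤ gap≤) (ℚ.≤-reflexive (halves η))
          where
          small : Eventually (λ t → proj₁ (reciprocal t) ≤ ½ * η)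
          small = ev-reciprocal (0<* (ℚ.positive⁻¹ ½) 0<η)
          halves : ∀ q → ½ * q + ½ * q ≡ q
          halves = RingSolver.solve-∀ ring
        limit = limit-feasible (λ t → time (conf (φ t))) (λ t → ℕ.≤-trans (T≥ t) (time≥ (conf (φ t))))
          (λ t → x (conf (φ t))) (λ t → y (conf (φ t))) 0≤C (λ t → x-bound (φ t)) (λ t → y-bound (φ t))
          x-cauchy (proj₂ (proj₂ second)) (λ t → gap (φ t) + gap (φ t)) gap→0 (λ t → rows (conf (φ t)))
      decide : Dec (Eventually (λ T → ¬ Configuration w θ Y T)) → Eventually (λ T → ¬ Configuration w θ Y T)
      decide (yes ev)    = ev
      decide (no never) = ⊥-elim (accumulate λ t → find never t em)

-- Polynomials

add : List ℚ → List ℚ → List ℚ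
add []       bs       = bs
add (a ∷ as) []       = a ∷ as
add (a ∷ as) (b ∷ bs) = a + b ∷ add as bs

mul : List ℚ → List ℚ → List ℚ
mul []       bs = []
mul (a ∷ as) bs = add (List.map (a *_) bs) (0ℚ ∷ mul as bs)

eval-add : ∀ as bs x → evalPoly (add as bs) x ≡ evalPoly as x + evalPoly bs x
eval-add []       bs       x = sym (ℚ.+-identityˡ (evalPoly bs x))
eval-add (a ∷ as) []       x = sym (ℚ.+-identityʳ (evalPoly (a ∷ as) x))
eval-add (a ∷ as) (b ∷ bs) x = trans (cong (λ y → (a + b) + x * y) (eval-add as bs x))
  (regroup a b x (evalPoly as x) (evalPoly bs x))
  where
  regroup : ∀ a b x p q → (a + b) + x * (p + q) ≡ (a + x * p) + (b + x * q)
  regroup = RingSolver.solve-∀ ring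

eval-scale : ∀ c bs x → evalPoly (List.map (c *_) bs) x ≡ c * evalPoly bs x
eval-scale c []       x = sym (ℚ.*-zeroʳ c)
eval-scale c (b ∷ bs) x = trans (cong (λ y → c * b + x * y) (eval-scale c bs x)) (regroup c b x (evalPoly bs x))
  where
  regroup : ∀ c b x q → c * b + x * (c * q) ≡ c * (b + x * q)
  regroup = RingSolver.solve-∀ ring

eval-mul : ∀ as bs x → evalPoly (mul as bs) x ≡ evalPoly as x * evalPoly bs x
eval-mul []       bs x = sym (ℚ.*-zeroˡ (evalPoly bs x))
eval-mul (a ∷ as) bs x = trans (eval-add (List.map (a *_) bs) (0ℚ ∷ mul as bs) x)
  (trans (cong₂ (λ y z → y + (0ℚ + x * z)) (eval-scale a bs x) (eval-mul as bs x))
    (regroup a x (evalPoly as x) (evalPoly bs x)))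
  where
  regroup : ∀ a x p q → a * q + (0ℚ + x * (p * q)) ≡ (a + x * p) * q
  regroup = RingSolver.solve-∀ ring

poly-+ : ∀ {p q} → IsPolynomial p → IsPolynomial q → IsPolynomial (λ n → p n ℕ.+ q n)
poly-+ {p} {q} (as , p≡) (bs , q≡) = add as bs , λ n → trans (fromℕ-homo-+ (p n) (q n))
  (trans (cong₂ _+_ (p≡ n) (q≡ n)) (sym (eval-add as bs (fromℕ n))))

poly-* : ∀ {p q} → IsPolynomial p → IsPolynomial q → IsPolynomial (λ n → p n ℕ.* q n)
poly-* {p} {q} (as , p≡) (bs , q≡) = mul as bs , λ n → trans (fromℕ-homo-* (p n) (q n))
  (trans (cong₂ _*_ (p≡ n) (q≡ n)) (sym (eval-mul as bs (fromℕ n))))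

poly-const : ∀ k → IsPolynomial (λ _ → k)
poly-const k = fromℕ k ∷ [] , λ n → sym (constant (fromℕ k) (fromℕ n))
  where
  constant : ∀ k x → k + x * 0ℚ ≡ k
  constant = RingSolver.solve-∀ ring

poly-id : IsPolynomial (λ n → n)
poly-id = 0ℚ ∷ 1ℚ ∷ [] , λ n → sym (linear (fromℕ n))
  where
  linear : ∀ x → 0ℚ + x * (1ℚ + x * 0ℚ) ≡ x
  linear = RingSolver.solve-∀ ring

poly-suc : ∀ {p} → IsPolynomial p → IsPolynomial (λ n → suc (p n))
poly-suc {p} pp = poly-+ {λ _ → 1} {p} (poly-const 1) pp

poly-stepCount : ∀ {N E} → IsPolynomial N → IsPolynomial E → IsPolynomial (λ n → stepCount (N n) (E n))
poly-stepCount {N} {E} pN pE = poly-* {λ n → sweepCount (N n) (E n)} {N}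
  (poly-suc {λ n → N n ℕ.* (suc (E n) ℕ.* suc (E n))}
    (poly-* {N} {λ n → suc (E n) ℕ.* suc (E n)} pN
      (poly-* {λ n → suc (E n)} {λ n → suc (E n)} (poly-suc {E} pE) (poly-suc {E} pE)))) pN

poly-letterCount : ∀ {H G} → IsPolynomial H → IsPolynomial G → IsPolynomial (λ n → letterCount (H n) (G n))
poly-letterCount {H} {G} pH pG = poly-suc {λ n → (H n ℕ.+ H n) ℕ.* suc (G n)}
  (poly-* {λ n → H n ℕ.+ H n} {λ n → suc (G n)} (poly-+ {H} {H} pH pH) (poly-suc {G} pG))

poly-network-size : ∀ {N M T} → IsPolynomial N → IsPolynomial M → IsPolynomial T →
                    IsPolynomial (λ n → network-size (N n) (M n) (T n))
poly-network-size {N} {M} {T} pN pM pT = poly-+ {λ n → accept-cost (N n) (M n)}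
    {λ n → T n ℕ.* (N n ℕ.* M n ℕ.* step-cost (M n)) ℕ.+ N n ℕ.* M n ℕ.* 6}
  (poly-suc {λ n → N n ℕ.* suc (inner n)} (poly-* {N} {λ n → suc (inner n)} pN (poly-suc {inner} pInner)))
  (poly-+ {λ n → T n ℕ.* (N n ℕ.* M n ℕ.* step-cost (M n))} {λ n → N n ℕ.* M n ℕ.* 6}
    (poly-* {T} {λ n → N n ℕ.* M n ℕ.* step-cost (M n)} pT
      (poly-* {λ n → N n ℕ.* M n} {λ n → step-cost (M n)} pNM
        (poly-suc {λ n → M n ℕ.* suc (inner n)} (poly-* {M} {λ n → suc (inner n)} pM (poly-suc {inner} pInner)))))
    (poly-* {λ n → N n ℕ.* M n} {λ _ → 6} pNM (poly-const 6)))
  where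
  inner : ℕ → ℕ
  inner n = 1 ℕ.+ M n ℕ.* 2
  pInner : IsPolynomial inner
  pInner = poly-suc {λ n → M n ℕ.* 2} (poly-* {M} {λ _ → 2} pM (poly-const 2))
  pNM : IsPolynomial (λ n → N n ℕ.* M n)
  pNM = poly-* {N} {M} pN pM

poly-separatorSize : ∀ {N E} → IsPolynomial N → IsPolynomial E → IsPolynomial (λ n → separatorSize (N n) (E n))
poly-separatorSize {N} {E} pN pE = poly-network-size {N} {λ n → gridSize (N n) (E n)} {steps} pN
  (poly-letterCount {λ n → 3 ℕ.+ steps n} {λ n → suc (steps n) ℕ.* suc (E n)}
    (poly-+ {λ _ → 3} {steps} (poly-const 3) pSteps)
    (poly-* {λ n → suc (steps n)} {λ n → suc (E n)} (poly-suc {steps} pSteps) (poly-suc {E} pE))) pSteps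
  where
  steps : ℕ → ℕ
  steps n = stepCount (N n) (E n)
  pSteps : IsPolynomial steps
  pSteps = poly-stepCount {N} {E} pN pE

-- Rational systems from real extended formulations

unit : ∀ {k} → Fin k → Vector k
unit zero    zero    = 1ℚ
unit zero    (suc j) = 0ℚ
unit (suc i) zero    = 0ℚ
unit (suc i) (suc j) = unit i j

⟨,⟩-unit : ∀ {k} (u : Vector k) i → ⟨ u , unit i ⟩ ≡ u i
⟨,⟩-unit {suc k} u zero = trans (cong (u zero * 1ℚ +_) (⟨,⟩-zeroʳ (u ∘ suc))) (simplify (u zero))
  where
  simplify : ∀ x → x * 1ℚ + 0ℚ ≡ x
  simplify = RingSolver.solve-∀ ring
⟨,⟩-unit {suc k} u (suc i) = trans (cong (u zero * 0ℚ +_) (⟨,⟩-unit (u ∘ suc) i)) (simplify (u zero) (u (suc i)))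
  where
  simplify : ∀ x y → x * 0ℚ + y ≡ y
  simplify = RingSolver.solve-∀ ring

infixr 5 _⧺_

_⧺_ : ∀ {n r} → Vector n → Vector r → Vector (n ℕ.+ r)
_⧺_ {n} x y i = [ x , y ] (Fin.splitAt n i)

⟨,⟩-⧺ : ∀ {n r} (u : Vector (n ℕ.+ r)) (a : Vector n) (b : Vector r) →
  ⟨ u , a ⧺ b ⟩ ≡ ⟨ (λ i → u (i Fin.↑ˡ r)) , a ⟩ + ⟨ (λ j → u (n Fin.↑ʳ j)) , b ⟩
⟨,⟩-⧺ {zero}  u a b = sym (ℚ.+-identityˡ ⟨ u , b ⟩)
⟨,⟩-⧺ {suc n} {r} u a b = trans (cong (u zero * a zero +_) (trans (⟨,⟩-congʳ (u ∘ suc) shift) (⟨,⟩-⧺ (u ∘ suc) (a ∘ suc) b)))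
  (sym (ℚ.+-assoc (u zero * a zero) ⟨ (λ i → u (suc i Fin.↑ˡ r)) , (λ i → a (suc i)) ⟩ ⟨ (λ j → u (suc n Fin.↑ʳ j)) , b ⟩))
  where
  shift : ∀ i → (a ⧺ b) (suc i) ≡ ((a ∘ suc) ⧺ b) i
  shift i with Fin.splitAt n i
  ... | inj₁ _ = refl
  ... | inj₂ _ = refl

⧺-left : ∀ {n r} (x : Vector n) (y : Vector r) i → (x ⧺ y) (i Fin.↑ˡ r) ≡ x i
⧺-left {n} {r} x y i = cong [ x , y ] (Fin.splitAt-↑ˡ n i r)

⧺-right : ∀ {n r} (x : Vector n) (y : Vector r) j → (x ⧺ y) (n Fin.↑ʳ j) ≡ y j
⧺-right {n} {r} x y j = cong [ x , y ] (Fin.splitAt-↑ʳ n r j)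

-- With E this number and ε = 1/(E+1), the tolerance 3ε satisfies 3ε(m+1) ≤ 1/(2n+1).
precision : ℕ → ℕ → ℕ
precision n m = 3 ℕ.* suc m ℕ.* suc (n ℕ.+ n)

module Formulation {n r : ℕ} (A : Matrix r n) (B : Matrix r r) (b : ℝ^ r)
  (InL : Vec Bool n → Set) (InL? : ∀ w → Dec (InL w)) (w₀ : Vec Bool n) (L₀ : InL w₀)
  (complete : ∀ w → InL w → projection A B b (bitVector w))
  (θ : ℚ) (0<θ : 0ℚ < θ) (nθ≡1 : fromℕ (suc (n ℕ.+ n)) * θ ≡ 1ℚ)
  (far : ∀ w → ¬ InL w → (X : ℝ^ n) → (∀ t j → ∣ seq (X j) t - bit (lookup w j) ∣ ≤ θ) → ¬ projection A B b X)
  (em : ExcludedMiddle 0ℓ)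
  where

  open Rows A B b

  private
    member : ∀ w → Dec (InL w) → Σ[ v ∈ Vec Bool n ] (InL v × (InL w → v ≡ w))
    member w (yes inL) = w , inL , λ _ → refl
    member w (no ¬inL) = w₀ , L₀ , λ inL → ⊥-elim (¬inL inL)

    rep : Vec Bool n → Vec Bool n
    rep w = proj₁ (member w (InL? w))

    rep-in : ∀ w → InL (rep w)
    rep-in w = proj₁ (proj₂ (member w (InL? w)))

    witness : ∀ w → projection A B b (bitVector (rep w))
    witness w = complete (rep w) (rep-in w)

    Below : Vec Bool n → Fin r → ℕ → ℕ → Set
    Below w j M t = ∣ seq (proj₁ (witness w) j) t ∣ ≤ fromℕ M

    Bounded : ℕ → ℕ → Set
    Bounded M t = ∀ w j → Below w j M t

    bounded : Eventually (λ M → Eventually (Bounded M))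
    bounded = ev-map {λ M → ∀ w j → Eventually (Below w j M)} {λ M → Eventually (Bounded M)}
      (λ bs → ev-words λ w → ev-Fin λ j → bs w j)
      (ev-words λ w → ev-Fin λ j → cauchy-bounded {seq (proj₁ (witness w) j)} (cauchy (proj₁ (witness w) j)))

    M : ℕ
    M = proj₁ bounded

    0≤M+1 : 0ℚ ≤ fromℕ M + 1ℚ
    0≤M+1 = 0≤+ (0≤fromℕ M) 0≤1

    -- The order of choices matters: the box M comes from the finitely many witnesses, T depends on
    -- M by compactness, γ on T, and the time t on all of these. Hence configurations are excluded
    -- at every time past T at once.
    separated : Eventually (λ T → ∀ w → ¬ InL w → ¬ Configuration w θ (fromℕ M + 1ℚ) T)
    separated = ev-words λ w → by-cases w (InL? w)
      where
      by-cases : ∀ w → Dec (InL w) → Eventually (λ T → ¬ InL w → ¬ Configuration w θ (fromℕ M + 1ℚ) T)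
      by-cases w (yes inL) = ev-always λ _ ¬inL _ → ¬inL inL
      by-cases w (no ¬inL) = ev-map (λ none _ → none) (no-configuration em w (ℚ.<⇒≤ 0<θ) 0≤M+1 (far w ¬inL))

    T : ℕ
    T = proj₁ separated

    γ : ℚ
    γ = proj₁ (reciprocal T)

    0<γ : 0ℚ < γ
    0<γ = proj₁ (proj₂ (reciprocal T))

    Snapshot : ℕ → Set
    Snapshot t = (∀ w i → seq ((A · bitVector (rep w) +ᵛ B · proj₁ (witness w)) i) t ≤ seq (b i) t + γ) × Bounded M t

    snapshot : Eventually Snapshot
    snapshot = ev-× (ev-words λ w → ev-Fin λ i → proj₂ (witness w) i γ 0<γ) (proj₂ bounded M ℕ.≤-refl)

    t : ℕ
    t = proj₁ snapshot ℕ.⊔ T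

    taken : Snapshot t
    taken = proj₂ snapshot t (ℕ.m≤m⊔n (proj₁ snapshot) T)

    bits y : Vec Bool n → Vector _
    bits w i = bit (lookup (rep w) i)
    y w j = seq (proj₁ (witness w) j) t

    row-feasible : ∀ w i → row t i (bits w) (y w) ≤ seq (b i) t + γ
    row-feasible w i = subst (_≤ seq (b i) t + γ)
      (trans (seq-row (bitVector (rep w)) (proj₁ (witness w)) i t)
        (cong (_+ sum (λ j → seq (B i j) t * y w j))
          (⟨,⟩-congʳ (λ j → seq (A i j) t) (λ j → seq-bitVector (rep w) j t))))
      (proj₁ taken w i)

    d : ℕ
    d = n ℕ.+ r

    -- The rows of the formulation, followed by the box ∣ y j ∣ ≤ M + 1.
    Constraint : Set
    Constraint = Fin r ⊎ (Fin r ⊎ Fin r)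

    offset : Constraint → ℚ
    offset (inj₁ i) = seq (b i) t + (γ + γ)
    offset (inj₂ _) = fromℕ M + 1ℚ

    normal : Constraint → Vector d
    normal (inj₁ i)        = (λ j → (- 1ℚ) * seq (A i j) t) ⧺ (λ j → (- 1ℚ) * seq (B i j) t)
    normal (inj₂ (inj₁ j)) = (λ _ → 0ℚ) ⧺ (λ l → (- 1ℚ) * unit j l)
    normal (inj₂ (inj₂ j)) = (λ _ → 0ℚ) ⧺ unit j

    slack : Constraint → Vector n → Vector r → ℚ
    slack (inj₁ i)        x y = (seq (b i) t + (γ + γ)) - row t i x y
    slack (inj₂ (inj₁ j)) x y = (fromℕ M + 1ℚ) - y j
    slack (inj₂ (inj₂ j)) x y = (fromℕ M + 1ℚ) + y j

    left : Vector d → Vector n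
    left u i = u (i Fin.↑ˡ r)

    right : Vector d → Vector r
    right u j = u (n Fin.↑ʳ j)

    slack≡ : ∀ κ u → affine (offset κ) (normal κ) u ≡ slack κ (left u) (right u)
    slack≡ (inj₁ i) u = trans (cong (offset (inj₁ i) +_) (trans (⟨,⟩-⧺ u (λ j → (- 1ℚ) * seq (A i j) t) (λ j → (- 1ℚ) * seq (B i j) t))
        (cong₂ _+_ (negated (λ j → seq (A i j) t) (left u)) (negated (λ j → seq (B i j) t) (right u)))))
      (collect (offset (inj₁ i)) (sum (λ j → seq (A i j) t * left u j)) (sum (λ j → seq (B i j) t * right u j)))
      where
      negated : ∀ {k} (a x : Vector k) → ⟨ x , (λ j → (- 1ℚ) * a j) ⟩ ≡ (- 1ℚ) * sum (λ j → a j * x j)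
      negated a x = trans (⟨,⟩-*ʳ x (- 1ℚ) a) (cong ((- 1ℚ) *_) (⟨,⟩-comm x a))
      collect : ∀ c x y → c + ((- 1ℚ) * x + (- 1ℚ) * y) ≡ c - (x + y)
      collect = RingSolver.solve-∀ ring
    slack≡ (inj₂ (inj₁ j)) u = trans (cong (fromℕ M + 1ℚ +_) (trans (⟨,⟩-⧺ u (λ _ → 0ℚ) (λ l → (- 1ℚ) * unit j l))
        (cong₂ _+_ (⟨,⟩-zeroʳ (left u)) (trans (⟨,⟩-*ʳ (right u) (- 1ℚ) (unit j)) (cong ((- 1ℚ) *_) (⟨,⟩-unit (right u) j))))))
      (collect (fromℕ M + 1ℚ) (right u j))
      where
      collect : ∀ c y → c + (0ℚ + (- 1ℚ) * y) ≡ c - y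
      collect = RingSolver.solve-∀ ring
    slack≡ (inj₂ (inj₂ j)) u = trans (cong (fromℕ M + 1ℚ +_) (trans (⟨,⟩-⧺ u (λ _ → 0ℚ) (unit j))
        (cong₂ _+_ (⟨,⟩-zeroʳ (left u)) (⟨,⟩-unit (right u) j))))
      (cong (fromℕ M + 1ℚ +_) (ℚ.+-identityˡ (right u j)))

    slack-cong : ∀ κ {x x′ y y′} → (∀ i → x i ≡ x′ i) → (∀ j → y j ≡ y′ j) → slack κ x y ≡ slack κ x′ y′
    slack-cong (inj₁ i) x≗ y≗ = cong (λ q → offset (inj₁ i) - q)
      (cong₂ _+_ (⟨,⟩-congʳ (λ j → seq (A i j) t) x≗) (⟨,⟩-congʳ (λ j → seq (B i j) t) y≗))
    slack-cong (inj₂ (inj₁ j)) x≗ y≗ = cong (λ q → fromℕ M + 1ℚ - q) (y≗ j)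
    slack-cong (inj₂ (inj₂ j)) x≗ y≗ = cong (λ q → fromℕ M + 1ℚ + q) (y≗ j)

    U : Vec Bool n → Vector d
    U w = bits w ⧺ y w

    0<slack : ∀ κ w → 0ℚ < slack κ (bits w) (y w)
    0<slack (inj₁ i) w = ℚ.<-≤-trans 0<γ (≤-by _ (0≤-diff (row-feasible w i)) (regroup (seq (b i) t) γ (row t i (bits w) (y w))))
      where
      regroup : ∀ b γ q → (b + (γ + γ)) - q ≡ γ + ((b + γ) - q)
      regroup = RingSolver.solve-∀ ring
    0<slack (inj₂ (inj₁ j)) w = ℚ.<-≤-trans 0<1 (≤-by _
        (0≤-diff (ℚ.≤-trans (p≤∣p∣ (y w j)) (proj₂ taken w j))) (regroup (fromℕ M) (y w j)))
      where
      regroup : ∀ M y → (M + 1ℚ) - y ≡ 1ℚ + (M - y)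
      regroup = RingSolver.solve-∀ ring
    0<slack (inj₂ (inj₂ j)) w = ℚ.<-≤-trans 0<1 (≤-by _
        (0≤-diff (ℚ.≤-trans (-p≤∣p∣ (y w j)) (proj₂ taken w j))) (regroup (fromℕ M) (y w j)))
      where
      regroup : ∀ M y → (M + 1ℚ) + y ≡ 1ℚ + (M - - y)
      regroup = RingSolver.solve-∀ ring

    m : ℕ
    m = r ℕ.+ (r ℕ.+ r)

    tag : Fin m → Constraint
    tag k = [ inj₁ , (λ l → inj₂ (Fin.splitAt r l)) ] (Fin.splitAt r k)

    untag : ∀ κ → ∃[ k ] tag k ≡ κ
    untag (inj₁ i) = i Fin.↑ˡ (r ℕ.+ r) ,
      cong [ inj₁ , (λ l → inj₂ (Fin.splitAt r l)) ] (Fin.splitAt-↑ˡ r i (r ℕ.+ r))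
    untag (inj₂ κ) = r Fin.↑ʳ Fin.join r r κ ,
      trans (cong [ inj₁ , (λ l → inj₂ (Fin.splitAt r l)) ] (Fin.splitAt-↑ʳ r (r ℕ.+ r) (Fin.join r r κ)))
        (cong inj₂ (Fin.splitAt-join r r κ))

    xRow : Fin n → Vector d
    xRow i = unit i ⧺ (λ _ → 0ℚ)

    xRow≡ : ∀ u i → ⟨ u , xRow i ⟩ ≡ left u i
    xRow≡ u i = trans (⟨,⟩-⧺ u (unit i) (λ _ → 0ℚ))
      (trans (cong₂ _+_ (⟨,⟩-unit (left u) i) (⟨,⟩-zeroʳ (right u))) (ℚ.+-identityʳ (left u i)))

    -- For w outside the language the two parts of `u` would form a configuration at time t, which
    -- is past T.
    sound : ∀ w u → (∀ i → ∣ ⟨ u , xRow i ⟩ - bit (lookup w i) ∣ ≤ θ) →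
            (∀ k → 0ℚ ≤ affine (offset (tag k)) (normal (tag k)) u) → InL w
    sound w u x≈ slack≥ = decided (InL? w)
      where
      slack≥′ : ∀ κ → 0ℚ ≤ slack κ (left u) (right u)
      slack≥′ κ = let k , eq = untag κ in
        subst (0ℚ ≤_) (trans (cong (λ κ → affine (offset κ) (normal κ) u) eq) (slack≡ κ u)) (slack≥ k)
      0≤q-p : ∀ {p q} → 0ℚ ≤ q - p → p ≤ q
      0≤q-p {p} {q} h = ≤-by (q - p) h (restore p q)
        where
        restore : ∀ p q → q ≡ p + (q - p)
        restore = RingSolver.solve-∀ ring
      configuration : Configuration w θ (fromℕ M + 1ℚ) T
      configuration = record
        { time  = t
        ; time≥ = ℕ.m≤n⊔m (proj₁ snapshot) T
        ; x     = left u
        ; y     = right u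
        ; x≈w   = λ j → subst (λ q → ∣ q - bit (lookup w j) ∣ ≤ θ) (xRow≡ u j) (x≈ j)
        ; y≤Y   = λ j → ∣p∣≤q (0≤q-p (slack≥′ (inj₂ (inj₁ j))))
                    (≤-by _ (slack≥′ (inj₂ (inj₂ j))) (negate (fromℕ M + 1ℚ) (right u j)))
        ; rows  = λ i → 0≤q-p (slack≥′ (inj₁ i))
        }
        where
        negate : ∀ c y → c ≡ - y + (c + y)
        negate = RingSolver.solve-∀ ring
      decided : Dec (InL w) → InL w
      decided (yes inL) = inL
      decided (no ¬inL) = ⊥-elim (proj₂ separated T ℕ.≤-refl w ¬inL configuration)

    E : ℕ
    E = precision n m

    ε : ℚ
    ε = proj₁ (reciprocal E)

    0<ε : 0ℚ < ε
    0<ε = proj₁ (proj₂ (reciprocal E))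

    Eε≡1 : fromℕ (suc E) * ε ≡ 1ℚ
    Eε≡1 = proj₂ (proj₂ (reciprocal E))

    ε-small : (ε + ε + ε) * (1ℚ + fromℕ m) ≤ θ
    ε-small = ℚ.*-cancelˡ-≤-pos (fromℕ (suc (n ℕ.+ n))) {{ℚ.positive (0<fromℕ-suc (n ℕ.+ n))}} (begin
      fromℕ (suc (n ℕ.+ n)) * ((ε + ε + ε) * (1ℚ + fromℕ m))
        ≡⟨ regroup (fromℕ (suc (n ℕ.+ n))) ε (1ℚ + fromℕ m) ⟩
      (1ℚ + 1ℚ + 1ℚ) * (1ℚ + fromℕ m) * fromℕ (suc (n ℕ.+ n)) * ε
        ≡⟨ cong (λ q → (1ℚ + 1ℚ + 1ℚ) * q * fromℕ (suc (n ℕ.+ n)) * ε) (fromℕ-suc m) ⟨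
      fromℕ 3 * fromℕ (suc m) * fromℕ (suc (n ℕ.+ n)) * ε
        ≡⟨ cong (λ q → q * fromℕ (suc (n ℕ.+ n)) * ε) (fromℕ-homo-* 3 (suc m)) ⟨
      fromℕ (3 ℕ.* suc m) * fromℕ (suc (n ℕ.+ n)) * ε
        ≡⟨ cong (_* ε) (fromℕ-homo-* (3 ℕ.* suc m) (suc (n ℕ.+ n))) ⟨
      fromℕ E * ε
        ≤⟨ ℚ.*-monoʳ-≤-nonNeg ε {{ℚ.nonNegative (ℚ.<⇒≤ 0<ε)}} (fromℕ-mono (ℕ.n≤1+n E)) ⟩
      fromℕ (suc E) * ε
        ≡⟨ trans Eε≡1 (sym nθ≡1) ⟩
      fromℕ (suc (n ℕ.+ n)) * θ ∎)
      where
      open ℚ.≤-Reasoning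
      regroup : ∀ a e c → a * ((e + e + e) * c) ≡ (1ℚ + 1ℚ + 1ℚ) * c * a * e
      regroup = RingSolver.solve-∀ ring

    open Normalise {n} {d} {m} xRow (offset ∘ tag) (normal ∘ tag) InL w₀ L₀ rep (λ w → proj₂ (proj₂ (member w (InL? w)))) U
      (λ w i → trans (xRow≡ (U w) i) (⧺-left (bits w) (y w) i))
      (λ w k → subst (0ℚ <_) (sym (trans (slack≡ (tag k) (U w))
        (slack-cong (tag k) (⧺-left (bits w) (y w)) (⧺-right (bits w) (y w))))) (0<slack (tag k) w))
      θ sound E ε 0<ε Eε≡1 ε-small

  formulation-circuit : ∃[ s ] (s ℕ.≤ separatorSize (n ℕ.+ m) E × Σ[ C ∈ Circuit n s ]
                          (∀ w → InL w ⇔ evalCircuit C w ≡ true))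
  formulation-circuit = circuit

-- The polynomial bound and the assembly over all input lengths

circuitBound : ℕ → ℕ → ℕ
circuitBound n r = separatorSize (n ℕ.+ (r ℕ.+ (r ℕ.+ r))) (precision n (r ℕ.+ (r ℕ.+ r)))

poly-circuitBound : ∀ {p} → IsPolynomial p → IsPolynomial (λ n → circuitBound n (p n))
poly-circuitBound {p} pp = poly-separatorSize {λ n → n ℕ.+ m n} {λ n → precision n (m n)}
  (poly-+ {λ n → n} {m} poly-id pm)
  (poly-* {λ n → 3 ℕ.* suc (m n)} {λ n → suc (n ℕ.+ n)}
    (poly-* {λ _ → 3} {λ n → suc (m n)} (poly-const 3) (poly-suc {m} pm))
    (poly-suc {λ n → n ℕ.+ n} (poly-+ {λ n → n} {λ n → n} poly-id poly-id)))
  where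
  m : ℕ → ℕ
  m n = p n ℕ.+ (p n ℕ.+ p n)
  pm : IsPolynomial m
  pm = poly-+ {p} {λ n → p n ℕ.+ p n} pp (poly-+ {p} {p} pp pp)

slice-circuit : ExcludedMiddle 0ℓ → ∀ (L : Language) n {r} (A : Matrix r n) (B : Matrix r r) (b : ℝ^ r) →
  (∀ {x} → conv (slice L n) x → projection A B b x) → (∀ {x} → projection A B b x → conv (slice L n) x) →
  ∃[ s ] (s ℕ.≤ circuitBound n r × Σ[ C ∈ Circuit n s ] (∀ w → L (toList w) ⇔ evalCircuit C w ≡ true))
slice-circuit em L n {r} A B b conv⊆ ⊆conv = by-cases em
  where
  InL : Vec Bool n → Set
  InL w = L (toList w)
  -- The denominator 2n+1 gives `nθ≤½` and stays positive for n = 0.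
  θ : ℚ
  θ = proj₁ (reciprocal (n ℕ.+ n))
  0<θ : 0ℚ < θ
  0<θ = proj₁ (proj₂ (reciprocal (n ℕ.+ n)))
  nθ≡1 : fromℕ (suc (n ℕ.+ n)) * θ ≡ 1ℚ
  nθ≡1 = proj₂ (proj₂ (reciprocal (n ℕ.+ n)))
  nθ≤½ : fromℕ n * θ ≤ ½
  nθ≤½ = ≤-by (½ * θ) (0≤* 0≤½ (ℚ.<⇒≤ 0<θ)) (begin
    ½                                              ≡⟨ ℚ.*-identityʳ ½ ⟨
    ½ * 1ℚ                                         ≡⟨ cong (½ *_) nθ≡1 ⟨
    ½ * (fromℕ (suc (n ℕ.+ n)) * θ)                ≡⟨ cong (λ q → ½ * (q * θ)) (trans (fromℕ-suc (n ℕ.+ n)) (cong (1ℚ +_) (fromℕ-homo-+ n n))) ⟩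
    ½ * ((1ℚ + (fromℕ n + fromℕ n)) * θ)           ≡⟨ regroup (fromℕ n) θ ⟩
    fromℕ n * θ + ½ * θ                            ∎)
    where
    open ≡-Reasoning
    regroup : ∀ n θ → ½ * ((1ℚ + (n + n)) * θ) ≡ n * θ + ½ * θ
    regroup = RingSolver.solve-∀ ring
  complete : ∀ w → InL w → projection A B b (bitVector w)
  complete w inL = conv⊆ {bitVector w} (conv-extensive {S = slice L n} {bitVector w}
    (w , inL , λ i → ≈-pointwise {bitVector w i} {bitVector w i} (λ _ → refl)))
  far : ∀ w → ¬ InL w → (X : ℝ^ n) → (∀ t j → ∣ seq (X j) t - bit (lookup w j) ∣ ≤ θ) → ¬ projection A B b X
  far w ¬inL X X≈w proj = far-from-hull {L = L} w ¬inL nθ≤½ X X≈w (⊆conv {X} proj)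
  by-cases : Dec (Σ[ w ∈ Vec Bool n ] InL w) →
    ∃[ s ] (s ℕ.≤ circuitBound n r × Σ[ C ∈ Circuit n s ] (∀ w → InL w ⇔ evalCircuit C w ≡ true))
  -- An empty slice offers no starting word for the relaxation; one constant gate decides it.
  by-cases (no none) = 1 , ℕ.s≤s ℕ.z≤n , record { gates = [] ▷ const false ; output = zero } ,
    λ w → mk⇔ (λ inL → ⊥-elim (none (w , inL))) λ ()
  by-cases (yes (w₀ , L₀)) = Formulation.formulation-circuit A B b InL (λ w → em) w₀ L₀ complete θ 0<θ nθ≡1 far em

theorem7 : ExcludedMiddle 0ℓ → CF ⊆ P/poly
theorem7 em {L} (p , p-polynomial , formulation) =
  (λ n → circuitBound n (p n)) , poly-circuitBound {p} p-polynomial , λ n →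
    let A , B , b , conv⊆ , ⊆conv = formulation n in slice-circuit em L n A B b (λ {x} → conv⊆ {x}) (λ {x} → ⊆conv {x})
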